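{- Let $n\ge 3$ and let $S\subseteq\{1,\dots,n-2\}$ with $1\notin S$. Then $b_S(n)>0$.
   Context: $\Pi_n$ is the lattice of set partitions of $\{1,\dots,n\}$ ordered by refinement, with minimum $\hat 0$ (all singletons) and maximum $\hat 1$ (one block); the rank of a partition with $k$ blocks is $n-k$, so the proper part has ranks $1,\dots,n-2$. The symmetric group $S_n$ acts on $\Pi_n$ by permuting $\{1,\dots,n\}$, preserving order and rank, and hence permutes chains. For $T\subseteq\{1,\dots,n-2\}$ let $\alpha_T$ be the permutation representation of $S_n$ (over $\mathbb{C}$) on the set of chains $\hat 0<x_1<\dots<x_k<\hat 1$ whose set of ranks $\{\mathrm{rk}(x_1),\dots,\mathrm{rk}(x_k)\}$ is exactly $T$. For $S\subseteq\{1,\dots,n-2\}$ put $\beta_S=\sum_{T\subseteq S}(-1)^{|S-T|}\alpha_T$ (a virtual representation, which equals the $S_n$-representation on the top reduced homology of the order complex of the rank-selected subposet $\Pi_n^S$ consisting of the elements whose rank lies in $S$). Let $b_S(n)=\langle \beta_S,1\rangle$ denote the multiplicity of the trivial representation of $S_n$ in $\beta_S$. -}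

module Defs where

open import Data.Bool using (Bool; true; false; not; _∧_; _∨_; if_then_else_; _xor_)
open import Data.Nat using (ℕ; zero; suc; _∸_; _!; _≡ᵇ_; _<ᵇ_)
open import Data.Nat.Properties using (_!≢0)
open import Data.Fin using (Fin; toℕ)
open import Data.Fin.Properties using () renaming (_≟_ to _≟F_)
open import Data.Fin.Subset using (Subset; _⊆_; ∣_∣)
open import Data.Fin.Subset.Properties using (_⊆?_)
open import Data.Vec using (Vec; []; _∷_; lookup; tabulate)
open import Data.List using (List; []; _∷_; map; concatMap; filterᵇ; length; allFin; filter)
open import Data.Bool.ListAction using (and)
open import Data.Nat.ListAction using (sum)
open import Data.Integer using (ℤ; +_; -_; _-_) renaming (_+_ to _+ℤ_; _*_ to _*ℤ_)
open import Data.Rational using (ℚ; _/_)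
open import Relation.Nullary.Decidable using (isYes)

allVecs : {A : Set} → List A → (n : ℕ) → List (Vec A n)
allVecs xs zero    = [] ∷ []
allVecs xs (suc n) = concatMap (λ x → map (x ∷_) (allVecs xs n)) xs

allB : {A : Set} → (A → Bool) → List A → Bool
allB p xs = and (map p xs)

∀F : (n : ℕ) → (Fin n → Bool) → Bool
∀F n p = allB p (allFin n)

_==B_ : Bool → Bool → Bool
a ==B b = not (a xor b)

_==F_ : {n : ℕ} → Fin n → Fin n → Bool
i ==F j = isYes (i ≟F j)

_⇒B_ : Bool → Bool → Bool
a ⇒B b = not a ∨ b

-- Set partitions of {1..n} (here Fin n), encoded as equivalence relations
-- given by Boolean n×n matrices: rel x i j = true iff i,j in the same block.

Rel : ℕ → Set
Rel n = Vec (Vec Bool n) n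

rel : {n : ℕ} → Rel n → Fin n → Fin n → Bool
rel x i j = lookup (lookup x i) j

isEquivRel : {n : ℕ} → Rel n → Bool
isEquivRel {n} x =
  ∀F n (λ i → rel x i i) ∧
  ∀F n (λ i → ∀F n (λ j → rel x i j ⇒B rel x j i)) ∧
  ∀F n (λ i → ∀F n (λ j → ∀F n (λ k → (rel x i j ∧ rel x j k) ⇒B rel x i k)))

partitions : (n : ℕ) → List (Rel n)
partitions n = filterᵇ isEquivRel (allVecs (allVecs (true ∷ false ∷ []) n) n)

-- number of blocks: number of i that are the least element of their block
numBlocks : {n : ℕ} → Rel n → ℕ
numBlocks {n} x =
  length (filterᵇ (λ i → ∀F n (λ j → (toℕ j <ᵇ toℕ i) ⇒B not (rel x j i))) (allFin n))

rank : {n : ℕ} → Rel n → ℕ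
rank {n} x = n ∸ numBlocks x

refines : {n : ℕ} → Rel n → Rel n → Bool
refines {n} x y = ∀F n (λ i → ∀F n (λ j → rel x i j ⇒B rel y i j))

-- The symmetric group S_n, as the list of all permutations of Fin n
-- (a permutation σ is the vector (σ 0, …, σ (n-1)) with distinct entries)

isInjective : {n : ℕ} → Vec (Fin n) n → Bool
isInjective {n} σ =
  ∀F n (λ i → ∀F n (λ j → (lookup σ i ==F lookup σ j) ⇒B (i ==F j)))

Sym : (n : ℕ) → List (Vec (Fin n) n)
Sym n = filterᵇ isInjective (allVecs (allFin n) n)

-- x is fixed by σ (σ·x = x, where (σ·x) relates σ i, σ j iff x relates i, j)
fixedBy : {n : ℕ} → Vec (Fin n) n → Rel n → Bool
fixedBy {n} σ x =
  ∀F n (λ i → ∀F n (λ j → rel x (lookup σ i) (lookup σ j) ==B rel x i j))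

-- Chains 0̂ < x₁ < … < x_k < 1̂ with prescribed rank set.
-- A subset S ⊆ {1,…,n-2} is encoded as  Subset (n ∸ 2) , where the
-- index i : Fin (n ∸ 2) stands for the rank  suc (toℕ i).

ranksOf : {m : ℕ} → Subset m → List ℕ
ranksOf {zero}  []            = []
ranksOf {suc m} (true  ∷ T)   = 1 ∷ map suc (ranksOf T)
ranksOf {suc m} (false ∷ T)   = map suc (ranksOf T)

-- chains x₁ < … < x_k with rank(x_i) = r_i for a strictly increasing
-- list r₁ < … < r_k of ranks (strictness of the chain follows from the
-- distinct ranks together with refinement)
chainsWithRanks : (n : ℕ) → List ℕ → List (List (Rel n))
chainsWithRanks n []       = [] ∷ []
chainsWithRanks n (r ∷ rs) =
  concatMap (λ c → map (_∷ c) (filterᵇ (λ x → (rank x ≡ᵇ r) ∧ belowHead x c) (partitions n)))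
            (chainsWithRanks n rs)
  where
  belowHead : Rel n → List (Rel n) → Bool
  belowHead x []      = true
  belowHead x (y ∷ _) = refines x y

chains : (n : ℕ) → Subset (n ∸ 2) → List (List (Rel n))
chains n T = chainsWithRanks n (ranksOf T)

-- character of the permutation representation α_T at σ:
-- the number of chains with rank set T fixed by σ
χα : (n : ℕ) → Subset (n ∸ 2) → Vec (Fin n) n → ℕ
χα n T σ = length (filterᵇ (allB (fixedBy σ)) (chains n T))

sumχα : (n : ℕ) → Subset (n ∸ 2) → ℕ
sumχα n T = sum (map (χα n T) (Sym n))

subsets : (m : ℕ) → List (Subset m)
subsets m = allVecs (true ∷ false ∷ []) m

sign : ℕ → ℤ
sign zero          = + 1
sign (suc zero)    = - (+ 1)
sign (suc (suc k)) = sign k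

-- Σ_{σ ∈ S_n} χ_{β_S}(σ),  β_S = Σ_{T ⊆ S} (-1)^{|S - T|} α_T
sumχβ : (n : ℕ) → Subset (n ∸ 2) → ℤ
sumχβ n S =
  Data.List.foldr _+ℤ_ (+ 0)
    (map (λ T → sign (∣ S ∣ ∸ ∣ T ∣) *ℤ (+ sumχα n T))
         (filter (λ T → T ⊆? S) (subsets (n ∸ 2))))

-- b_S(n) = ⟨β_S , 1⟩ = (1 / |S_n|) Σ_{σ ∈ S_n} χ_{β_S}(σ),  |S_n| = n!
b : (n : ℕ) → Subset (n ∸ 2) → ℚ
b n S = _/_ (sumχβ n S) (n !) {{n !≢0}}

{-# OPTIONS --safe #-}

-- Order the pairs {i,j} as {0,1} first, then the path edges {k,k+1} with k descending, then
-- the rest, and compare partitions lexicographically, those containing early pairs being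
-- small. Call s ∈ S a descent of an S-chain c if the element of c of rank s can be replaced
-- by a smaller one. Between two consecutive descents c is obtained greedily, hence is the
-- lexicographically least filling, so the functions f_c(d) = [c and d agree on the descents
-- of c] are unitriangular, and those with Des c ⊆ T form a basis of the functions depending
-- only on the ranks in T. By inclusion-exclusion the character of β_S at σ is the trace of
-- σ on the quotient spanned by the f_c with Des c = S, for which f_c is the indicator of c.
--
-- The sum over the symmetric group is then the trace of an integer matrix E with
-- E² = |S_n| E, hence positive as soon as E ≠ 0. Let c₀ be the comb chain, whose element of
-- rank r has the single non-trivial block {0,…,r}. If 1 ∉ S, all its ranks are descents. All
-- chains that contribute to the c₀-coordinate of the orbit sum of f_{c₀} consist of
-- partitions into intervals with 0 and 1 in a common block; c₀ is the only such chain in its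
-- orbit, so the diagonal entry of E at c₀ is the order of the stabiliser of c₀.

module Submission where

-- The group does not respect the lexicographic order, so it does not permute the functions f_c, and
-- nothing controls the signs of the averaging matrix E: its trace cannot be estimated entry by
-- entry. What the group does preserve is the span of the f_c with Des c ⊆ T, because this is the
-- space of functions of the ranks in T, described without the order. Hence averaging descends to
-- the quotient, and there the identity for E² replaces any knowledge of signs. The diagonal entry
-- at the comb chain is computable because forward substitution only visits chains that precede it
-- and agree with it, step by step, on their own descents. Two demands on the order of pairs meet
-- here. Preferring late path edges makes prolonging the block of 0 a bad choice, which produces
-- descents. Intervals alone, however, would leave the position of a single block free, and other
-- chains of the same orbit could enter the substitution. Placing {0,1} ahead of everything pins the
-- block to the start, at the price of rank 1: this is where 1 ∉ S is used.

-- Integer sums over lists, and traces of matrices with E² = cE.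

module Sums where
  open import Data.Bool using (Bool; true; false; T?)
  open import Data.Nat as ℕ using (ℕ; suc)
  open import Data.Integer hiding (suc)
  open import Data.Integer.Properties
  open import Data.Integer.Tactic.RingSolver using (solve-∀)
  open import Data.List using (List; []; _∷_; _++_; map; filter; filterᵇ; foldr; length)
  open import Data.Nat.ListAction using (sum)
  open import Data.List.Membership.Propositional using (_∈_; find; lose)
  open import Data.List.Relation.Unary.Any using (Any; here; there; any?)
  open import Data.List.Relation.Unary.All as All using (All; []; _∷_)
  open import Data.List.Relation.Unary.AllPairs using ([]; _∷_)
  open import Data.List.Relation.Unary.Unique.Propositional using (Unique)
  open import Data.Product using (_×_; _,_; ∃-syntax)
  open import Data.Sum using (_⊎_; inj₁; inj₂)
  open import Data.Empty using (⊥-elim)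
  open import Relation.Binary using (DecidableEquality)
  open import Relation.Nullary using (¬_; Dec; yes; no; does; ¬?)
  open import Relation.Binary.PropositionalEquality

  private variable
    A B : Set

  ⟦_⟧ : Bool → ℤ
  ⟦ true ⟧  = 1ℤ
  ⟦ false ⟧ = 0ℤ

  Σ : List A → (A → ℤ) → ℤ
  Σ []       f = 0ℤ
  Σ (x ∷ xs) f = f x + Σ xs f

  Σ-cong : ∀ (xs : List A) {f g} → (∀ {x} → x ∈ xs → f x ≡ g x) → Σ xs f ≡ Σ xs g
  Σ-cong []       e = refl
  Σ-cong (x ∷ xs) e = cong₂ _+_ (e (here refl)) (Σ-cong xs (λ p → e (there p)))

  Σ-ext : ∀ (xs : List A) {f g} → (∀ x → f x ≡ g x) → Σ xs f ≡ Σ xs g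
  Σ-ext xs e = Σ-cong xs (λ {x} _ → e x)

  Σ-zero : ∀ (xs : List A) → Σ xs (λ _ → 0ℤ) ≡ 0ℤ
  Σ-zero []       = refl
  Σ-zero (x ∷ xs) = trans (+-identityˡ _) (Σ-zero xs)

  Σ-const : ∀ (xs : List A) c → Σ xs (λ _ → c) ≡ + length xs * c
  Σ-const []       c = refl
  Σ-const (x ∷ xs) c = trans (cong (_+_ c) (Σ-const xs c)) (sym (suc-* (+ length xs) c))

  Σ-+ : ∀ (xs : List A) f g → Σ xs (λ x → f x + g x) ≡ Σ xs f + Σ xs g
  Σ-+ []       f g = refl
  Σ-+ (x ∷ xs) f g = trans (cong (_+_ (f x + g x)) (Σ-+ xs f g)) (lem (f x) (g x) (Σ xs f) (Σ xs g))
    where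
    lem : ∀ a b c d → a + b + (c + d) ≡ a + c + (b + d)
    lem = solve-∀

  Σ-*ˡ : ∀ (xs : List A) c f → Σ xs (λ x → c * f x) ≡ c * Σ xs f
  Σ-*ˡ []       c f = sym (*-zeroʳ c)
  Σ-*ˡ (x ∷ xs) c f = trans (cong (_+_ (c * f x)) (Σ-*ˡ xs c f)) (sym (*-distribˡ-+ c (f x) (Σ xs f)))

  Σ-*ʳ : ∀ (xs : List A) c f → Σ xs (λ x → f x * c) ≡ Σ xs f * c
  Σ-*ʳ xs c f = trans (Σ-ext xs (λ x → *-comm (f x) c)) (trans (Σ-*ˡ xs c f) (*-comm c _))

  Σ-swap : ∀ (xs : List A) (ys : List B) (f : A → B → ℤ) →
           Σ xs (λ x → Σ ys (f x)) ≡ Σ ys (λ y → Σ xs (λ x → f x y))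
  Σ-swap []       ys f = sym (Σ-zero ys)
  Σ-swap (x ∷ xs) ys f =
    trans (cong (_+_ (Σ ys (f x))) (Σ-swap xs ys f)) (sym (Σ-+ ys (f x) (λ y → Σ xs (λ x → f x y))))

  Σ-++ : ∀ (xs ys : List A) f → Σ (xs ++ ys) f ≡ Σ xs f + Σ ys f
  Σ-++ []       ys f = sym (+-identityˡ _)
  Σ-++ (x ∷ xs) ys f = trans (cong (_+_ (f x)) (Σ-++ xs ys f)) (sym (+-assoc (f x) _ _))

  Σ-map : ∀ (h : A → B) (xs : List A) f → Σ (map h xs) f ≡ Σ xs (λ x → f (h x))
  Σ-map h []       f = refl
  Σ-map h (x ∷ xs) f = cong (_+_ (f (h x))) (Σ-map h xs f)

  Σ-filter : ∀ {P : A → Set} (P? : ∀ x → Dec (P x)) (xs : List A) f →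
             Σ (filter P? xs) f ≡ Σ xs (λ x → ⟦ does (P? x) ⟧ * f x)
  Σ-filter P? []       f = refl
  Σ-filter P? (x ∷ xs) f with does (P? x)
  ... | true  = cong₂ _+_ (sym (*-identityˡ (f x))) (Σ-filter P? xs f)
  ... | false = trans (Σ-filter P? xs f) (sym (+-identityˡ _))

  Σ-filterᵇ : ∀ (p : A → Bool) (xs : List A) f → Σ (filterᵇ p xs) f ≡ Σ xs (λ x → ⟦ p x ⟧ * f x)
  Σ-filterᵇ p = Σ-filter (λ x → T? (p x))

  length-filterᵇ : ∀ (p : A → Bool) xs → + length (filterᵇ p xs) ≡ Σ xs (λ x → ⟦ p x ⟧)
  length-filterᵇ p []       = refl
  length-filterᵇ p (x ∷ xs) with p x
  ... | true  = cong (_+_ 1ℤ) (length-filterᵇ p xs)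
  ... | false = trans (length-filterᵇ p xs) (sym (+-identityˡ _))

  Σ-foldr : ∀ (xs : List A) f → foldr _+_ 0ℤ (map f xs) ≡ Σ xs f
  Σ-foldr []       f = refl
  Σ-foldr (x ∷ xs) f = cong (_+_ (f x)) (Σ-foldr xs f)

  Σ-sum : ∀ (xs : List A) (f : A → ℕ) → + sum (map f xs) ≡ Σ xs (λ x → + f x)
  Σ-sum []       f = refl
  Σ-sum (x ∷ xs) f = cong (_+_ (+ f x)) (Σ-sum xs f)

  Σ-nonneg : ∀ (xs : List A) {f} → (∀ x → 0ℤ ≤ f x) → 0ℤ ≤ Σ xs f
  Σ-nonneg []       p = ≤-refl
  Σ-nonneg (x ∷ xs) p = +-mono-≤ (p x) (Σ-nonneg xs p)

  Σ-pos : ∀ {xs : List A} {f} → (∀ x → 0ℤ ≤ f x) → ∀ {x} → x ∈ xs → 0ℤ < f x → 0ℤ < Σ xs f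
  Σ-pos {xs = _ ∷ xs} p (here refl) q = +-mono-<-≤ q (Σ-nonneg xs p)
  Σ-pos {xs = y ∷ _}  p (there i)   q = +-mono-≤-< (p y) (Σ-pos p i q)

  ⟦⟧-nonneg : ∀ b → 0ℤ ≤ ⟦ b ⟧
  ⟦⟧-nonneg true  = +≤+ ℕ.z≤n
  ⟦⟧-nonneg false = +≤+ ℕ.z≤n

  does-true : (d : Dec A) → A → does d ≡ true
  does-true (yes _) a = refl
  does-true (no ¬a) a = ⊥-elim (¬a a)

  does-false : (d : Dec A) → ¬ A → does d ≡ false
  does-false (yes a) ¬a = ⊥-elim (¬a a)
  does-false (no _)  ¬a = refl

  does-⇔ : (d : Dec A) (e : Dec B) → (A → B) → (B → A) → does d ≡ does e
  does-⇔ (yes a) e f g = sym (does-true e (f a))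
  does-⇔ (no ¬a) e f g = sym (does-false e (λ b → ¬a (g b)))

  Σ-single : ∀ {xs : List A} → Unique xs → ∀ {a} → a ∈ xs → (f : A → ℤ) →
             (∀ {x} → x ∈ xs → x ≢ a → f x ≡ 0ℤ) → Σ xs f ≡ f a
  Σ-single {xs = x ∷ xs} (x∉ ∷ u) (here refl) f z =
    trans (cong (_+_ (f x)) (trans (Σ-cong xs (λ i → z (there i) (λ e → All.lookup x∉ i (sym e)))) (Σ-zero xs)))
          (+-identityʳ (f x))
  Σ-single {xs = x ∷ xs} (x∉ ∷ u) (there i) f z =
    trans (cong₂ _+_ (z (here refl) (All.lookup x∉ i)) (Σ-single u i f (λ j → z (there j)))) (+-identityˡ _)

  Σ-δ : (_≟_ : DecidableEquality A) → ∀ {xs} → Unique xs → ∀ {a} → a ∈ xs → (f : A → ℤ) →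
        Σ xs (λ x → ⟦ does (a ≟ x) ⟧ * f x) ≡ f a
  Σ-δ _≟_ u {a} i f =
    trans (Σ-single u i (λ x → ⟦ does (a ≟ x) ⟧ * f x) (λ {x} _ x≢a → cong (λ b → ⟦ b ⟧ * f x) (does-false (a ≟ x) (λ e → x≢a (sym e)))))
          (trans (cong (λ b → ⟦ b ⟧ * f a) (does-true (a ≟ a) refl)) (*-identityˡ (f a)))

  -- Writing `h (s x)` as a sum over `ys` against a Kronecker delta and exchanging the sums leaves
  -- exactly one `x` for each `y`.
  Σ-reindex : DecidableEquality B → ∀ {xs : List A} {ys : List B} → Unique xs → Unique ys → (s : A → B) →
              (∀ {x} → x ∈ xs → s x ∈ ys) →
              (∀ {x x′} → x ∈ xs → x′ ∈ xs → s x ≡ s x′ → x ≡ x′) →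
              (∀ {y} → y ∈ ys → ∃[ x ] (x ∈ xs × s x ≡ y)) →
              (h : B → ℤ) → Σ xs (λ x → h (s x)) ≡ Σ ys h
  Σ-reindex _≟_ {xs} {ys} u v s s∈ inj surj h =
    trans (Σ-cong xs (λ i → sym (Σ-δ _≟_ v (s∈ i) h)))
    (trans (Σ-swap xs ys (λ x y → ⟦ does (s x ≟ y) ⟧ * h y))
    (Σ-cong ys (λ {y} j →
      let x₀ , i₀ , e₀ = surj j in
      trans (Σ-single u i₀ (λ x → ⟦ does (s x ≟ y) ⟧ * h y)
              (λ {x} i x≢ → cong (λ b → ⟦ b ⟧ * h y)
                 (does-false (s x ≟ y) (λ e → x≢ (inj i i₀ (trans e (sym e₀)))))))
            (trans (cong (λ b → ⟦ b ⟧ * h y) (does-true (s x₀ ≟ y) e₀)) (*-identityˡ (h y))))))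

  -- The trace of a matrix with E² = cE is c times a natural number: subtracting a
  -- multiple of the rank-one matrix E e_l e_kᵀ E clears row k and lowers the trace by c.
  module Trace {A : Set} (ds : List A) where

    QuasiIdempotent : ℤ → (A → A → ℤ) → Set
    QuasiIdempotent c E = ∀ {z x} → z ∈ ds → x ∈ ds → Σ ds (λ y → E z y * E y x) ≡ c * E z x

    tr : (A → A → ℤ) → ℤ
    tr E = Σ ds (λ x → E x x)

    -- Multiplied through by the pivot `E k l` instead of divided by it, so that all entries stay
    -- integral; the constant `c` picks up the same factor.
    reduce : (A → A → ℤ) → A → A → A → A → ℤ
    reduce E k l z x = E k l * E z x - E z l * E k x

    reduce-quasi : ∀ c E {k l} → QuasiIdempotent c E → k ∈ ds → l ∈ ds →
                   QuasiIdempotent (c * E k l) (reduce E k l)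
    reduce-quasi c E {k} {l} q ik il {z} {x} iz ix =
      trans (Σ-ext ds (λ y → expand e (E z y) (E z l) (E k y) (E y x) (E y l) (E k x)))
      (trans (Σ-+ ds (λ y → e * e * (E z y * E y x) + (- (e * E k x)) * (E z y * E y l)) _)
      (trans (cong₂ _+_
               (trans (Σ-+ ds (λ y → e * e * (E z y * E y x)) _)
                 (cong₂ _+_ (pull (e * e) z x iz ix) (pull (- (e * E k x)) z l iz il)))
               (trans (Σ-+ ds (λ y → (- (e * E z l)) * (E k y * E y x)) _)
                 (cong₂ _+_ (pull (- (e * E z l)) k x ik ix) (pull (E z l * E k x) k l ik il))))
             (collect c e (E z x) (E z l) (E k x))))
      where
      e = E k l
      pull : ∀ a u w → u ∈ ds → w ∈ ds → Σ ds (λ y → a * (E u y * E y w)) ≡ a * (c * E u w)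
      pull a u w iu iw = trans (Σ-*ˡ ds a _) (cong (a *_) (q iu iw))
      expand : ∀ e zy zl ky yx yl kx →
        (e * zy - zl * ky) * (e * yx - yl * kx) ≡
        e * e * (zy * yx) + (- (e * kx)) * (zy * yl) + ((- (e * zl)) * (ky * yx) + zl * kx * (ky * yl))
      expand = solve-∀
      collect : ∀ c e zx zl kx →
        e * e * (c * zx) + (- (e * kx)) * (c * zl) + ((- (e * zl)) * (c * kx) + zl * kx * (c * e)) ≡
        c * e * (e * zx - zl * kx)
      collect = solve-∀

    -- The subtracted matrix has trace `Σ E k x * E x l`, the entry of E² at `k`, `l`, which is
    -- `c * E k l`.
    reduce-tr : ∀ c E {k l} → QuasiIdempotent c E → k ∈ ds → l ∈ ds →
                tr (reduce E k l) ≡ E k l * (tr E - c)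
    reduce-tr c E {k} {l} q ik il =
      trans (Σ-ext ds (λ x → expand (E k l) (E x x) (E x l) (E k x)))
      (trans (Σ-+ ds (λ x → E k l * E x x) _)
      (trans (cong₂ _+_ (Σ-*ˡ ds (E k l) _)
                (trans (Σ-*ˡ ds (- 1ℤ) _) (cong (- 1ℤ *_) (q ik il))))
             (collect (E k l) (tr E) c)))
      where
      expand : ∀ e xx xl kx → e * xx - xl * kx ≡ e * xx + - 1ℤ * (kx * xl)
      expand = solve-∀
      collect : ∀ e t c → e * t + - 1ℤ * (c * e) ≡ e * (t - c)
      collect = solve-∀

    tr-step : ∀ c E {k l} → QuasiIdempotent c E → k ∈ ds → l ∈ ds → E k l ≢ 0ℤ →
              (r : ℕ) → tr (reduce E k l) ≡ c * E k l * + r → tr E ≡ c * + suc r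
    tr-step c E {k} {l} q ik il e≢0 r eq =
      *-cancelˡ-≡ (E k l) _ _ ⦃ ≢-nonZero e≢0 ⦄
        (trans (shift (E k l) (tr E) c)
          (trans (cong (_+ E k l * c) (trans (sym (reduce-tr c E q ik il)) eq)) (collect (E k l) c (+ r))))
      where
      shift : ∀ e t c → e * t ≡ e * (t - c) + e * c
      shift = solve-∀
      collect : ∀ e c r → c * e * r + e * c ≡ e * (c * (1ℤ + r))
      collect = solve-∀

    -- `rows` lists the rows that may still be non-zero; each round removes one of them. The
    -- constant `c` has to vary in the induction, and its sign is left open because pivots may be
    -- negative.
    tr-multiple : ∀ (rows : List A) c E → QuasiIdempotent c E → All (_∈ ds) rows →
                  (∀ {z x} → z ∈ ds → x ∈ ds → z ∈ rows ⊎ E z x ≡ 0ℤ) →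
                  ∃[ r ] tr E ≡ c * + r
    tr-multiple [] c E q _ zr = 0 , trans (trans (Σ-cong ds (λ i → zero-row (zr i i))) (Σ-zero ds)) (sym (*-zeroʳ c))
      where
      zero-row : ∀ {z x} → z ∈ [] ⊎ E z x ≡ 0ℤ → E z x ≡ 0ℤ
      zero-row (inj₂ e) = e
    tr-multiple (k ∷ rows) c E q (ik ∷ irs) zr with any? (λ l → ¬? (E k l ≟ 0ℤ)) ds
    ... | yes p =
      let l , il , e≢0 = find p
          r , eq = tr-multiple rows (c * E k l) (reduce E k l) (reduce-quasi c E q ik il) irs (rows′ l il)
      in suc r , tr-step c E q ik il e≢0 r eq
      where
      vanish : ∀ e zx zl kx → zx ≡ 0ℤ → zl ≡ 0ℤ → e * zx - zl * kx ≡ 0ℤ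
      vanish e _ _ kx refl refl = lem e kx
        where
        lem : ∀ e kx → e * 0ℤ - 0ℤ * kx ≡ 0ℤ
        lem = solve-∀
      self : ∀ a b → a * b - a * b ≡ 0ℤ
      self = solve-∀
      rows′ : ∀ l → l ∈ ds → ∀ {z x} → z ∈ ds → x ∈ ds → z ∈ rows ⊎ reduce E k l z x ≡ 0ℤ
      rows′ l il {z} {x} iz ix with zr iz ix | zr iz il
      ... | inj₁ (here refl) | _ = inj₂ (self (E k l) (E k x))
      ... | inj₁ (there i)   | _ = inj₁ i
      ... | inj₂ _ | inj₁ (here refl) = inj₂ (self (E k l) (E k x))
      ... | inj₂ _ | inj₁ (there i) = inj₁ i
      ... | inj₂ e | inj₂ e′ = inj₂ (vanish (E k l) (E z x) (E z l) (E k x) e e′)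
    ... | no ¬p = tr-multiple rows c E q irs rows′
      where
      none : ∀ {xs : List A} {x} → ¬ Any (λ l → ¬ E k l ≡ 0ℤ) xs → x ∈ xs → E k x ≡ 0ℤ
      none {x = x} ¬q i with E k x ≟ 0ℤ
      ... | yes e = e
      ... | no ne = ⊥-elim (¬q (lose i ne))
      rows′ : ∀ {z x} → z ∈ ds → x ∈ ds → z ∈ rows ⊎ E z x ≡ 0ℤ
      rows′ iz ix with zr iz ix
      ... | inj₁ (here refl) = inj₂ (none ¬p ix)
      ... | inj₁ (there i)   = inj₁ i
      ... | inj₂ e           = inj₂ e

    -- Pivoting on the given non-zero entry guarantees at least one reduction, so the natural number
    -- in front of `c` is a successor.
    tr-positive : ∀ c E {k} → QuasiIdempotent c E → k ∈ ds → E k k ≢ 0ℤ → 0ℤ < c → 0ℤ < tr E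
    tr-positive c E {k} q ik e≢0 c>0
      with tr-multiple ds (c * E k k) (reduce E k k) (reduce-quasi c E q ik ik)
             (All.tabulate (λ i → i)) (λ i _ → inj₁ i)
    ... | r , eq = subst (0ℤ <_) (sym (tr-step c E q ik ik e≢0 r eq)) (scaled c>0)
      where
      scaled : ∀ {c} → 0ℤ < c → 0ℤ < c * + suc r
      scaled (+<+ (ℕ.s≤s _)) = +<+ (ℕ.s≤s ℕ.z≤n)

-- Boolean masks and Möbius inversion over them.

module Masks where
  open Sums
  open import Defs
  open import Data.Bool using (Bool; true; false; _∧_)
  open import Data.Nat using (ℕ; zero; suc)
  open import Data.Integer hiding (suc)
  open import Data.Integer.Properties
  open import Data.List using (List; []; _∷_; map)
  open import Data.List.Properties using (++-identityʳ)
  open import Data.Vec using (Vec; []; _∷_)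
  open import Relation.Binary.PropositionalEquality

  infix 4 _≼_

  Mask : ℕ → Set
  Mask = Vec Bool

  masks : ∀ k → List (Mask k)
  masks = allVecs (true ∷ false ∷ [])

  _≼_ : ∀ {k} → Mask k → Mask k → Bool
  []      ≼ []      = true
  (b ∷ p) ≼ (c ∷ q) = (b ⇒B c) ∧ (p ≼ q)

  isFull : ∀ {k} → Mask k → Bool
  isFull []      = true
  isFull (b ∷ m) = b ∧ isFull m

  -- The sign (-1)^|S - T| when the mask is the indicator of T inside S.
  sgn : ∀ {k} → Mask k → ℤ
  sgn []          = 1ℤ
  sgn (true ∷ m)  = sgn m
  sgn (false ∷ m) = - sgn m

  ≼-refl : ∀ {k} (p : Mask k) → (p ≼ p) ≡ true
  ≼-refl []          = refl
  ≼-refl (true ∷ p)  = ≼-refl p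
  ≼-refl (false ∷ p) = ≼-refl p

  full-≼ : ∀ {k} (p q : Mask k) → isFull p ≡ true → (p ≼ q) ≡ true → isFull q ≡ true
  full-≼ []         []         f l = refl
  full-≼ (true ∷ p) (true ∷ q) f l = full-≼ p q f l

  Σ-masks : ∀ k (f : Mask (suc k) → ℤ) →
            Σ (masks (suc k)) f ≡ Σ (masks k) (λ m → f (true ∷ m)) + Σ (masks k) (λ m → f (false ∷ m))
  Σ-masks k f =
    trans (Σ-++ (map (true ∷_) (masks k)) _ f)
      (cong₂ _+_ (Σ-map (true ∷_) (masks k) f)
        (trans (cong (λ l → Σ l f) (++-identityʳ (map (false ∷_) (masks k)))) (Σ-map (false ∷_) (masks k) f)))

  -- A `false` in `D` leaves that coordinate of `m` free, and its two values cancel.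
  Σ-sgn-≼ : ∀ k (D : Mask k) → Σ (masks k) (λ m → sgn m * ⟦ D ≼ m ⟧) ≡ ⟦ isFull D ⟧
  Σ-sgn-≼ zero    []          = refl
  Σ-sgn-≼ (suc k) (true ∷ D)  =
    trans (Σ-masks k (λ m → sgn m * ⟦ (true ∷ D) ≼ m ⟧))
      (trans (cong₂ _+_ (Σ-sgn-≼ k D)
                (trans (Σ-ext (masks k) (λ m → *-zeroʳ (- sgn m))) (Σ-zero (masks k))))
             (+-identityʳ _))
  Σ-sgn-≼ (suc k) (false ∷ D) =
    trans (Σ-masks k (λ m → sgn m * ⟦ (false ∷ D) ≼ m ⟧))
      (trans (cong (_+_ s)
                (trans (Σ-ext (masks k) (λ m → trans (sym (neg-distribˡ-* (sgn m) _)) (sym (-1*i≡-i (sgn m * ⟦ D ≼ m ⟧)))))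
                       (trans (Σ-*ˡ (masks k) -1ℤ _) (-1*i≡-i s))))
             (+-inverseʳ s))
    where s = Σ (masks k) (λ m → sgn m * ⟦ D ≼ m ⟧)

-- A unitriangular basis adapted to descents, and the trace of a group average in it.

module Adapted where
  open Sums
  open Masks
  open import Data.Bool using (Bool; true; false; T?)
  open import Data.Bool.Properties using (T-≡)
  open import Function.Bundles using (Equivalence)
  open import Data.Nat as ℕ using (ℕ; zero; suc)
  import Data.Nat.Properties as ℕ
  open import Data.Integer hiding (suc)
  open import Data.Integer.Properties
  open import Data.Integer.Tactic.RingSolver using (solve-∀)
  open import Data.List using (List; []; _∷_; filterᵇ; length)
  open import Data.List.Membership.Propositional using (_∈_)
  open import Data.List.Membership.Propositional.Properties using (∈-filter⁺; ∈-filter⁻)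
  open import Data.List.Relation.Unary.Any using (here; there)
  open import Data.List.Relation.Unary.Unique.Propositional using (Unique)
  open import Data.Product using (_×_; _,_; ∃-syntax; proj₁; proj₂)
  open import Data.Sum using (_⊎_; inj₁; inj₂)
  open import Data.Empty using (⊥-elim)
  open import Relation.Binary using (DecidableEquality)
  open import Relation.Nullary using (¬_; Dec; yes; no; does)
  open import Relation.Binary.PropositionalEquality

  guard : ∀ {P : Set} {a b} (d : Dec P) → (P → a ≡ b) → ⟦ does d ⟧ * a ≡ ⟦ does d ⟧ * b
  guard (yes p) h = cong (1ℤ *_) (h p)
  guard (no _)  h = refl

  guardᵇ : ∀ {a b} (c : Bool) → (c ≡ true → a ≡ b) → ⟦ c ⟧ * a ≡ ⟦ c ⟧ * b
  guardᵇ true  h = cong (1ℤ *_) (h refl)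
  guardᵇ false h = refl

  guard-zero : ∀ {P : Set} {a} (d : Dec P) → (P → a ≡ 0ℤ) → ⟦ does d ⟧ * a ≡ 0ℤ
  guard-zero d h = trans (guard d h) (*-zeroʳ ⟦ does d ⟧)

  -- The functions f x = [ · agrees with x on Des x ] are unitriangular for psi, so
  -- every φ is uniquely Σ_x g φ x · f x; if φ depends only on the coordinates in m, then
  -- only the x with Des x ≼ m contribute.
  module Expansion {X Y : Set} (_≟X_ : DecidableEquality X) (_≟Y_ : DecidableEquality Y)
    (xs : List X) (xs-unique : Unique xs) (k : ℕ)
    (sel : Mask k → X → Y) (Des : X → Mask k) (psi : X → ℕ)
    (sel-mono : ∀ {m m′ x y} → (m ≼ m′) ≡ true → x ∈ xs → y ∈ xs → sel m′ x ≡ sel m′ y → sel m x ≡ sel m y)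
    (lower : ∀ {m x} → x ∈ xs → (Des x ≼ m) ≡ false →
             ∃[ x′ ] (x′ ∈ xs × sel m x′ ≡ sel m x × psi x′ ℕ.< psi x))
    (least : ∀ {x y} → x ∈ xs → y ∈ xs → sel (Des x) x ≡ sel (Des x) y → x ≡ y ⊎ psi x ℕ.< psi y)
    where

    agrees? : ∀ y x → Dec (sel (Des y) y ≡ sel (Des y) x)
    agrees? y x = sel (Des y) y ≟Y sel (Des y) x

    f : X → X → ℤ
    f y x = ⟦ does (agrees? y x) ⟧

    below : X → X → ℤ
    below y x = ⟦ does (psi y ℕ.<? psi x) ⟧

    -- Forward substitution for the unitriangular system `φ x = Σ_y f y x * g φ y`. The first
    -- argument is fuel, sufficient as soon as it exceeds `psi x`.
    G : ℕ → (X → ℤ) → X → ℤ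
    G zero    φ x = 0ℤ
    G (suc b) φ x = φ x - Σ xs (λ y → below y x * (f y x * G b φ y))

    g : (X → ℤ) → X → ℤ
    g φ x = G (suc (psi x)) φ x

    G-stable : ∀ a b φ x → psi x ℕ.< a → psi x ℕ.< b → G a φ x ≡ G b φ x
    G-stable (suc a) (suc b) φ x p q = cong (_-_ (φ x)) (Σ-ext xs (λ y →
      guard (psi y ℕ.<? psi x) (λ r → cong (f y x *_)
        (G-stable a b φ y (ℕ.<-≤-trans r (ℕ.s≤s⁻¹ p)) (ℕ.<-≤-trans r (ℕ.s≤s⁻¹ q))))))

    g-unfold : ∀ φ x → g φ x ≡ φ x - Σ xs (λ y → below y x * (f y x * g φ y))
    g-unfold φ x = cong (_-_ (φ x)) (Σ-ext xs (λ y →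
      guard (psi y ℕ.<? psi x) (λ r → cong (f y x *_) (G-stable _ _ φ y r (ℕ.n<1+n _)))))

    expand : ∀ φ {x} → x ∈ xs → Σ xs (λ y → f y x * g φ y) ≡ φ x
    expand φ {x} ix =
      trans (Σ-cong xs (λ {y} iy → split (agrees? y x) (x ≟X y) (psi y ℕ.<? psi x) (least iy ix)
               (λ { refl → refl }) (λ { refl → ℕ.<-irrefl refl }) (g φ y)))
      (trans (Σ-+ xs (λ y → ⟦ does (x ≟X y) ⟧ * g φ y) (λ y → below y x * (f y x * g φ y)))
      (trans (cong (_+ rest) (trans (Σ-δ _≟X_ xs-unique ix (g φ)) (g-unfold φ x)))
             (cancel (φ x) rest)))
      where
      rest = Σ xs (λ y → below y x * (f y x * g φ y))
      cancel : ∀ a b → a - b + b ≡ a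
      cancel = solve-∀
      split : ∀ {P Q : Set} {y} (d : Dec P) (e : Dec (x ≡ y)) (l : Dec Q) → (P → y ≡ x ⊎ Q) →
              (x ≡ y → P) → (x ≡ y → ¬ Q) → ∀ a →
              ⟦ does d ⟧ * a ≡ ⟦ does e ⟧ * a + ⟦ does l ⟧ * (⟦ does d ⟧ * a)
      split (yes p) (yes e) (yes l) _ _ h a = ⊥-elim (h e l)
      split (yes p) (yes e) (no ¬l) _ _ _ a = sym (+-identityʳ _)
      split (yes p) (no ¬e) (yes l) _ _ _ a = sym (trans (+-identityˡ _) (*-identityˡ _))
      split (yes p) (no ¬e) (no ¬l) h _ _ a with h p
      ... | inj₁ e = ⊥-elim (¬e (sym e))
      ... | inj₂ l = ⊥-elim (¬l l)
      split (no ¬p) (yes e) _ _ h _ a = ⊥-elim (¬p (h e))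
      split (no ¬p) (no ¬e) l _ _ _ a = sym (trans (+-identityˡ _) (*-zeroʳ ⟦ does l ⟧))

    G-cong : ∀ b {φ φ′} → (∀ {x} → x ∈ xs → φ x ≡ φ′ x) → ∀ {x} → x ∈ xs → G b φ x ≡ G b φ′ x
    G-cong zero    e ix = refl
    G-cong (suc b) e {x} ix = cong₂ _-_ (e ix) (Σ-cong xs (λ {y} iy →
      cong (λ h → below y x * (f y x * h)) (G-cong b e iy)))

    g-cong : ∀ {φ φ′} → (∀ {x} → x ∈ xs → φ x ≡ φ′ x) → ∀ {x} → x ∈ xs → g φ x ≡ g φ′ x
    g-cong e {x} ix = G-cong (suc (psi x)) e ix

    G-linear : ∀ {I : Set} (ts : List I) (a : I → ℤ) (φ : I → X → ℤ) b x →
               G b (λ x → Σ ts (λ t → a t * φ t x)) x ≡ Σ ts (λ t → a t * G b (φ t) x)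
    G-linear ts a φ zero    x = sym (trans (Σ-ext ts (λ t → *-zeroʳ (a t))) (Σ-zero ts))
    G-linear ts a φ (suc b) x = sym
      (trans (Σ-ext ts (λ t → dist (a t) (φ t x) (inner t)))
      (trans (Σ-+ ts (λ t → a t * φ t x) (λ t → -1ℤ * (a t * inner t)))
      (trans (cong (_+_ (Σ ts (λ t → a t * φ t x))) (trans (Σ-*ˡ ts -1ℤ (λ t → a t * inner t)) (-1*i≡-i _)))
             (cong (λ w → Σ ts (λ t → a t * φ t x) - w) exchange))))
      where
      inner : _ → ℤ
      inner t = Σ xs (λ y → below y x * (f y x * G b (φ t) y))
      dist : ∀ a p q → a * (p - q) ≡ a * p + -1ℤ * (a * q)
      dist = solve-∀
      move : ∀ a w v h → a * (w * (v * h)) ≡ w * v * (a * h)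
      move = solve-∀
      exchange : Σ ts (λ t → a t * inner t) ≡
                 Σ xs (λ y → below y x * (f y x * G b (λ x → Σ ts (λ t → a t * φ t x)) y))
      exchange =
        trans (Σ-ext ts (λ t → sym (Σ-*ˡ xs (a t) (λ y → below y x * (f y x * G b (φ t) y)))))
        (trans (Σ-swap ts xs (λ t y → a t * (below y x * (f y x * G b (φ t) y))))
        (Σ-ext xs (λ y →
          trans (Σ-ext ts (λ t → move (a t) (below y x) (f y x) (G b (φ t) y)))
          (trans (Σ-*ˡ ts (below y x * f y x) (λ t → a t * G b (φ t) y))
          (trans (cong (below y x * f y x *_) (sym (G-linear ts a φ b y))) (*-assoc (below y x) _ _))))))

    g-linear : ∀ {I : Set} (ts : List I) (a : I → ℤ) (φ : I → X → ℤ) x →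
               g (λ x → Σ ts (λ t → a t * φ t x)) x ≡ Σ ts (λ t → a t * g (φ t) x)
    g-linear ts a φ x = G-linear ts a φ (suc (psi x)) x

    g-Σ : ∀ {I : Set} (ts : List I) (φ : I → X → ℤ) {x} → x ∈ xs →
          g (λ x → Σ ts (λ t → φ t x)) x ≡ Σ ts (λ t → g (φ t) x)
    g-Σ ts φ {x} ix =
      trans (g-cong (λ {y} _ → Σ-ext ts (λ t → sym (*-identityˡ (φ t y)))) ix)
      (trans (g-linear ts (λ _ → 1ℤ) φ x) (Σ-ext ts (λ t → *-identityˡ (g (φ t) x))))

    DependsOn : Mask k → (X → ℤ) → Set
    DependsOn m φ = ∀ {x y} → x ∈ xs → y ∈ xs → sel m x ≡ sel m y → φ x ≡ φ y

    f-cong : ∀ {m y x x′} → (Des y ≼ m) ≡ true → x ∈ xs → x′ ∈ xs → sel m x ≡ sel m x′ → f y x ≡ f y x′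
    f-cong {m} {y} {x} {x′} l ix ix′ e =
      cong ⟦_⟧ (does-⇔ (agrees? y x) (agrees? y x′) (λ p → trans p e′) (λ p → trans p (sym e′)))
      where e′ = sel-mono l ix ix′ e

    -- Compare the expansions of `φ` at `x` and at the smaller `x′` of the same `m`-class. A term
    -- `y` below `x` either has `Des y ≼ m`, and `f y` takes the same value at both, or has
    -- coefficient zero by induction; a `y` not below `x` does not reach `x′`. So the coefficient at
    -- `x` is `φ x - φ x′ = 0`.
    g-vanish : ∀ m φ → DependsOn m φ → ∀ {x} → x ∈ xs → (Des x ≼ m) ≡ false → g φ x ≡ 0ℤ
    g-vanish m φ dep {x} ix = go (suc (psi x)) ix ℕ.≤-refl
      where
      go : ∀ b {x} → x ∈ xs → psi x ℕ.< b → (Des x ≼ m) ≡ false → g φ x ≡ 0ℤ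
      go (suc b) {x} ix x<b ¬l =
        trans (g-unfold φ x)
        (trans (cong (_-_ (φ x)) (trans (sym (Σ-cong xs (λ iy → term iy))) (trans (expand φ ix′) (dep ix′ ix e))))
               (+-inverseʳ (φ x)))
        where
        low = lower ix ¬l
        x′ = proj₁ low
        ix′ = proj₁ (proj₂ low)
        e = proj₁ (proj₂ (proj₂ low))
        x′<x = proj₂ (proj₂ (proj₂ low))
        smaller : ∀ {y} → y ∈ xs → (sel (Des y) y ≡ sel (Des y) x′) → psi y ℕ.< psi x
        smaller iy p with least iy ix′ p
        ... | inj₁ refl = x′<x
        ... | inj₂ q    = ℕ.<-trans q x′<x
        term′ : ∀ {y} → y ∈ xs → psi y ℕ.< psi x → (c : Bool) → (Des y ≼ m) ≡ c → f y x′ * g φ y ≡ f y x * g φ y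
        term′ {y} iy y<x true  l = cong (_* g φ y) (f-cong l ix′ ix e)
        term′ {y} iy y<x false l =
          trans (cong (f y x′ *_) z) (trans (*-zeroʳ (f y x′)) (sym (trans (cong (f y x *_) z) (*-zeroʳ (f y x)))))
          where z = go b iy (ℕ.<-≤-trans y<x (ℕ.s≤s⁻¹ x<b)) l
        term″ : ∀ {y} → y ∈ xs → (d : Dec (psi y ℕ.< psi x)) → f y x′ * g φ y ≡ ⟦ does d ⟧ * (f y x * g φ y)
        term″ iy (yes p) = trans (term′ iy p _ refl) (sym (*-identityˡ _))
        term″ {y} iy (no ¬p) = cong (λ c → ⟦ c ⟧ * g φ y) (does-false (agrees? y x′) (λ p → ¬p (smaller iy p)))
        term : ∀ {y} → y ∈ xs → f y x′ * g φ y ≡ below y x * (f y x * g φ y)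
        term {y} iy = term″ iy (psi y ℕ.<? psi x)

    -- Each use of `lower` decreases `psi`, so the descent ends at an element of the class without
    -- descents outside `m`. Together with uniqueness, the basis functions with `Des d ≼ m` are
    -- matched with the `m`-classes.
    representative : ∀ m {x} → x ∈ xs → ∃[ d ] (d ∈ xs × (Des d ≼ m) ≡ true × sel m d ≡ sel m x)
    representative m {x} ix = go (suc (psi x)) ix ℕ.≤-refl
      where
      go : ∀ b {x} → x ∈ xs → psi x ℕ.< b → ∃[ d ] (d ∈ xs × (Des d ≼ m) ≡ true × sel m d ≡ sel m x)
      go (suc b) {x} ix x<b with Des x ≼ m in l
      ... | true  = x , ix , l , refl
      ... | false =
        let x′ , ix′ , e , lt = lower ix l
            d , id , l′ , e′ = go b ix′ (ℕ.<-≤-trans lt (ℕ.s≤s⁻¹ x<b))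
        in d , id , l′ , trans e′ e

    representative-unique : ∀ m {x y} → x ∈ xs → y ∈ xs → (Des x ≼ m) ≡ true → (Des y ≼ m) ≡ true →
                            sel m x ≡ sel m y → x ≡ y
    representative-unique m ix iy lx ly e
      with least ix iy (sel-mono lx ix iy e) | least iy ix (sel-mono ly iy ix (sym e))
    ... | inj₁ p | _      = p
    ... | _      | inj₁ p = sym p
    ... | inj₂ p | inj₂ q = ⊥-elim (ℕ.<-asym p q)

    -- Both sides are the trace of φ ↦ φ ∘ σ on the functions depending only on m,
    -- in the basis (f x) and in the basis of indicators.
    trace-restricted : ∀ m (σ : X → X) → (∀ {x} → x ∈ xs → σ x ∈ xs) →
      (∀ {x y} → x ∈ xs → y ∈ xs → sel m x ≡ sel m y → sel m (σ x) ≡ sel m (σ y)) →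
      Σ xs (λ x → ⟦ Des x ≼ m ⟧ * g (λ y → f x (σ y)) x) ≡
      Σ xs (λ x → ⟦ Des x ≼ m ⟧ * ⟦ does (sel m x ≟Y sel m (σ x)) ⟧)
    trace-restricted m σ σ∈ σ-sel =
      trans (Σ-cong xs (λ {x} ix →
               trans (guardᵇ (Des x ≼ m) (λ l → row ix l))
                     (trans (sym (Σ-*ˡ xs ⟦ Des x ≼ m ⟧ (λ d → ⟦ Des d ≼ m ⟧ * f x d * g (δσ d) x)))
                            (Σ-cong xs (λ {d} id → drop ix id _ refl)))))
      (trans (Σ-swap xs xs (λ x d → ⟦ Des d ≼ m ⟧ * (f x d * g (δσ d) x)))
      (Σ-cong xs (λ {d} id →
        trans (Σ-*ˡ xs ⟦ Des d ≼ m ⟧ (λ x → f x d * g (δσ d) x))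
              (cong (⟦ Des d ≼ m ⟧ *_) (expand (δσ d) id)))))
      where
      δσ : X → X → ℤ
      δσ d y = ⟦ does (sel m d ≟Y sel m (σ y)) ⟧
      δσ-dep : ∀ d → DependsOn m (δσ d)
      δσ-dep d {x} {y} ix iy e = cong (λ v → ⟦ does (sel m d ≟Y v) ⟧) (σ-sel ix iy e)
      -- `f x` is constant on `m`-classes, hence a combination of their indicators, one for each
      -- representative `d`.
      decompose : ∀ {x y} → (Des x ≼ m) ≡ true → y ∈ xs →
        f x y ≡ Σ xs (λ d → ⟦ Des d ≼ m ⟧ * f x d * ⟦ does (sel m d ≟Y sel m y) ⟧)
      decompose {x} {y} l iy = sym
        (trans (Σ-single xs-unique id₀ (λ d → ⟦ Des d ≼ m ⟧ * f x d * ⟦ does (sel m d ≟Y sel m y) ⟧)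
                  (λ {d} id d≢ → off id d≢ _ refl))
        (trans (cong₂ (λ p q → ⟦ p ⟧ * f x d₀ * ⟦ q ⟧) l₀ (does-true (sel m d₀ ≟Y sel m y) e₀))
        (trans (*-identityʳ _) (trans (*-identityˡ _) (f-cong l id₀ iy e₀)))))
        where
        r = representative m iy
        d₀ = proj₁ r
        id₀ = proj₁ (proj₂ r)
        l₀ = proj₁ (proj₂ (proj₂ r))
        e₀ = proj₂ (proj₂ (proj₂ r))
        off : ∀ {d} → d ∈ xs → d ≢ d₀ → ∀ c → (Des d ≼ m) ≡ c →
              ⟦ Des d ≼ m ⟧ * f x d * ⟦ does (sel m d ≟Y sel m y) ⟧ ≡ 0ℤ
        off {d} id d≢ false q rewrite q = refl
        off {d} id d≢ true  q =
          trans (cong (λ b → ⟦ Des d ≼ m ⟧ * f x d * ⟦ b ⟧)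
                   (does-false (sel m d ≟Y sel m y)
                     (λ e → d≢ (representative-unique m id id₀ q l₀ (trans e (sym e₀))))))
                (*-zeroʳ (⟦ Des d ≼ m ⟧ * f x d))
      row : ∀ {x} → x ∈ xs → (Des x ≼ m) ≡ true →
            g (λ y → f x (σ y)) x ≡ Σ xs (λ d → ⟦ Des d ≼ m ⟧ * f x d * g (δσ d) x)
      row {x} ix l = trans (g-cong (λ iy → decompose l (σ∈ iy)) ix)
                           (g-linear xs (λ d → ⟦ Des d ≼ m ⟧ * f x d) δσ x)
      -- When `Des x` is not below `m`, the coefficient of `δσ d` at `x` vanishes. The sum over `x`
      -- may therefore run over all of `xs`, where `expand` evaluates it.
      drop : ∀ {x d} → x ∈ xs → d ∈ xs → ∀ c → (Des x ≼ m) ≡ c →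
             ⟦ Des x ≼ m ⟧ * (⟦ Des d ≼ m ⟧ * f x d * g (δσ d) x) ≡ ⟦ Des d ≼ m ⟧ * (f x d * g (δσ d) x)
      drop {x} {d} ix id true  q rewrite q = trans (*-identityˡ _) (*-assoc ⟦ Des d ≼ m ⟧ _ _)
      drop {x} {d} ix id false q rewrite q = sym
        (trans (cong (λ h → ⟦ Des d ≼ m ⟧ * (f x d * h)) (g-vanish m (δσ d) (δσ-dep d) ix q))
               (trans (cong (⟦ Des d ≼ m ⟧ *_) (*-zeroʳ (f x d))) (*-zeroʳ ⟦ Des d ≼ m ⟧)))

    -- On the quotient spanned by the f x with Des x full, summing over Γ is |Γ| times a
    -- projection.
    module Equivariant {Γ : Set} (Gs : List Γ) (act : Γ → X → X)
      (act-∈ : ∀ {σ x} → σ ∈ Gs → x ∈ xs → act σ x ∈ xs)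
      (act-sel : ∀ {σ} m {x y} → σ ∈ Gs → x ∈ xs → y ∈ xs → sel m x ≡ sel m y → sel m (act σ x) ≡ sel m (act σ y))
      (translate : ∀ {τ} → τ ∈ Gs → (h : X → ℤ) → ∀ {x} → x ∈ xs →
                   Σ Gs (λ σ → h (act σ (act τ x))) ≡ Σ Gs (λ σ → h (act σ x)))
      (sel-full : ∀ {m x y} → isFull m ≡ true → x ∈ xs → y ∈ xs → sel m x ≡ sel m y → x ≡ y)
      where

      Av : (X → ℤ) → X → ℤ
      Av φ x = Σ Gs (λ σ → φ (act σ x))

      ds : List X
      ds = filterᵇ (λ x → isFull (Des x)) xs

      E : X → X → ℤ
      E z x = g (Av (f x)) z

      c : ℤ
      c = + length Gs

      ∈-ds : ∀ {x} → x ∈ ds → x ∈ xs × isFull (Des x) ≡ true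
      ∈-ds i = let j , q = ∈-filter⁻ (λ x → T? (isFull (Des x))) {xs = xs} i in j , Equivalence.to T-≡ q

      ds-∈ : ∀ {x} → x ∈ xs → isFull (Des x) ≡ true → x ∈ ds
      ds-∈ i q = ∈-filter⁺ (λ x → T? (isFull (Des x))) i (Equivalence.from T-≡ q)

      Av-dep : ∀ w → DependsOn (Des w) (Av (f w))
      Av-dep w ix iy e = Σ-cong Gs (λ iσ →
        f-cong (≼-refl (Des w)) (act-∈ iσ ix) (act-∈ iσ iy) (act-sel (Des w) iσ ix iy e))

      -- Basis functions `f w` with a missing descent contribute nothing: `Av (f w)` depends only on
      -- the coordinates in `Des w`, and a full `Des z` is not below it.
      g-Av : ∀ φ {z} → z ∈ ds → g (Av φ) z ≡ Σ ds (λ w → E z w * g φ w)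
      g-Av φ {z} iz =
        trans (g-cong (λ {y} iy →
                 trans (Σ-cong Gs (λ iσ → sym (expand φ (act-∈ iσ iy))))
                 (trans (Σ-swap Gs xs (λ σ w → f w (act σ y) * g φ w))
                 (Σ-ext xs (λ w → trans (Σ-*ʳ Gs (g φ w) (λ σ → f w (act σ y))) (*-comm _ (g φ w))))))
               iz′)
        (trans (g-linear xs (g φ) (λ w → Av (f w)) z)
        (trans (Σ-ext xs (λ w → term w _ refl))
               (sym (Σ-filterᵇ (λ x → isFull (Des x)) xs (λ w → E z w * g φ w)))))
        where
        iz′ = proj₁ (∈-ds iz)
        not-≼ : ∀ w → isFull (Des w) ≡ false → ∀ c → (Des z ≼ Des w) ≡ c → (Des z ≼ Des w) ≡ false
        not-≼ w q false r = r
        not-≼ w q true  r with trans (sym q) (full-≼ (Des z) (Des w) (proj₂ (∈-ds iz)) r)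
        ... | ()
        term : ∀ w c → isFull (Des w) ≡ c → g φ w * E z w ≡ ⟦ isFull (Des w) ⟧ * (E z w * g φ w)
        term w true  q rewrite q = trans (*-comm (g φ w) (E z w)) (sym (*-identityˡ _))
        term w false q rewrite q =
          trans (cong (g φ w *_) (g-vanish (Des w) (Av (f w)) (Av-dep w) iz′ (not-≼ w q _ refl)))
                (*-zeroʳ (g φ w))

      -- By `g-Av` the matrix product is averaging twice, and translation by any `τ` leaves the
      -- first average unchanged.
      E-quasi : Trace.QuasiIdempotent ds c E
      E-quasi {z} {x} iz ix =
        trans (sym (g-Av (Av (f x)) iz))
        (trans (g-Σ Gs (λ τ y → Av (f x) (act τ y)) iz′)
        (trans (Σ-cong Gs (λ iτ → g-cong (λ iy → translate iτ (f x) iy) iz′))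
               (Σ-const Gs (E z x))))
        where iz′ = proj₁ (∈-ds iz)

      fixed : Mask k → Γ → ℤ
      fixed m σ = Σ xs (λ x → ⟦ Des x ≼ m ⟧ * ⟦ does (sel m x ≟Y sel m (act σ x)) ⟧)

      -- After exchanging the sums, each `x` carries the signed sum over the masks above `Des x`,
      -- which survives only when `Des x` is full.
      alternating-trace : Σ (masks k) (λ m → sgn m * Σ Gs (fixed m)) ≡ Trace.tr ds E
      alternating-trace =
        trans (Σ-ext (masks k) (λ m → cong (sgn m *_) (Σ-cong Gs (λ {σ} iσ →
                 sym (trace-restricted m (act σ) (act-∈ iσ) (act-sel m iσ))))))
        (trans (Σ-ext (masks k) (λ m → cong (sgn m *_) (trans (Σ-swap Gs xs (λ σ x → ⟦ Des x ≼ m ⟧ * t σ x))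
                 (Σ-ext xs (λ x → Σ-*ˡ Gs ⟦ Des x ≼ m ⟧ (λ σ → t σ x))))))
        (trans (Σ-ext (masks k) (λ m → trans (sym (Σ-*ˡ xs (sgn m) (λ x → ⟦ Des x ≼ m ⟧ * s x)))
                 (Σ-ext xs (λ x → sym (*-assoc (sgn m) ⟦ Des x ≼ m ⟧ (s x))))))
        (trans (Σ-swap (masks k) xs (λ m x → sgn m * ⟦ Des x ≼ m ⟧ * s x))
        (trans (Σ-cong xs (λ {x} ix →
                 trans (Σ-*ʳ (masks k) (s x) (λ m → sgn m * ⟦ Des x ≼ m ⟧))
                       (cong₂ _*_ (Σ-sgn-≼ k (Des x)) (sym (g-Σ Gs (λ σ y → f x (act σ y)) ix)))))
               (sym (Σ-filterᵇ (λ x → isFull (Des x)) xs (λ x → E x x)))))))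
        where
        t : Γ → X → ℤ
        t σ x = g (λ y → f x (act σ y)) x
        s : X → ℤ
        s x = Σ Gs (λ σ → t σ x)

      -- `N` contains every element that forward substitution visits when started at `y₀`, and it
      -- meets the orbit of `y₀` only in `y₀`. So the average of `f y₀` vanishes at all elements
      -- visited below `y₀`.
      module _ {y₀ : X} (y₀∈ : y₀ ∈ xs) (y₀-full : isFull (Des y₀) ≡ true) (N : X → Set)
        (y₀-N : N y₀)
        (N-closed : ∀ {x y} → x ∈ xs → y ∈ xs → N y → sel (Des x) x ≡ sel (Des x) y → N x)
        (N-orbit : ∀ {x σ} → x ∈ xs → σ ∈ Gs → N x → act σ x ≡ y₀ → x ≡ y₀)
        {e : Γ} (e∈ : e ∈ Gs) (act-e : act e y₀ ≡ y₀) where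

        φ₀ : X → ℤ
        φ₀ = Av (f y₀)

        off-orbit : ∀ {x} → x ∈ xs → N x → psi x ℕ.< psi y₀ → φ₀ x ≡ 0ℤ
        off-orbit {x} ix nx lt = trans (Σ-cong Gs (λ {σ} iσ →
          cong ⟦_⟧ (does-false (agrees? y₀ (act σ x))
            (λ p → ℕ.<-irrefl (cong psi (N-orbit ix iσ nx (sym (sel-full y₀-full y₀∈ (act-∈ iσ ix) p)))) lt))))
          (Σ-zero Gs)

        g-N-value : ∀ {y} → y ∈ xs → N y →
                    (∀ {w} → w ∈ xs → N w → psi w ℕ.< psi y → g φ₀ w ≡ 0ℤ) → g φ₀ y ≡ φ₀ y
        g-N-value {y} iy ny h =
          trans (g-unfold φ₀ y)
          (trans (cong (_-_ (φ₀ y)) (trans (Σ-cong xs (λ {w} iw →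
                    guard-zero (psi w ℕ.<? psi y) (λ lt →
                      guard-zero (agrees? w y) (λ p → h iw (N-closed iw iy ny p) lt)))) (Σ-zero xs)))
                 (+-identityʳ (φ₀ y)))

        g-N-zero : ∀ b {y} → y ∈ xs → N y → psi y ℕ.< b → psi y ℕ.< psi y₀ → g φ₀ y ≡ 0ℤ
        g-N-zero (suc b) iy ny y<b lt =
          trans (g-N-value iy ny (λ iw nw w<y → g-N-zero b iw nw (ℕ.<-≤-trans w<y (ℕ.s≤s⁻¹ y<b)) (ℕ.<-trans w<y lt)))
                (off-orbit iy ny lt)

        φ₀-positive : 0ℤ < φ₀ y₀
        φ₀-positive = Σ-pos (λ σ → ⟦⟧-nonneg (does (agrees? y₀ (act σ y₀)))) e∈
          (subst (λ b → 0ℤ < ⟦ b ⟧) (sym (does-true (agrees? y₀ (act e y₀)) (cong (sel (Des y₀)) (sym act-e))))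
                 (+<+ (ℕ.s≤s ℕ.z≤n)))

        -- All correction terms vanish, so the entry equals `φ₀ y₀`, the number of group elements
        -- fixing `y₀`.
        E-diagonal : E y₀ y₀ ≢ 0ℤ
        E-diagonal z = <-irrefl (trans (sym z) (g-N-value y₀∈ y₀-N (λ iw nw lt → g-N-zero _ iw nw ℕ.≤-refl lt))) φ₀-positive

        c-positive : ∀ {l : List Γ} → e ∈ l → 0ℤ < + length l
        c-positive (here _)  = +<+ (ℕ.s≤s ℕ.z≤n)
        c-positive (there _) = +<+ (ℕ.s≤s ℕ.z≤n)

        alternating-positive : 0ℤ < Σ (masks k) (λ m → sgn m * Σ Gs (fixed m))
        alternating-positive = subst (0ℤ <_) (sym alternating-trace)
          (Trace.tr-positive ds c E E-quasi (ds-∈ y₀∈ y₀-full) E-diagonal (c-positive e∈))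

-- The partition lattice: order, rank, merging of blocks, interpolation.

module Partitions where
  open import Defs
  open import Data.Bool using (Bool; true; false; T; T?; not; _∧_; _∨_)
  open import Data.Bool.Properties using (T-∧; T-∨)
  open import Data.Nat using (ℕ; zero; suc; _≤_; _<_; _∸_; _<?_; _<ᵇ_; z≤n; s≤s; s≤s⁻¹; _≤?_)
  open import Data.Nat.Properties
  open import Data.Fin using (Fin; toℕ; zero; suc)
  open import Data.Fin.Properties using (any?; toℕ-injective)
  open import Data.List using (List; []; _∷_; filterᵇ; length; allFin)
  open import Data.List.Properties using (length-filter; length-tabulate)
  open import Data.List.Membership.Propositional using (_∈_)
  open import Data.List.Membership.Propositional.Properties using (∈-allFin; ∈-filter⁺)
  open import Data.List.Relation.Unary.Any using (here; there)
  open import Data.List.Relation.Unary.All using (All; []; _∷_)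
  open import Data.List.Relation.Unary.AllPairs using ([]; _∷_)
  open import Data.List.Relation.Unary.Unique.Propositional using (Unique)
  open import Data.List.Relation.Unary.Unique.Propositional.Properties using (allFin⁺)
  open import Data.Vec using (lookup; tabulate)
  open import Data.Vec.Properties using (lookup∘tabulate; tabulate∘lookup; tabulate-cong)
  open import Data.Product using (_×_; _,_; ∃-syntax; proj₁; proj₂)
  open import Data.Sum using (_⊎_; inj₁; inj₂)
  open import Data.Empty using (⊥-elim)
  open import Function.Bundles using (Equivalence)
  open import Relation.Nullary using (¬_; Dec; yes; no)
  open import Relation.Nullary.Decidable using (map′; _×-dec_; ¬?; fromWitness; toWitness)
  open import Relation.Binary using (Tri; tri<; tri≈; tri>)
  open import Relation.Binary.PropositionalEquality
  open Equivalence using (to; from)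

  T-⇒⁺ : ∀ a {b} → (T a → T b) → T (a ⇒B b)
  T-⇒⁺ true  h = h _
  T-⇒⁺ false h = _

  T-⇒⁻ : ∀ a {b} → T (a ⇒B b) → T a → T b
  T-⇒⁻ true h _ = h

  T-not⁺ : ∀ b → ¬ T b → T (not b)
  T-not⁺ true  h = h _
  T-not⁺ false h = _

  T-not⁻ : ∀ b → T (not b) → ¬ T b
  T-not⁻ true h _ = h

  T-ext : ∀ {a b} → (T a → T b) → (T b → T a) → a ≡ b
  T-ext {true}  {true}  f g = refl
  T-ext {true}  {false} f g = ⊥-elim (f _)
  T-ext {false} {true}  f g = ⊥-elim (g _)
  T-ext {false} {false} f g = refl

  T-allB⁺ : ∀ {A : Set} {p : A → Bool} xs → (∀ {x} → x ∈ xs → T (p x)) → T (allB p xs)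
  T-allB⁺ []       h = _
  T-allB⁺ (x ∷ xs) h = from T-∧ (h (here refl) , T-allB⁺ xs (λ i → h (there i)))

  T-allB⁻ : ∀ {A : Set} {p : A → Bool} {xs} → T (allB p xs) → ∀ {x} → x ∈ xs → T (p x)
  T-allB⁻ {xs = y ∷ xs} h (here refl) = proj₁ (to T-∧ h)
  T-allB⁻ {p = p} {y ∷ xs} h (there i) = T-allB⁻ {xs = xs} (proj₂ (to (T-∧ {p y}) h)) i

  T-∀F⁺ : ∀ {n} {p : Fin n → Bool} → (∀ i → T (p i)) → T (∀F n p)
  T-∀F⁺ {n} h = T-allB⁺ (allFin n) (λ {i} _ → h i)

  T-∀F⁻ : ∀ {n} {p : Fin n → Bool} → T (∀F n p) → ∀ i → T (p i)
  T-∀F⁻ {n} {p} h i = T-allB⁻ {p = p} {allFin n} h (∈-allFin i)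

  -- A record rather than the bare `T (rel x i j)`, from which unification could not recover `x`,
  -- `i` and `j`.
  record R {n} (x : Rel n) (i j : Fin n) : Set where
    constructor ⟨_⟩
    field holds : T (rel x i j)
  open R public

  R? : ∀ {n} (x : Rel n) i j → Dec (R x i j)
  R? x i j = map′ ⟨_⟩ holds (T? (rel x i j))

  record IsPartition {n} (x : Rel n) : Set where
    field
      reflexive  : ∀ i → R x i i
      symmetric  : ∀ {i j} → R x i j → R x j i
      transitive : ∀ {i j k} → R x i j → R x j k → R x i k
  open IsPartition public

  isEquivRel⁻ : ∀ {n} {x : Rel n} → T (isEquivRel x) → IsPartition x
  isEquivRel⁻ {n} {x} h = record
    { reflexive  = λ i → ⟨ T-∀F⁻ (proj₁ hs) i ⟩
    ; symmetric  = λ {i} {j} p → ⟨ T-⇒⁻ (rel x i j) (T-∀F⁻ (T-∀F⁻ (proj₁ ht) i) j) (holds p) ⟩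
    ; transitive = λ {i} {j} {k} p q →
        ⟨ T-⇒⁻ (rel x i j ∧ rel x j k) (T-∀F⁻ (T-∀F⁻ (T-∀F⁻ (proj₂ ht) i) j) k) (from T-∧ (holds p , holds q)) ⟩
    }
    where
    hs = to (T-∧ {∀F n (λ i → rel x i i)}) h
    ht = to (T-∧ {∀F n (λ i → ∀F n (λ j → rel x i j ⇒B rel x j i))}) (proj₂ hs)

  isEquivRel⁺ : ∀ {n} {x : Rel n} → IsPartition x → T (isEquivRel x)
  isEquivRel⁺ {n} {x} e = from T-∧ (T-∀F⁺ (λ i → holds (reflexive e i)) , from T-∧
    ( T-∀F⁺ (λ i → T-∀F⁺ (λ j → T-⇒⁺ (rel x i j) (λ h → holds (symmetric e ⟨ h ⟩))))
    , T-∀F⁺ (λ i → T-∀F⁺ (λ j → T-∀F⁺ (λ k → T-⇒⁺ (rel x i j ∧ rel x j k)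
        (λ h → holds (transitive e ⟨ proj₁ (to T-∧ h) ⟩ ⟨ proj₂ (to (T-∧ {rel x i j}) h) ⟩)))))))

  mk : ∀ {n} → (Fin n → Fin n → Bool) → Rel n
  mk f = tabulate (λ i → tabulate (f i))

  rel-mk : ∀ {n} (f : Fin n → Fin n → Bool) i j → rel (mk f) i j ≡ f i j
  rel-mk f i j = trans (cong (λ v → lookup v j) (lookup∘tabulate (λ i → tabulate (f i)) i)) (lookup∘tabulate (f i) j)

  R-mk⁺ : ∀ {n} (f : Fin n → Fin n → Bool) {i j} → T (f i j) → R (mk f) i j
  R-mk⁺ f {i} {j} h = ⟨ subst T (sym (rel-mk f i j)) h ⟩

  R-mk⁻ : ∀ {n} (f : Fin n → Fin n → Bool) {i j} → R (mk f) i j → T (f i j)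
  R-mk⁻ f {i} {j} h = subst T (rel-mk f i j) (holds h)

  mk-rel : ∀ {n} (x : Rel n) → mk (rel x) ≡ x
  mk-rel x = trans (tabulate-cong (λ i → tabulate∘lookup (lookup x i))) (tabulate∘lookup x)

  mk-cong : ∀ {n} {f g : Fin n → Fin n → Bool} → (∀ i j → f i j ≡ g i j) → mk f ≡ mk g
  mk-cong e = tabulate-cong (λ i → tabulate-cong (e i))

  infix 4 _⊑_
  _⊑_ : ∀ {n} → Rel n → Rel n → Set
  x ⊑ y = ∀ i j → R x i j → R y i j

  ⊑-refl : ∀ {n} {x : Rel n} → x ⊑ x
  ⊑-refl i j p = p

  ⊑-trans : ∀ {n} {x y z : Rel n} → x ⊑ y → y ⊑ z → x ⊑ z
  ⊑-trans p q i j r = q i j (p i j r)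

  ⊑-antisym : ∀ {n} {x y : Rel n} → x ⊑ y → y ⊑ x → x ≡ y
  ⊑-antisym {x = x} {y} p q =
    trans (sym (mk-rel x)) (trans (mk-cong (λ i j → T-ext (λ h → holds (p i j ⟨ h ⟩)) (λ h → holds (q i j ⟨ h ⟩)))) (mk-rel y))

  refines⁻ : ∀ {n} {x y : Rel n} → T (refines x y) → x ⊑ y
  refines⁻ {x = x} h i j p = ⟨ T-⇒⁻ (rel x i j) (T-∀F⁻ (T-∀F⁻ h i) j) (holds p) ⟩

  refines⁺ : ∀ {n} {x y : Rel n} → x ⊑ y → T (refines x y)
  refines⁺ {x = x} h = T-∀F⁺ (λ i → T-∀F⁺ (λ j → T-⇒⁺ (rel x i j) (λ p → holds (h i j ⟨ p ⟩))))

  module _ {A : Set} where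
    private
      cnt : (A → Bool) → List A → ℕ
      cnt p l = length (filterᵇ p l)

    count-mono : ∀ {p q : A → Bool} → (∀ i → T (p i) → T (q i)) → ∀ l → cnt p l ≤ cnt q l
    count-mono h [] = z≤n
    count-mono {p} {q} h (i ∷ l) with p i | q i | h i
    ... | true  | true  | _  = s≤s (count-mono h l)
    ... | true  | false | hi = ⊥-elim (hi _)
    ... | false | true  | _  = m≤n⇒m≤1+n (count-mono h l)
    ... | false | false | _  = count-mono h l

    count-tight : ∀ {p q : A → Bool} → (∀ i → T (p i) → T (q i)) → ∀ l → cnt p l ≡ cnt q l →
                  ∀ {i} → i ∈ l → T (q i) → T (p i)
    count-tight {p} {q} h (j ∷ l) e (here refl) t with p j | q j | h j
    ... | true  | _     | _ = _
    ... | false | true  | _ = <⇒≢ (s≤s (count-mono h l)) e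
    ... | false | false | _ = t
    count-tight {p} {q} h (j ∷ l) e (there k) t with p j | q j | h j
    ... | true  | true  | _  = count-tight h l (suc-injective e) k t
    ... | true  | false | hj = ⊥-elim (hj _)
    ... | false | true  | _  = ⊥-elim (<⇒≢ (s≤s (count-mono h l)) e)
    ... | false | false | _  = count-tight h l e k t

    count-exception : ∀ {p q : A → Bool} e l → Unique l → (∀ i → T (p i) → T (q i) ⊎ i ≡ e) →
                      cnt p l ≤ suc (cnt q l)
    count-exception e [] u h = z≤n
    count-exception {p} {q} e (i ∷ l) (i∉ ∷ u) h with p i in pi | q i in qi | h i
    ... | true  | true  | _ = s≤s (count-exception e l u h)
    ... | false | true  | _ = m≤n⇒m≤1+n (count-exception e l u h)
    ... | false | false | _ = count-exception e l u h
    ... | true  | false | hi with hi _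
    ...   | inj₂ refl = s≤s (rest l i∉)
      where
      rest : ∀ l → All (λ j → i ≢ j) l → cnt p l ≤ cnt q l
      rest [] _ = z≤n
      rest (j ∷ l) (i≢j ∷ a) with p j | q j | h j
      ... | true  | true  | _ = s≤s (rest l a)
      ... | false | true  | _ = m≤n⇒m≤1+n (rest l a)
      ... | false | false | _ = rest l a
      ... | true  | false | hj with hj _
      ...   | inj₂ e = ⊥-elim (i≢j (sym e))

    count-positive : ∀ {p : A → Bool} {i l} → i ∈ l → T (p i) → 1 ≤ cnt p l
    count-positive {p} {l = l} k t with filterᵇ p l | ∈-filter⁺ (λ i → T? (p i)) k t
    ... | _ ∷ _ | _ = s≤s z≤n

    count-all : ∀ {p : A → Bool} l → (∀ i → T (p i)) → cnt p l ≡ length l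
    count-all [] h = refl
    count-all {p} (i ∷ l) h with p i | h i
    ... | true | _ = cong suc (count-all l h)

  isMin : ∀ {n} → Rel n → Fin n → Bool
  isMin {n} x i = ∀F n (λ j → (toℕ j <ᵇ toℕ i) ⇒B not (rel x j i))

  Min : ∀ {n} → Rel n → Fin n → Set
  Min x i = ∀ j → toℕ j < toℕ i → ¬ R x j i

  isMin⁺ : ∀ {n} {x : Rel n} {i} → Min x i → T (isMin x i)
  isMin⁺ {x = x} {i} h = T-∀F⁺ (λ j → T-⇒⁺ (toℕ j <ᵇ toℕ i) (λ l → T-not⁺ (rel x j i) (λ r → h j (<ᵇ⇒< _ _ l) ⟨ r ⟩)))

  isMin⁻ : ∀ {n} {x : Rel n} {i} → T (isMin x i) → Min x i
  isMin⁻ {x = x} {i} h j l r = T-not⁻ (rel x j i) (T-⇒⁻ (toℕ j <ᵇ toℕ i) (T-∀F⁻ h j) (<⇒<ᵇ l)) (holds r)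

  minimum : ∀ {n} {x : Rel n} → IsPartition x → ∀ i → ∃[ m ] (Min x m × R x m i)
  minimum {n} {x} e i = go (suc (toℕ i)) i ≤-refl
    where
    go : ∀ b i → toℕ i < b → ∃[ m ] (Min x m × R x m i)
    go (suc b) i i<b with any? (λ j → (toℕ j <? toℕ i) ×-dec R? x j i)
    ... | yes (j , j<i , r) =
      let m , mm , rm = go b j (<-≤-trans j<i (s≤s⁻¹ i<b)) in m , mm , transitive e rm r
    ... | no none = i , (λ j l r → none (j , l , r)) , reflexive e i

  minimum-unique : ∀ {n} {x : Rel n} → IsPartition x → ∀ {i j} → Min x i → Min x j → R x i j → i ≡ j
  minimum-unique e {i} {j} mi mj r with <-cmp (toℕ i) (toℕ j)
  ... | tri< l _ _ = ⊥-elim (mj i l r)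
  ... | tri≈ _ q _ = toℕ-injective q
  ... | tri> _ _ l = ⊥-elim (mi j l (symmetric e r))

  blocks≤ : ∀ {n} (x : Rel n) → numBlocks x ≤ n
  blocks≤ {n} x = ≤-trans (length-filter (λ i → T? (isMin x i)) (allFin n)) (≤-reflexive (length-tabulate {n = n} (λ i → i)))

  Min-anti : ∀ {n} {x y : Rel n} → x ⊑ y → ∀ i → T (isMin y i) → T (isMin x i)
  Min-anti s i m = isMin⁺ (λ j l r → isMin⁻ m j l (s j i r))

  blocks-anti : ∀ {n} {x y : Rel n} → x ⊑ y → numBlocks y ≤ numBlocks x
  blocks-anti {n} {x} {y} s = count-mono {p = isMin y} {isMin x} (Min-anti s) (allFin n)

  -- With equally many minima, every block minimum of `x` is still one for `y`. Elements related in
  -- `y` then have `x`-minima that are related minima of `y`, hence equal.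
  blocks-tight : ∀ {n} {x y : Rel n} → IsPartition x → IsPartition y → x ⊑ y → numBlocks y ≡ numBlocks x → y ⊑ x
  blocks-tight {n} {x} {y} ex ey s q i j r =
    let a , ma , ra = minimum ex i
        b , mb , rb = minimum ex j
        up : ∀ {i} → Min x i → Min y i
        up {i} m = isMin⁻ (count-tight {p = isMin y} {isMin x} (Min-anti s) (allFin n) q (∈-allFin i) (isMin⁺ m))
        a≡b = minimum-unique ey (up ma) (up mb)
                (transitive ey (s a i ra) (transitive ey r (symmetric ey (s b j rb))))
    in transitive ex (symmetric ex ra) (subst (λ c → R x c j) (sym a≡b) rb)

  rank-mono : ∀ {n} {x y : Rel n} → x ⊑ y → rank x ≤ rank y
  rank-mono {n} s = ∸-monoʳ-≤ n (blocks-anti s)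

  rank-tight : ∀ {n} {x y : Rel n} → IsPartition x → IsPartition y → x ⊑ y → rank x ≡ rank y → x ≡ y
  rank-tight {n} {x} {y} ex ey s q =
    ⊑-antisym s (blocks-tight ex ey s (sym (∸-cancelˡ-≡ (blocks≤ x) (blocks≤ y) q)))

  rank-strict : ∀ {n} {x y : Rel n} → IsPartition x → IsPartition y → x ⊑ y → x ≢ y → rank x < rank y
  rank-strict ex ey s ne = ≤∧≢⇒< (rank-mono s) (λ q → ne (rank-tight ex ey s q))

  difference : ∀ {n} {x y : Rel n} → ¬ y ⊑ x → ∃[ i ] ∃[ j ] (R y i j × ¬ R x i j)
  difference {x = x} {y} ne with any? (λ i → any? (λ j → R? y i j ×-dec ¬? (R? x i j)))
  ... | yes (i , j , r) = i , j , r
  ... | no none = ⊥-elim (ne sub)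
    where
    sub : y ⊑ x
    sub i j r with R? x i j
    ... | yes p = p
    ... | no ¬p = ⊥-elim (none (i , j , r , ¬p))

  Merged : ∀ {n} → Rel n → Fin n → Fin n → Fin n → Fin n → Set
  Merged x a b i j = R x i j ⊎ (R x i a × R x b j) ⊎ (R x i b × R x a j)

  mergeᵇ : ∀ {n} → Rel n → Fin n → Fin n → Fin n → Fin n → Bool
  mergeᵇ x a b i j = rel x i j ∨ (rel x i a ∧ rel x b j) ∨ (rel x i b ∧ rel x a j)

  merge : ∀ {n} → Rel n → Fin n → Fin n → Rel n
  merge x a b = mk (mergeᵇ x a b)

  merge⁻ : ∀ {n} (x : Rel n) a b {i j} → R (merge x a b) i j → Merged x a b i j
  merge⁻ x a b {i} {j} h with to (T-∨ {rel x i j}) (R-mk⁻ (mergeᵇ x a b) h)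
  ... | inj₁ p = inj₁ ⟨ p ⟩
  ... | inj₂ q with to (T-∨ {rel x i a ∧ rel x b j}) q
  ...   | inj₁ r = let p , q = to (T-∧ {rel x i a}) r in inj₂ (inj₁ (⟨ p ⟩ , ⟨ q ⟩))
  ...   | inj₂ r = let p , q = to (T-∧ {rel x i b}) r in inj₂ (inj₂ (⟨ p ⟩ , ⟨ q ⟩))

  merge⁺ : ∀ {n} (x : Rel n) a b {i j} → Merged x a b i j → R (merge x a b) i j
  merge⁺ x a b h = R-mk⁺ (mergeᵇ x a b) (go h)
    where
    go : ∀ {i j} → Merged x a b i j → T (mergeᵇ x a b i j)
    go {i} {j} (inj₁ p)              = from (T-∨ {rel x i j}) (inj₁ (holds p))
    go {i} {j} (inj₂ (inj₁ (p , q))) = from (T-∨ {rel x i j}) (inj₂ (from (T-∨ {rel x i a ∧ rel x b j}) (inj₁ (from T-∧ (holds p , holds q)))))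
    go {i} {j} (inj₂ (inj₂ (p , q))) = from (T-∨ {rel x i j}) (inj₂ (from (T-∨ {rel x i a ∧ rel x b j}) (inj₂ (from T-∧ (holds p , holds q)))))

  module _ {n} {x : Rel n} (e : IsPartition x) (a b : Fin n) where

    merge-partition : IsPartition (merge x a b)
    merge-partition = record
      { reflexive  = λ i → merge⁺ x a b (inj₁ (reflexive e i))
      ; symmetric  = λ h → merge⁺ x a b (sm (merge⁻ x a b h))
      ; transitive = λ h k → merge⁺ x a b (tr (merge⁻ x a b h) (merge⁻ x a b k))
      }
      where
      _˘ : ∀ {i j} → R x i j → R x j i
      _˘ = symmetric e
      infixr 5 _∙_
      _∙_ : ∀ {i j k} → R x i j → R x j k → R x i k
      _∙_ = transitive e
      sm : ∀ {i j} → Merged x a b i j → Merged x a b j i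
      sm (inj₁ p)              = inj₁ (p ˘)
      sm (inj₂ (inj₁ (p , q))) = inj₂ (inj₂ (q ˘ , p ˘))
      sm (inj₂ (inj₂ (p , q))) = inj₂ (inj₁ (q ˘ , p ˘))
      tr : ∀ {i j k} → Merged x a b i j → Merged x a b j k → Merged x a b i k
      tr (inj₁ p) (inj₁ q) = inj₁ (p ∙ q)
      tr (inj₁ p) (inj₂ (inj₁ (q , r))) = inj₂ (inj₁ (p ∙ q , r))
      tr (inj₁ p) (inj₂ (inj₂ (q , r))) = inj₂ (inj₂ (p ∙ q , r))
      tr (inj₂ (inj₁ (p , q))) (inj₁ r) = inj₂ (inj₁ (p , q ∙ r))
      tr (inj₂ (inj₂ (p , q))) (inj₁ r) = inj₂ (inj₂ (p , q ∙ r))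
      tr (inj₂ (inj₁ (p , q))) (inj₂ (inj₁ (r , s))) = inj₂ (inj₁ (p , s))
      tr (inj₂ (inj₁ (p , q))) (inj₂ (inj₂ (r , s))) = inj₁ (p ∙ s)
      tr (inj₂ (inj₂ (p , q))) (inj₂ (inj₁ (r , s))) = inj₁ (p ∙ s)
      tr (inj₂ (inj₂ (p , q))) (inj₂ (inj₂ (r , s))) = inj₂ (inj₂ (p , s))

    ⊑-merge : x ⊑ merge x a b
    ⊑-merge i j p = merge⁺ x a b (inj₁ p)

    merge-joins : R (merge x a b) a b
    merge-joins = merge⁺ x a b (inj₂ (inj₁ (reflexive e a , reflexive e b)))

    merge-least : ∀ {y} → IsPartition y → x ⊑ y → R y a b → merge x a b ⊑ y
    merge-least ey s r i j h with merge⁻ x a b h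
    ... | inj₁ p = s i j p
    ... | inj₂ (inj₁ (p , q)) = transitive ey (s i a p) (transitive ey r (s b j q))
    ... | inj₂ (inj₂ (p , q)) = transitive ey (s i b p) (transitive ey (symmetric ey r) (s a j q))

    -- Only the larger of the two block minima is lost.
    blocks-merge : numBlocks x ≤ suc (numBlocks (merge x a b))
    blocks-merge =
      let c , mc , rc = minimum e a
          d , md , rd = minimum e b
      in go c d mc md rc rd (<-cmp (toℕ c) (toℕ d))
      where
      Kept Lost : Fin n → Set
      Kept i = T (isMin (merge x a b) i)
      Lost i = ∃[ w ] (toℕ w < toℕ i × (R x w a × R x b i ⊎ R x w b × R x a i))
      find : ∀ i → T (isMin x i) → Kept i ⊎ Lost i
      find i t with any? (λ w → (toℕ w <? toℕ i) ×-dec R? (merge x a b) w i)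
      ... | no none = inj₁ (isMin⁺ (λ j l r → none (j , l , r)))
      ... | yes (w , l , r) with merge⁻ x a b r
      ...   | inj₁ p = ⊥-elim (isMin⁻ t w l p)
      ...   | inj₂ p = inj₂ (w , l , p)
      least : ∀ {c w} → Min x c → R x c w → toℕ c ≤ toℕ w
      least {c} {w} m r with toℕ c ≤? toℕ w
      ... | yes p = p
      ... | no ¬p = ⊥-elim (m w (≰⇒> ¬p) (symmetric e r))
      go : ∀ c d → Min x c → Min x d → R x c a → R x d b → Tri (toℕ c < toℕ d) (toℕ c ≡ toℕ d) (toℕ d < toℕ c) → numBlocks x ≤ suc (numBlocks (merge x a b))
      go c d mc md rc rd (tri≈ _ q _) = count-exception c (allFin n) (allFin⁺ n) (λ i t → except i t (find i t))
        where
        except : ∀ i → T (isMin x i) → Kept i ⊎ Lost i → Kept i ⊎ i ≡ c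
        except i t (inj₁ p) = inj₁ p
        except i t (inj₂ (w , l , inj₁ (p , r))) =
          inj₂ (minimum-unique e (isMin⁻ t) mc (transitive e (symmetric e r) (transitive e (symmetric e rd)
            (subst (λ k → R x k c) (toℕ-injective q) (reflexive e c)))))
        except i t (inj₂ (w , l , inj₂ (p , r))) =
          inj₂ (minimum-unique e (isMin⁻ t) mc (transitive e (symmetric e r) (symmetric e rc)))
      go c d mc md rc rd (tri< c<d _ _) = count-exception d (allFin n) (allFin⁺ n) (λ i t → except i t (find i t))
        where
        except : ∀ i → T (isMin x i) → Kept i ⊎ Lost i → Kept i ⊎ i ≡ d
        except i t (inj₁ p) = inj₁ p
        except i t (inj₂ (w , l , inj₁ (p , r))) =
          inj₂ (minimum-unique e (isMin⁻ t) md (transitive e (symmetric e r) (symmetric e rd)))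
        except i t (inj₂ (w , l , inj₂ (p , r))) with minimum-unique e (isMin⁻ t) mc (transitive e (symmetric e r) (symmetric e rc))
        ... | refl = ⊥-elim (<-asym (<-≤-trans c<d (least md (transitive e rd (symmetric e p)))) l)
      go c d mc md rc rd (tri> _ _ d<c) = count-exception c (allFin n) (allFin⁺ n) (λ i t → except i t (find i t))
        where
        except : ∀ i → T (isMin x i) → Kept i ⊎ Lost i → Kept i ⊎ i ≡ c
        except i t (inj₁ p) = inj₁ p
        except i t (inj₂ (w , l , inj₂ (p , r))) =
          inj₂ (minimum-unique e (isMin⁻ t) mc (transitive e (symmetric e r) (symmetric e rc)))
        except i t (inj₂ (w , l , inj₁ (p , r))) with minimum-unique e (isMin⁻ t) md (transitive e (symmetric e r) (symmetric e rd))
        ... | refl = ⊥-elim (<-asym (<-≤-trans d<c (least mc (transitive e rc (symmetric e p)))) l)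

    rank-merge : rank (merge x a b) ≤ suc (rank x)
    rank-merge = ≤-trans (∸-monoʳ-≤ (suc n) blocks-merge) (≤-reflexive (+-∸-assoc 1 (blocks≤ x)))

  record Between {n} (x y : Rel n) (r : ℕ) : Set where
    constructor between
    field
      {mid}     : Rel n
      partition : IsPartition mid
      ⊒-lower   : x ⊑ mid
      ⊑-upper   : mid ⊑ y
      rank-mid  : rank mid ≡ r

  -- Merging a pair of `y` that `x` lacks stays below `y` and raises the rank by exactly one, so no
  -- rank is skipped.
  interpolate : ∀ {n} {x y : Rel n} → IsPartition x → IsPartition y → x ⊑ y →
                ∀ {r} → rank x ≤ r → r ≤ rank y → Between x y r
  -- Fuel is measured from `suc r`, so that running out of it would mean that `rank x` exceeds `r`.
  interpolate {n} {x} {y} ex ey s {r} = go (suc r ∸ rank x) ex s ≤-refl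
    where
    go : ∀ b {x} → IsPartition x → x ⊑ y → suc r ∸ rank x ≤ b → rank x ≤ r → r ≤ rank y → Between x y r
    go zero {x} ex s f lo hi = ⊥-elim (<⇒≱ (s≤s lo) (m∸n≡0⇒m≤n (n≤0⇒n≡0 f)))
    go (suc b) {x} ex s f lo hi with m≤n⇒m<n∨m≡n lo
    ... | inj₂ q = between ex ⊑-refl s q
    ... | inj₁ x<r =
      let i , j , p , ¬p = difference {x = x} {y} (λ t → <⇒≱ (<-≤-trans x<r hi) (rank-mono t))
          em = merge-partition ex i j
          x<m = rank-strict ex em (⊑-merge ex i j) (λ q → ¬p (subst (λ z → R z i j) (sym q) (merge-joins ex i j)))
          between e l u q = go b em (merge-least ex i j ey s p)
                              (s≤s⁻¹ (≤-trans (∸-strict x<m (m≤n⇒m≤1+n (≤-trans (rank-merge ex i j) x<r))) f))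
                              (≤-trans (rank-merge ex i j) x<r) hi
      in between e (⊑-trans (⊑-merge ex i j) l) u q
      where
      ∸-strict : ∀ {a b c} → a < b → b ≤ c → c ∸ b < c ∸ a
      ∸-strict p q = ∸-monoʳ-< p q

  bot : ∀ {n} → Rel n
  bot = mk _==F_

  top : ∀ {n} → Rel n
  top = mk (λ _ _ → true)

  bot⁻ : ∀ {n} {i j : Fin n} → R bot i j → i ≡ j
  bot⁻ h = toWitness (R-mk⁻ _==F_ h)

  bot⁺ : ∀ {n} (i : Fin n) → R bot i i
  bot⁺ i = R-mk⁺ _==F_ (fromWitness refl)

  bot-partition : ∀ {n} → IsPartition {n} bot
  bot-partition = record
    { reflexive  = bot⁺
    ; symmetric  = λ {i} {j} h → subst (λ k → R bot k i) (bot⁻ h) (bot⁺ i)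
    ; transitive = λ {i} {j} {k} h g → subst (λ l → R bot l k) (sym (bot⁻ h)) g
    }

  bot-⊑ : ∀ {n} {x : Rel n} → IsPartition x → bot ⊑ x
  bot-⊑ {x = x} e i j h = subst (R x i) (bot⁻ h) (reflexive e i)

  top⁺ : ∀ {n} (i j : Fin n) → R top i j
  top⁺ i j = R-mk⁺ (λ _ _ → true) _

  top-partition : ∀ {n} → IsPartition {n} top
  top-partition = record
    { reflexive  = λ i → top⁺ i i
    ; symmetric  = λ {i} {j} _ → top⁺ j i
    ; transitive = λ {i} {_} {k} _ _ → top⁺ i k
    }

  ⊑-top : ∀ {n} {x : Rel n} → x ⊑ top
  ⊑-top i j _ = top⁺ i j

  rank-bot : ∀ {n} → rank {n} bot ≡ 0
  rank-bot {n} = trans (cong (n ∸_) (trans (count-all (allFin n) all-min) (length-tabulate {n = n} (λ i → i)))) (n∸n≡0 n)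
    where
    all-min : ∀ i → T (isMin bot i)
    all-min i = isMin⁺ {x = bot} {i} (λ j l r → <⇒≢ l (cong toℕ (bot⁻ r)))

  rank< : ∀ {n} {x : Rel (suc n)} → IsPartition x → rank x ≤ n
  rank< {n} {x} e =
    let m , mm , _ = minimum e zero
    in ∸-monoʳ-≤ (suc n) (count-positive {p = isMin x} (∈-allFin m) (isMin⁺ {x = x} mm))

  rank-top : ∀ {n} → rank {suc n} top ≡ n
  rank-top {n} = ≤-antisym (rank< top-partition)
    (∸-monoʳ-≤ (suc n) (≤-trans (count-exception {q = λ _ → false} zero (allFin (suc n)) (allFin⁺ (suc n)) only-zero)
                                 (s≤s (≤-reflexive (none (allFin (suc n)))))))
    where
    only-zero : ∀ i → T (isMin {suc n} top i) → T false ⊎ i ≡ zero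
    only-zero zero    _ = inj₂ refl
    only-zero (suc i) t = ⊥-elim (isMin⁻ {x = top} t zero (s≤s z≤n) (top⁺ zero (suc i)))
    none : ∀ {A : Set} (l : List A) → length (filterᵇ (λ _ → false) l) ≡ 0
    none []      = refl
    none (_ ∷ l) = none l

  meet : ∀ {n} → Rel n → Rel n → Rel n
  meet x y = mk (λ i j → rel x i j ∧ rel y i j)

  meet⁻ : ∀ {n} (x y : Rel n) {i j} → R (meet x y) i j → R x i j × R y i j
  meet⁻ x y {i} {j} h = let p , q = to (T-∧ {rel x i j}) (R-mk⁻ (λ i j → rel x i j ∧ rel y i j) h) in ⟨ p ⟩ , ⟨ q ⟩

  meet⁺ : ∀ {n} (x y : Rel n) {i j} → R x i j → R y i j → R (meet x y) i j
  meet⁺ x y p q = R-mk⁺ (λ i j → rel x i j ∧ rel y i j) (from T-∧ (holds p , holds q))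

  meet-partition : ∀ {n} {x y : Rel n} → IsPartition x → IsPartition y → IsPartition (meet x y)
  meet-partition {x = x} {y} ex ey = record
    { reflexive  = λ i → meet⁺ x y (reflexive ex i) (reflexive ey i)
    ; symmetric  = λ h → let p , q = meet⁻ x y h in meet⁺ x y (symmetric ex p) (symmetric ey q)
    ; transitive = λ h k → let p , q = meet⁻ x y h ; r , s = meet⁻ x y k
                           in meet⁺ x y (transitive ex p r) (transitive ey q s)
    }

-- Lexicographic comparison of Boolean words.

module Lexicographic where
  open import Data.Bool using (Bool; true; false)
  open import Data.Nat
  open import Data.Nat.Properties
  open import Data.List using (List; []; _∷_; _++_; map; length)
  open import Data.List.Properties using (length-++)
  open import Data.List.Membership.Propositional using (_∈_)
  open import Data.List.Relation.Unary.Any using (here; there)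
  open import Data.Product using (_×_; _,_; ∃-syntax)
  open import Data.Sum using (_⊎_; inj₁; inj₂)
  open import Data.Empty using (⊥-elim)
  open import Relation.Nullary using (¬_; Dec; yes; no)
  open import Relation.Binary.PropositionalEquality

  -- Kept next to the numeric value `num` because it passes through concatenation on either side,
  -- which is how a change of one element reaches the word of a chain.
  data Less : List Bool → List Bool → Set where
    here  : ∀ {bs cs} → length bs ≡ length cs → Less (true ∷ bs) (false ∷ cs)
    there : ∀ {b bs cs} → Less bs cs → Less (b ∷ bs) (b ∷ cs)

  -- Binary value of the negated bits, so that words with early trues are small.
  num : List Bool → ℕ
  num []           = 0
  num (true ∷ bs)  = num bs
  num (false ∷ bs) = 2 ^ length bs + num bs

  num-bound : ∀ bs → num bs < 2 ^ length bs
  num-bound []           = s≤s z≤n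
  num-bound (true ∷ bs)  = <-≤-trans (num-bound bs) (m≤m+n _ _)
  num-bound (false ∷ bs) = +-monoʳ-< (2 ^ length bs) (<-≤-trans (num-bound bs) (m≤m+n _ 0))

  Less-length : ∀ {bs cs} → Less bs cs → length bs ≡ length cs
  Less-length (here e)  = cong suc e
  Less-length (there l) = cong suc (Less-length l)

  num-Less : ∀ {bs cs} → Less bs cs → num bs < num cs
  num-Less {true ∷ bs} {false ∷ cs} (here e) =
    <-≤-trans (num-bound bs) (≤-trans (≤-reflexive (cong (2 ^_) e)) (m≤m+n _ (num cs)))
  num-Less {true ∷ _}  (there l) = num-Less l
  num-Less {false ∷ bs} {false ∷ cs} (there l) =
    +-mono-≤-< (≤-reflexive (cong (2 ^_) (Less-length l))) (num-Less l)

  num-Less⁻ : ∀ bs cs → length bs ≡ length cs → num bs < num cs → Less bs cs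
  num-Less⁻ []           []           e ()
  num-Less⁻ (true ∷ bs)  (true ∷ cs)  e l = there (num-Less⁻ bs cs (suc-injective e) l)
  num-Less⁻ (true ∷ bs)  (false ∷ cs) e l = here (suc-injective e)
  num-Less⁻ (false ∷ bs) (true ∷ cs)  e l = ⊥-elim (<⇒≱ l (≤-trans (<⇒≤ (num-bound cs))
    (≤-trans (≤-reflexive (cong (2 ^_) (sym (suc-injective e)))) (m≤m+n _ (num bs)))))
  num-Less⁻ (false ∷ bs) (false ∷ cs) e l = there (num-Less⁻ bs cs e′
    (+-cancelˡ-< (2 ^ length bs) _ _ (subst (λ k → 2 ^ length bs + num bs < 2 ^ k + num cs) (sym e′) l)))
    where e′ = suc-injective e

  Less-++ˡ : ∀ us {bs cs} → Less bs cs → Less (us ++ bs) (us ++ cs)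
  Less-++ˡ []       l = l
  Less-++ˡ (u ∷ us) l = there (Less-++ˡ us l)

  Less-++ʳ : ∀ {bs cs us vs} → length us ≡ length vs → Less bs cs → Less (bs ++ us) (cs ++ vs)
  Less-++ʳ {true ∷ bs} {false ∷ cs} {us} {vs} q (here e) =
    here (trans (length-++ bs) (trans (cong₂ _+_ e q) (sym (length-++ cs))))
  Less-++ʳ q (there l) = there (Less-++ʳ q l)

  Less-first : ∀ {A : Set} (f g : A → Bool) pre {a} suf → f a ≡ true → g a ≡ false →
               (∀ {p} → p ∈ pre → f p ≡ g p) → Less (map f (pre ++ a ∷ suf)) (map g (pre ++ a ∷ suf))
  Less-first f g []        {a} suf fa ga e rewrite fa | ga = here (lengths suf)
    where
    lengths : ∀ l → length (map f l) ≡ length (map g l)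
    lengths []      = refl
    lengths (_ ∷ l) = cong suc (lengths l)
  Less-first f g (p ∷ pre) suf fa ga e rewrite e (here refl) = there (Less-first f g pre suf fa ga (λ i → e (there i)))

  first : ∀ {A : Set} {P : A → Set} → (∀ a → Dec (P a)) → ∀ l →
          (∃[ pre ] ∃[ a ] ∃[ suf ] (l ≡ pre ++ a ∷ suf × P a × (∀ {p} → p ∈ pre → ¬ P p))) ⊎
          (∀ {a} → a ∈ l → ¬ P a)
  first P? [] = inj₂ (λ ())
  first P? (a ∷ l) with P? a | first P? l
  ... | yes p | _ = inj₁ ([] , a , l , refl , p , λ ())
  ... | no ¬p | inj₁ (pre , b , suf , refl , q , h) =
    inj₁ (a ∷ pre , b , suf , refl , q , λ { (here refl) → ¬p ; (there i) → h i })
  ... | no ¬p | inj₂ h = inj₂ (λ { (here refl) → ¬p ; (there i) → h i })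

-- Greedy elements of intervals in the partition lattice.

module Greedy where
  open Partitions
  open Lexicographic
  open import Defs
  open import Data.Bool using (Bool; true; false)
  open import Data.Bool.Properties using (T-≡)
  open import Data.Nat using (ℕ; _<_)
  open import Data.Nat.Properties
  open import Data.Fin using (Fin)
  open import Data.List using (List; []; _∷_; _++_; map)
  open import Data.List.Properties using (++-assoc)
  open import Data.List.Membership.Propositional using (_∈_)
  open import Data.List.Membership.Propositional.Properties using (∈-++⁺ˡ; ∈-++⁺ʳ)
  open import Data.List.Relation.Unary.Any using (here)
  open import Data.Product using (_×_; _,_; ∃-syntax; proj₁; proj₂)
  open import Data.Sum using (_⊎_; inj₁; inj₂)
  open import Data.Empty using (⊥-elim)
  open import Function.Bundles using (Equivalence)
  open import Relation.Nullary using (¬_; Dec; yes; no)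
  open import Relation.Nullary.Decidable using (_×-dec_; ¬?; decidable-stable)
  open import Relation.Binary.PropositionalEquality
  open Equivalence using (to; from)

  module Order {n} (atoms : List (Fin n × Fin n)) (all-atoms : ∀ i j → (i , j) ∈ atoms) where

    Atom : Set
    Atom = Fin n × Fin n

    _∋_ : Rel n → Atom → Set
    x ∋ a = R x (proj₁ a) (proj₂ a)

    _∋?_ : ∀ x a → Dec (x ∋ a)
    x ∋? a = R? x (proj₁ a) (proj₂ a)

    bits : Rel n → List Bool
    bits x = map (λ a → rel x (proj₁ a) (proj₂ a)) atoms

    value : Rel n → ℕ
    value x = num (bits x)

    record Fills (pre : List Atom) (y w : Rel n) : Set where
      constructor fills
      field fill : ∀ {p} → p ∈ pre → y ∋ p → w ∋ p
    open Fills public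

    record FirstOutside (z y : Rel n) : Set where
      constructor firstOutside
      field
        {pre suf} : List Atom
        {atom}    : Atom
        split     : atoms ≡ pre ++ atom ∷ suf
        inside    : y ∋ atom
        outside   : ¬ z ∋ atom
        before    : Fills pre y z

    fills-or-first : ∀ {l} y z →
      (∃[ pre ] ∃[ a ] ∃[ suf ] (l ≡ pre ++ a ∷ suf × (y ∋ a × ¬ z ∋ a) × Fills pre y z)) ⊎ Fills l y z
    fills-or-first {l} y z with first (λ a → (y ∋? a) ×-dec ¬? (z ∋? a)) l
    ... | inj₁ (pre , a , suf , e , p , h) =
      inj₁ (pre , a , suf , e , p , fills (λ {q} i yq → decidable-stable (z ∋? q) (λ ¬zq → h i (yq , ¬zq))))
    ... | inj₂ h = inj₂ (fills (λ {q} i yq → decidable-stable (z ∋? q) (λ ¬zq → h i (yq , ¬zq))))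

    fills-all : ∀ {y z} → Fills atoms y z → y ⊑ z
    fills-all h i j r = fill h (all-atoms i j) r

    fills-trans : ∀ {pre y y′ z} → y′ ⊑ y → Fills pre y z → Fills pre y′ z
    fills-trans s h = fills (λ {p} i r → fill h i (s (proj₁ p) (proj₂ p) r))

    firstOutside-exists : ∀ {z y} → ¬ y ⊑ z → FirstOutside z y
    firstOutside-exists {z} {y} ne with fills-or-first {atoms} y z
    ... | inj₁ (_ , _ , _ , e , (p , q) , h) = firstOutside e p q h
    ... | inj₂ h = ⊥-elim (ne (fills-all h))

    _⊑?_ : ∀ x y → Dec (x ⊑ y)
    x ⊑? y with fills-or-first {atoms} x y
    ... | inj₁ (_ , a , _ , _ , (p , q) , _) = no (λ s → q (s (proj₁ a) (proj₂ a) p))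
    ... | inj₂ h = yes (fills-all h)

    less-first : ∀ {z z′ y pre a suf} → atoms ≡ pre ++ a ∷ suf → z ⊑ y → z′ ⊑ y → z ∋ a → ¬ z′ ∋ a →
                 Fills pre y z → Fills pre y z′ → Less (bits z) (bits z′)
    less-first {z} {z′} {y} {pre} {a} {suf} e s s′ za ¬z′a h h′ =
      subst (λ l → Less (map (bit z) l) (map (bit z′) l)) (sym e)
        (Less-first (bit z) (bit z′) pre suf (to T-≡ (holds za)) (false-bit ¬z′a)
          (λ {p} i → T-ext (λ t → holds (fill h′ i (s (proj₁ p) (proj₂ p) ⟨ t ⟩)))
                           (λ t → holds (fill h i (s′ (proj₁ p) (proj₂ p) ⟨ t ⟩)))))
      where
      bit : Rel n → Atom → Bool
      bit x a = rel x (proj₁ a) (proj₂ a)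
      false-bit : ¬ z′ ∋ a → bit z′ a ≡ false
      false-bit ¬p with bit z′ a in q
      ... | false = refl
      ... | true  = ⊥-elim (¬p ⟨ from T-≡ q ⟩)

    -- z is the closure of x and of the atoms of y preceding the first atom of y outside z.
    record Gr (x z y : Rel n) : Set where
      constructor gr
      field closure : ∀ (o : FirstOutside z y) {w} → IsPartition w → x ⊑ w →
                      Fills (FirstOutside.pre o) y w → z ⊑ w
    open Gr public

    LocMin : Rel n → Rel n → Rel n → Set
    LocMin x z y = ∀ {z′} → IsPartition z′ → x ⊑ z′ → z′ ⊑ y → rank z′ ≡ rank z → ¬ value z′ < value z

    -- An exchange argument as in matroids. If some `w` showed the closure to be too small, the meet
    -- of `w` and `z` would have lower rank than `z` while containing `x` and all early atoms of
    -- `y`. Adding the first missing atom costs at most one rank, so the result can be filled up to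
    -- the rank of `z` inside `y`, and it precedes `z`.
    locMin-Gr : ∀ {x z y} → IsPartition x → IsPartition z → IsPartition y → x ⊑ z → z ⊑ y → LocMin x z y → Gr x z y
    locMin-Gr {x} {z} {y} ex ez ey xz zy lm = gr go
      where
      go : ∀ (o : FirstOutside z y) {w} → IsPartition w → x ⊑ w → Fills (FirstOutside.pre o) y w → z ⊑ w
      go (firstOutside {pre} {suf} {a , b} e ya ¬za h) {w} ew xw hw with z ⊑? w
      ... | yes s = s
      ... | no ¬s = ⊥-elim (lm ez′ (⊑-trans (⊑-trans xm (⊑-merge em a b)) lo) hi rk
                       (num-Less (less-first e hi zy (lo a b (merge-joins em a b)) ¬za hz′ h)))
        where
        m = meet w z
        em = meet-partition ew ez
        mz : m ⊑ z
        mz i j r = proj₂ (meet⁻ w z r)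
        xm : x ⊑ m
        xm i j r = meet⁺ w z (xw i j r) (xz i j r)
        m<z : rank m < rank z
        m<z = rank-strict em ez mz (λ q → ¬s (λ i j r → proj₁ (meet⁻ w z (subst (λ v → R v i j) (sym q) r))))
        em′ = merge-partition em a b
        bt = interpolate em′ ey (merge-least em a b ey (⊑-trans mz zy) ya)
               (≤-trans (rank-merge em a b) m<z) (rank-mono zy)
        open Between bt renaming (mid to z′; partition to ez′; ⊒-lower to lo; ⊑-upper to hi; rank-mid to rk)
        hz′ : Fills pre y z′
        hz′ = fills (λ {p} i r → lo (proj₁ p) (proj₂ p) (⊑-merge em a b (proj₁ p) (proj₂ p)
                (meet⁺ w z (fill hw i r) (fill h i r))))

    -- Take the first atom of `x₃` outside `x₁`. If `x₂` contains it, it is also the first atom of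
    -- `x₂` outside `x₁`, and `g₁` applies. Otherwise it is the first one outside `x₂` as well;
    -- since `x₁` already has all earlier atoms of `x₃`, `g₂` would force `x₂ ⊑ x₁`.
    Gr-extend : ∀ {x₀ x₁ x₂ x₃} → IsPartition x₁ → x₁ ⊑ x₂ → ¬ x₂ ⊑ x₁ → x₂ ⊑ x₃ →
                Gr x₀ x₁ x₂ → Gr x₁ x₂ x₃ → Gr x₀ x₁ x₃
    Gr-extend {x₀} {x₁} {x₂} {x₃} e₁ s₁₂ ¬s₂₁ s₂₃ g₁ g₂ = gr go
      where
      go : ∀ (o : FirstOutside x₁ x₃) {w} → IsPartition w → x₀ ⊑ w → Fills (FirstOutside.pre o) x₃ w → x₁ ⊑ w
      go (firstOutside {pre} {suf} {a} e p ¬q h) ew s hw with x₂ ∋? a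
      ... | yes in₂ = closure g₁ (firstOutside e in₂ ¬q (fills-trans s₂₃ h)) ew s (fills-trans s₂₃ hw)
      ... | no out₂ = ⊥-elim (¬s₂₁ (closure g₂ (firstOutside e p out₂
                        (fills (λ {c} i r → s₁₂ (proj₁ c) (proj₂ c) (fill h i r)))) e₁ ⊑-refl h))

    -- A competitor with all the early atoms of `y` contains `z` and equals it by rank. Any other
    -- competitor first departs from `z` at an early atom of `y`, which `z` has and the competitor
    -- lacks.
    Gr-least : ∀ {x z y z′} → IsPartition z → IsPartition z′ → Gr x z y → z ⊑ y → rank z < rank y →
               x ⊑ z′ → z′ ⊑ y → rank z′ ≡ rank z → z ≡ z′ ⊎ Less (bits z) (bits z′)
    Gr-least {x} {z} {y} {z′} ez ez′ g zy z<y xz′ z′y q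
      with firstOutside-exists {z} {y} (λ s → <⇒≱ z<y (rank-mono s))
    ... | o@(firstOutside {pre} {suf} {a} e p ¬q h) with fills-or-first {pre} y z′
    ...   | inj₂ h′ = inj₁ (rank-tight ez ez′ (closure g o ez′ xz′ h′) (sym q))
    ...   | inj₁ (pre₁ , c , pre₂ , refl , (yc , ¬z′c) , h₁) = inj₂
            (less-first (trans e (++-assoc pre₁ (c ∷ pre₂) (a ∷ suf))) zy z′y
              (fill h (∈-++⁺ʳ pre₁ (here refl)) yc) ¬z′c (fills (λ i → fill h (∈-++⁺ˡ i))) h₁)

-- Comb partitions, interval partitions and the order on pairs.

module Combs where
  open Partitions
  open Greedy
  open import Defs
  open import Data.Bool using (Bool; T; _∧_; _∨_)
  open import Data.Bool.Properties using (T-∧; T-∨)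
  open import Data.Nat using (ℕ; _∸_; _≟_; zero; suc; _+_; _≤_; _<_; _≤ᵇ_; _≤?_; _<?_; _⊔_; z≤n; s≤s; s≤s⁻¹)
  open import Data.Nat.Properties
  open import Data.Fin using (Fin; toℕ; zero; suc; inject₁; fromℕ; fromℕ<)
  import Data.Fin.Properties as Fin
  open import Data.Fin.Properties using (toℕ-injective; toℕ-inject₁; toℕ-fromℕ; toℕ-fromℕ<; toℕ<n; toℕ≤pred[n]; all?; any?)
  open import Data.Fin.Relation.Unary.Top using (view; ‵fromℕ; ‵inject₁)
  open import Data.List using (List; []; _∷_; _++_; map; allFin; cartesianProduct)
  open import Data.List.Properties using (map-++; ++-assoc; ∷-injective)
  open import Data.List.Membership.Propositional using (_∈_)
  open import Data.List.Membership.Propositional.Properties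
    using (∈-++⁺ʳ; ∈-map⁺; ∈-map⁻; ∈-allFin; ∈-cartesianProduct⁺)
  open import Data.List.Relation.Unary.Any using (here; there)
  open import Data.Product using (_×_; _,_; ∃-syntax; proj₁; proj₂)
  open import Data.Sum using (_⊎_; inj₁; inj₂)
  open import Data.Empty using (⊥; ⊥-elim)
  open import Function.Bundles using (Equivalence)
  open import Relation.Nullary using (¬_; Dec; yes; no)
  open import Relation.Nullary.Decidable using (map′; _×-dec_; _⊎-dec_; _→-dec_; fromWitness; toWitness; isYes)
  open import Relation.Binary.PropositionalEquality
  open Equivalence using (to; from)

  descending : ∀ k → List (Fin k)
  descending zero    = []
  descending (suc k) = fromℕ k ∷ map inject₁ (descending k)

  descending-split : ∀ k (i : Fin k) → ∃[ pre ] ∃[ suf ]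
    (descending k ≡ pre ++ i ∷ suf × (∀ {p} → p ∈ pre → toℕ i < toℕ p))
  descending-split (suc k) i with view i
  ... | ‵fromℕ = [] , _ , refl , λ ()
  ... | ‵inject₁ j =
    let pre , suf , e , h = descending-split k j
    in fromℕ k ∷ map inject₁ pre , map inject₁ suf
     , cong (fromℕ k ∷_) (trans (cong (map inject₁) e) (map-++ inject₁ pre (j ∷ suf)))
     , λ { (here refl) → subst₂ _<_ (sym (toℕ-inject₁ j)) (sym (toℕ-fromℕ k)) (toℕ<n j)
         ; (there q) → let p , ip , eq = ∈-map⁻ inject₁ q
                       in subst₂ _<_ (sym (toℕ-inject₁ j)) (trans (sym (toℕ-inject₁ p)) (cong toℕ (sym eq))) (h ip) }

  -- Decides whether everything read before a given atom is a path edge, or all path edges have been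
  -- read already.
  ++-compare : ∀ {A : Set} (pre : List A) {a suf} es {rest} → pre ++ a ∷ suf ≡ es ++ rest →
               (∀ {p} → p ∈ pre → p ∈ es) ⊎ (∀ {p} → p ∈ es → p ∈ pre)
  ++-compare []        es       e = inj₁ (λ ())
  ++-compare (p ∷ pre) []       e = inj₂ (λ ())
  ++-compare (p ∷ pre) (q ∷ es) e with ∷-injective e
  ... | refl , e′ with ++-compare pre es e′
  ...   | inj₁ h = inj₁ (λ { (here r) → here r ; (there i) → there (h i) })
  ...   | inj₂ h = inj₂ (λ { (here r) → here r ; (there i) → there (h i) })

  greatest : ∀ {n} {P : Fin (suc n) → Set} → (∀ i → Dec (P i)) → P zero →
             ∃[ j ] (P j × (∀ i → P i → toℕ i ≤ toℕ j))
  greatest {n} {P} P? pz = go n (λ i _ → toℕ≤pred[n] i)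
    where
    go : ∀ b → (∀ i → P i → toℕ i ≤ b) → ∃[ j ] (P j × (∀ i → P i → toℕ i ≤ toℕ j))
    go zero    h = zero , pz , h
    go (suc b) h with any? (λ i → P? i ×-dec (toℕ i ≟ suc b))
    ... | yes (j , p , e) = j , p , λ i q → subst (toℕ i ≤_) (sym e) (h i q)
    ... | no none = go b (λ i q → s≤s⁻¹ (≤∧≢⇒< (h i q) (λ e → none (i , q , e))))

  -- At most one block is non-trivial. Stated through the relation alone, so that invariance under
  -- permutations is immediate.
  OneBlock : ∀ {n} → Rel n → Set
  OneBlock x = ∀ {i j k l} → R x i j → i ≢ j → R x k l → k ≢ l → R x i k

  combᵇ : ∀ {n} → ℕ → Fin n → Fin n → Bool
  combᵇ r i j = (i ==F j) ∨ ((toℕ i ≤ᵇ r) ∧ (toℕ j ≤ᵇ r))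

  comb : ∀ {n} → ℕ → Rel n
  comb r = mk (combᵇ r)

  comb⁻ : ∀ {n} r {i j : Fin n} → R (comb r) i j → i ≡ j ⊎ (toℕ i ≤ r × toℕ j ≤ r)
  comb⁻ r {i} {j} h with to (T-∨ {i ==F j}) (R-mk⁻ (combᵇ r) h)
  ... | inj₁ t = inj₁ (toWitness t)
  ... | inj₂ t = let p , q = to (T-∧ {toℕ i ≤ᵇ r}) t in inj₂ (≤ᵇ⇒≤ _ _ p , ≤ᵇ⇒≤ _ _ q)

  comb⁺ : ∀ {n} r {i j : Fin n} → i ≡ j ⊎ (toℕ i ≤ r × toℕ j ≤ r) → R (comb r) i j
  comb⁺ r {i} {j} h = R-mk⁺ (combᵇ r) (from (T-∨ {i ==F j}) (go h))
    where
    go : i ≡ j ⊎ (toℕ i ≤ r × toℕ j ≤ r) → T (i ==F j) ⊎ T ((toℕ i ≤ᵇ r) ∧ (toℕ j ≤ᵇ r))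
    go (inj₁ e)       = inj₁ (fromWitness e)
    go (inj₂ (p , q)) = inj₂ (from T-∧ (≤⇒≤ᵇ p , ≤⇒≤ᵇ q))

  comb-partition : ∀ {n} r → IsPartition {n} (comb r)
  comb-partition {n} r = record
    { reflexive  = λ i → comb⁺ r (inj₁ refl)
    ; symmetric  = λ h → comb⁺ r (sm (comb⁻ r h))
    ; transitive = λ h k → comb⁺ r (tr (comb⁻ r h) (comb⁻ r k))
    }
    where
    C : Fin n → Fin n → Set
    C i j = i ≡ j ⊎ (toℕ i ≤ r × toℕ j ≤ r)
    sm : ∀ {i j} → C i j → C j i
    sm (inj₁ e)       = inj₁ (sym e)
    sm (inj₂ (p , q)) = inj₂ (q , p)
    tr : ∀ {i j k} → C i j → C j k → C i k
    tr (inj₁ refl) c = c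
    tr c (inj₁ refl) = c
    tr (inj₂ (p , _)) (inj₂ (_ , q)) = inj₂ (p , q)

  comb-mono : ∀ {n r s} → r ≤ s → comb {n} r ⊑ comb s
  comb-mono {r = r} {s} l i j h with comb⁻ r h
  ... | inj₁ e       = comb⁺ s (inj₁ e)
  ... | inj₂ (p , q) = comb⁺ s (inj₂ (≤-trans p l , ≤-trans q l))

  comb-oneBlock : ∀ {n} r → OneBlock {n} (comb r)
  comb-oneBlock r p i≢j q k≢l with comb⁻ r p | comb⁻ r q
  ... | inj₁ e | _ = ⊥-elim (i≢j e)
  ... | _ | inj₁ e = ⊥-elim (k≢l e)
  ... | inj₂ (a , _) | inj₂ (b , _) = comb⁺ r (inj₂ (a , b))

  comb-strict : ∀ {n r s} → r < s → s ≤ n → ¬ comb {suc n} s ⊑ comb r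
  comb-strict {n} {r} {s} r<s s≤n h =
    no-way (comb⁻ r (h zero j (comb⁺ s (inj₂ (z≤n , ≤-reflexive ej)))))
    where
    j = fromℕ< {s} {suc n} (s≤s s≤n)
    ej : toℕ j ≡ s
    ej = toℕ-fromℕ< (s≤s s≤n)
    no-way : zero ≡ j ⊎ (0 ≤ r × toℕ j ≤ r) → ⊥
    no-way (inj₁ e) = n≮0 (subst (r <_) (trans (sym ej) (cong toℕ (sym e))) r<s)
    no-way (inj₂ (_ , q)) = <⇒≱ r<s (subst (_≤ r) ej q)

  comb-zero : ∀ {n} → comb {suc n} 0 ≡ bot
  comb-zero = ⊑-antisym sub (bot-⊑ (comb-partition 0))
    where
    sub : comb 0 ⊑ bot
    sub i j h with comb⁻ 0 h
    ... | inj₁ refl    = bot⁺ i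
    ... | inj₂ (p , q) with toℕ-injective (trans (n≤0⇒n≡0 p) (sym (n≤0⇒n≡0 q)))
    ...   | refl = bot⁺ i

  comb-top : ∀ {n} → comb {suc n} n ≡ top
  comb-top {n} = ⊑-antisym ⊑-top (λ i j _ → comb⁺ n (inj₂ (toℕ≤pred[n] i , toℕ≤pred[n] j)))

  rank-comb-< : ∀ {n r s} → r < s → s ≤ n → rank (comb {suc n} r) < rank (comb {suc n} s)
  rank-comb-< {n} {r} {s} l h = rank-strict (comb-partition r) (comb-partition s) (comb-mono (<⇒≤ l))
    (λ e → comb-strict l h (λ i j p → subst (λ x → R x i j) (sym e) p))

  -- No block minima are counted: the combs from 0 to `n` form a strict chain and no rank exceeds
  -- `n`, so every step raises the rank by exactly one.
  rank-comb : ∀ {n} r → r ≤ n → rank (comb {suc n} r) ≡ r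
  rank-comb {n} r l = ≤-antisym
    (+-cancelʳ-≤ (n ∸ r) _ _ (≤-trans (upper (n ∸ r) r (m+[n∸m]≡n l)) (≤-reflexive (sym (m+[n∸m]≡n l)))))
    (lower r l)
    where
    lower : ∀ r → r ≤ n → r ≤ rank (comb {suc n} r)
    lower zero    _ = z≤n
    lower (suc r) h = ≤-trans (s≤s (lower r (<⇒≤ h))) (rank-comb-< (n<1+n r) h)
    upper : ∀ d r → r + d ≡ n → rank (comb {suc n} r) + d ≤ n
    upper zero    r e = subst (_≤ n) (sym (+-identityʳ _)) (rank< (comb-partition r))
    upper (suc d) r e = ≤-trans (≤-reflexive (+-suc _ d))
      (≤-trans (+-monoˡ-≤ d (rank-comb-< (n<1+n r) (≤-trans (m≤m+n (suc r) d) (≤-reflexive (trans (sym (+-suc r d)) e)))))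
               (upper d (suc r) (trans (sym (+-suc r d)) e)))

  module Path (m : ℕ) where

    N : ℕ
    N = suc (suc m)

    edge : Fin (suc m) → Fin N × Fin N
    edge k = inject₁ k , suc k

    -- The edge {0,1} is preferred to all others, so that a rank-one element is never a
    -- descent of the comb chain but every higher rank is: there the greedy choice is to add
    -- the last path edge available instead of prolonging the block of 0.
    edges : List (Fin N × Fin N)
    edges = edge zero ∷ map edge (descending (suc m))

    -- Path edges occur again in the product; this is harmless, since only the first occurrence of a
    -- pair can decide a comparison.
    atoms : List (Fin N × Fin N)
    atoms = edges ++ cartesianProduct (allFin N) (allFin N)

    all-atoms : ∀ i j → (i , j) ∈ atoms
    all-atoms i j = ∈-++⁺ʳ edges (∈-cartesianProduct⁺ (∈-allFin i) (∈-allFin j))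

    open Order atoms all-atoms public

    special : Atom
    special = edge zero

    edge-∈ : ∀ k → edge k ∈ edges
    edge-∈ k with descending-split (suc m) k
    ... | pre , suf , e , _ =
      there (∈-map⁺ edge (subst (k ∈_) (sym e) (∈-++⁺ʳ pre (here refl))))

    edges-∈ : ∀ {p} → p ∈ edges → ∃[ k ] p ≡ edge k
    edges-∈ (here e)  = zero , e
    edges-∈ (there i) = let k , _ , e = ∈-map⁻ edge i in k , e

    Crosses : Fin N → Fin N → Fin (suc m) → Set
    Crosses i j k = (toℕ i ≤ toℕ k × toℕ k < toℕ j) ⊎ (toℕ j ≤ toℕ k × toℕ k < toℕ i)

    record Inner (z : Rel N) (i j : Fin N) : Set where
      constructor inner
      field edges-in : ∀ k → Crosses i j k → z ∋ edge k
    open Inner public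

    Inner? : ∀ z i j → Dec (Inner z i j)
    Inner? z i j = map′ inner edges-in (all? (λ k →
      (((toℕ i ≤? toℕ k) ×-dec (toℕ k <? toℕ j)) ⊎-dec ((toℕ j ≤? toℕ k) ×-dec (toℕ k <? toℕ i))) →-dec (z ∋? edge k)))

    -- The partition generated by the path edges that `z` contains.
    interior : Rel N → Rel N
    interior z = mk (λ i j → isYes (Inner? z i j))

    interior⁺ : ∀ z {i j} → Inner z i j → R (interior z) i j
    interior⁺ z h = R-mk⁺ (λ i j → isYes (Inner? z i j)) (fromWitness h)

    interior⁻ : ∀ z {i j} → R (interior z) i j → Inner z i j
    interior⁻ z h = toWitness (R-mk⁻ (λ i j → isYes (Inner? z i j)) h)

    interior-partition : ∀ z → IsPartition (interior z)
    interior-partition z = record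
      { reflexive  = λ i → interior⁺ z (inner (λ k → λ
          { (inj₁ (p , q)) → ⊥-elim (<⇒≱ q p) ; (inj₂ (p , q)) → ⊥-elim (<⇒≱ q p) }))
      ; symmetric  = λ h → interior⁺ z (inner (λ k b → edges-in (interior⁻ z h) k (swap b)))
      ; transitive = λ {i} {j} {l} h g → interior⁺ z (inner (λ k b → tr {i} {j} {l} (edges-in (interior⁻ z h)) (edges-in (interior⁻ z g)) k b (toℕ j ≤? toℕ k)))
      }
      where
      swap : ∀ {A B : Set} → A ⊎ B → B ⊎ A
      swap (inj₁ a) = inj₂ a
      swap (inj₂ b) = inj₁ b
      -- An edge separating `i` from `l` separates `i` from `j` or `j` from `l`, according to the
      -- side on which `j` lies.
      tr : ∀ {i j l} → (∀ k → Crosses i j k → z ∋ edge k) → (∀ k → Crosses j l k → z ∋ edge k) →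
           ∀ k → Crosses i l k → Dec (toℕ j ≤ toℕ k) → z ∋ edge k
      tr f g k (inj₁ (p , q)) (yes r) = g k (inj₁ (r , q))
      tr f g k (inj₁ (p , q)) (no r)  = f k (inj₁ (p , ≰⇒> r))
      tr f g k (inj₂ (p , q)) (yes r) = f k (inj₂ (r , q))
      tr f g k (inj₂ (p , q)) (no r)  = g k (inj₂ (p , ≰⇒> r))

    path⇒R : ∀ {z} → IsPartition z → ∀ {i} j → toℕ i ≤ toℕ j →
             (∀ k → toℕ i ≤ toℕ k → toℕ k < toℕ j → z ∋ edge k) → R z i j
    path⇒R {z} ez {i} j l f = go (toℕ j) j refl l f
      where
      go : ∀ d j → toℕ j ≡ d → toℕ i ≤ toℕ j → (∀ k → toℕ i ≤ toℕ k → toℕ k < toℕ j → z ∋ edge k) → R z i j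
      go zero j e l f with toℕ-injective {i = i} {j} (≤-antisym l (subst (_≤ toℕ i) (sym e) z≤n))
      ... | refl = reflexive ez i
      go (suc d) (suc k) e l f with m≤n⇒m<n∨m≡n l
      ... | inj₂ q with toℕ-injective {i = i} {suc k} q
      ...   | refl = reflexive ez i
      go (suc d) (suc k) e l f | inj₁ q = transitive ez
        (go d (inject₁ k) (trans (toℕ-inject₁ k) (suc-injective e)) (subst (toℕ i ≤_) (sym (toℕ-inject₁ k)) (s≤s⁻¹ q))
            (λ k′ a b → f k′ a (<-trans b (subst (_< suc (toℕ k)) (sym (toℕ-inject₁ k)) ≤-refl))))
        (f k (s≤s⁻¹ q) ≤-refl)

    Inner⇒R : ∀ {z} → IsPartition z → ∀ {i j} → Inner z i j → R z i j
    Inner⇒R ez {i} {j} h with ≤-total (toℕ i) (toℕ j)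
    ... | inj₁ l = path⇒R ez j l (λ k p q → edges-in h k (inj₁ (p , q)))
    ... | inj₂ l = symmetric ez (path⇒R ez i l (λ k p q → edges-in h k (inj₂ (p , q))))

    -- The blocks are intervals. The wording by path edges matches the early atoms on which `Gr`
    -- tests a closure.
    record Convex (z : Rel N) : Set where
      constructor convex
      field R⇒Inner : ∀ {i j} → R z i j → Inner z i j
    open Convex public

    Inner-mono : ∀ {x z i j} → x ⊑ z → Inner x i j → Inner z i j
    Inner-mono s h = inner (λ k b → s _ _ (edges-in h k b))

    edge-Inner : ∀ {z} k → z ∋ edge k → Inner z (inject₁ k) (suc k)
    edge-Inner {z} k h = inner (λ k′ b → subst (λ k → z ∋ edge k) (toℕ-injective {i = k} {k′} (only k′ b)) h)
      where
      only : ∀ k′ → Crosses (inject₁ k) (suc k) k′ → toℕ k ≡ toℕ k′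
      only k′ (inj₁ (p , q)) = ≤-antisym (subst (_≤ toℕ k′) (toℕ-inject₁ k) p) (s≤s⁻¹ q)
      only k′ (inj₂ (p , q)) = ⊥-elim (<⇒≱ p (<⇒≤ (subst (toℕ k′ <_) (toℕ-inject₁ k) q)))

    bot-convex : Convex bot
    bot-convex = convex (λ {i} h → subst (Inner bot i) (bot⁻ h)
      (inner (λ k → λ { (inj₁ (p , q)) → ⊥-elim (<⇒≱ q p) ; (inj₂ (p , q)) → ⊥-elim (<⇒≱ q p) })))

    top-convex : Convex top
    top-convex = convex (λ _ → inner (λ k _ → top⁺ (inject₁ k) (suc k)))

    comb-convex : ∀ r → Convex (comb r)
    comb-convex r = convex (λ {i} {j} h → inner (λ k b → comb⁺ r (inj₂ (go i j (comb⁻ r h) k b))))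
      where
      go : ∀ i j → i ≡ j ⊎ (toℕ i ≤ r × toℕ j ≤ r) → ∀ k → Crosses i j k → toℕ (inject₁ k) ≤ r × suc (toℕ k) ≤ r
      go i .i (inj₁ refl) k (inj₁ (p , q)) = ⊥-elim (<⇒≱ q p)
      go i .i (inj₁ refl) k (inj₂ (p , q)) = ⊥-elim (<⇒≱ q p)
      go i j (inj₂ (a , b)) k (inj₁ (p , q)) =
        subst (_≤ r) (sym (toℕ-inject₁ k)) (≤-trans (<⇒≤ q) b) , ≤-trans q b
      go i j (inj₂ (a , b)) k (inj₂ (p , q)) =
        subst (_≤ r) (sym (toℕ-inject₁ k)) (≤-trans (<⇒≤ q) a) , ≤-trans q a

    -- If the first atom of y outside z is a path edge, then z is generated by path edges.
    Gr-convex : ∀ {x z y} → Gr x z y → IsPartition z → IsPartition y → x ⊑ z → ¬ y ⊑ z →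
                Convex x → Convex y → Convex z
    Gr-convex {x} {z} {y} g ez ey xz ¬yz cx cy with firstOutside-exists ¬yz
    ... | o@(firstOutside {pre} {suf} {a} e ya ¬za h) with ++-compare pre edges (sym e)
    -- `interior z` is the competitor: it contains the convex `x` and the early edges of `y`, so the
    -- closure condition places `z` inside it.
    ...   | inj₁ sub = convex (λ {i} {j} r → interior⁻ z (closure g o (interior-partition z)
                          (λ i j r → interior⁺ z (Inner-mono xz (R⇒Inner cx r))) (fills fill′) i j r))
      where
      fill′ : ∀ {p} → p ∈ pre → y ∋ p → interior z ∋ p
      fill′ i yp with edges-∈ (sub i)
      ... | k , refl = interior⁺ z (edge-Inner k (fill h i yp))
    -- Here all path edges come earlier, so `z` contains those of `y`; as `y` is convex, `z` would
    -- contain `y`.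
    ...   | inj₂ sup = ⊥-elim (¬yz (λ i j r → Inner⇒R ez
                          (inner (λ k b → fill h (sup (edge-∈ k)) (edges-in (R⇒Inner cy r) k b)))))

    -- `special` heads the list of atoms. If `z` missed it, no atom would come earlier, and the
    -- closure condition tested on `x` itself would give `z ⊑ x`.
    Gr-special : ∀ {x z y} → Gr x z y → IsPartition x → ¬ z ⊑ x → y ∋ special → z ∋ special
    Gr-special {x} {z} {y} g ex ¬zx s with z ∋? special
    ... | yes p = p
    ... | no ¬p = ⊥-elim (¬zx (closure g (firstOutside {pre = []} refl s ¬p (fills (λ ()))) ex ⊑-refl (fills (λ ()))))

    comb-special : ∀ {r} → 1 ≤ r → comb r ∋ special
    comb-special {r} l = comb⁺ r (inj₂ (z≤n , l))

    -- The first atom of comb t outside comb s is its last path edge, and only the special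
    -- edge precedes it.
    comb-not-Gr : ∀ {r s t} → r < s → s < t → t ≤ suc m → 2 ≤ s → ¬ Gr (comb r) (comb s) (comb t)
    comb-not-Gr {r} {s} {suc t} r<s (s≤s s≤t) (s≤s t≤m) 2≤s g =
      -- The competitor `comb (r ⊔ 1)` contains `comb r` and the special edge, which is all that is
      -- demanded of it. It fails to contain `comb s` because both `r` and 1 are below `s`; for 1
      -- this is the bound `2 ≤ s`.
      comb-strict {suc m} {r ⊔ 1} {s} (⊔-lub r<s 2≤s) (≤-trans s≤t (≤-trans t≤m (n≤1+n m)))
        (closure g o (comb-partition (r ⊔ 1)) (comb-mono (m≤m⊔n r 1)) (fills early))
      where
      k = fromℕ< {t} {suc m} (s≤s t≤m)
      ek : toℕ k ≡ t
      ek = toℕ-fromℕ< (s≤s t≤m)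
      sp = descending-split (suc m) k
      pre₀ = proj₁ sp
      suf₀ = proj₁ (proj₂ sp)
      pre = special ∷ map edge pre₀
      rest = cartesianProduct (allFin N) (allFin N)
      split₀ : atoms ≡ pre ++ edge k ∷ (map edge suf₀ ++ rest)
      split₀ = cong (special ∷_) (trans (cong (λ l → map edge l ++ rest) (proj₁ (proj₂ (proj₂ sp))))
        (trans (cong (_++ rest) (map-++ edge pre₀ (k ∷ suf₀))) (++-assoc (map edge pre₀) _ rest)))
      early : ∀ {p} → p ∈ pre → comb (suc t) ∋ p → comb (r ⊔ 1) ∋ p
      early (here refl) _ = comb-special (m≤n⊔m r 1)
      early (there i)   h with ∈-map⁻ edge i
      ... | k′ , j , refl with comb⁻ (suc t) h
      ...   | inj₁ q = ⊥-elim (1+n≢n (trans (sym (cong toℕ q)) (toℕ-inject₁ k′)))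
      ...   | inj₂ (_ , q) = ⊥-elim (<⇒≱ (subst (_< toℕ k′) ek (proj₂ (proj₂ (proj₂ sp)) j)) (s≤s⁻¹ q))
      1≤s : 1 ≤ s
      1≤s = ≤-trans (n≤1+n 1) 2≤s
      out : ¬ comb s ∋ edge k
      out h with comb⁻ s h
      ... | inj₁ q = 1+n≢n (trans (sym (cong toℕ q)) (toℕ-inject₁ k))
      ... | inj₂ (_ , q) = <⇒≱ (subst (λ v → suc v ≤ s) ek q) s≤t
      o : FirstOutside (comb s) (comb (suc t))
      o = firstOutside split₀
            (comb⁺ (suc t) (inj₂ (≤-trans (≤-reflexive (trans (toℕ-inject₁ k) ek)) (n≤1+n t) , s≤s (≤-reflexive ek))))
            out (fills (λ i h → comb-mono {r = r ⊔ 1} {s} (⊔-lub (<⇒≤ r<s) 1≤s) _ _ (early i h)))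

    -- Convexity makes the non-trivial block an interval, `special` makes it start at 0, and the
    -- rank determines its end.
    convex-oneBlock : ∀ {x} → IsPartition x → Convex x → x ∋ special → OneBlock x → x ≡ comb (rank x)
    convex-oneBlock {x} ex cx sx ob with greatest (λ j → R? x zero j) (reflexive ex zero)
    ... | j , r0j , max = subst (λ r → x ≡ comb r) (trans (sym (rank-comb (toℕ j) (toℕ≤pred[n] j))) (cong rank (sym x≡))) x≡
      where
      sub : x ⊑ comb (toℕ j)
      sub a b h with a Fin.≟ b
      ... | yes e = comb⁺ (toℕ j) (inj₁ e)
      ... | no ne = comb⁺ (toℕ j) (inj₂ ( max a (symmetric ex (ob h ne sx (λ ())))
                                       , max b (symmetric ex (ob (symmetric ex h) (λ e → ne (sym e)) sx (λ ())))))
      near : ∀ a → toℕ a ≤ toℕ j → R x zero a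
      near a l = path⇒R ex a z≤n (λ k _ q → edges-in (R⇒Inner cx r0j) k (inj₁ (z≤n , <-≤-trans q l)))
      sup : comb (toℕ j) ⊑ x
      sup a b h with comb⁻ (toℕ j) h
      ... | inj₁ refl = reflexive ex a
      ... | inj₂ (p , q) = transitive ex (symmetric ex (near a p)) (near b q)
      x≡ : x ≡ comb (toℕ j)
      x≡ = ⊑-antisym sub sup

-- The enumerations are complete and free of repetitions.

module Enumeration where
  open Partitions
  open import Defs
  open import Data.Bool using (Bool; true; false; T?)
  open import Data.Bool.Properties using (T-∧)
  open import Data.Nat using (ℕ; zero; suc; _≡ᵇ_)
  open import Data.Nat.Properties using (≡ᵇ⇒≡; ≡⇒≡ᵇ)
  open import Data.Fin using (zero; suc)
  open import Data.List using (List; []; _∷_; map; concatMap)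
  open import Data.List.Membership.Propositional using (_∈_; find; lose)
  open import Data.List.Membership.Propositional.Properties
    using (∈-concatMap⁺; ∈-concatMap⁻; ∈-map⁺; ∈-map⁻; ∈-filter⁺; ∈-filter⁻)
  open import Data.List.Relation.Unary.Any using (here; there)
  open import Data.List.Relation.Unary.All as All using (All; []; _∷_)
  open import Data.List.Relation.Unary.AllPairs using ([]; _∷_)
  open import Data.List.Relation.Unary.Unique.Propositional using (Unique)
  open import Data.List.Relation.Unary.Unique.Propositional.Properties using (filter⁺; map⁺; ++⁺)
  open import Data.Vec as Vec using (Vec; []; _∷_)
  open import Data.Product using (_,_; proj₁; proj₂)
  open import Function.Bundles using (Equivalence)
  open import Relation.Binary.PropositionalEquality
  open Equivalence using (to; from)

  concatMap-unique : ∀ {A B : Set} (f : A → List B) {xs} → Unique xs → (∀ x → Unique (f x)) →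
                     (∀ {x y b} → b ∈ f x → b ∈ f y → x ≡ y) → Unique (concatMap f xs)
  concatMap-unique f []       uf inj = []
  concatMap-unique f {x ∷ xs} (x∉ ∷ u) uf inj =
    ++⁺ (uf x) (concatMap-unique f u uf inj) (λ { (p , q) →
      let y , iy , q′ = find (∈-concatMap⁻ f {xs = xs} q) in All.lookup x∉ iy (inj p q′) })

  allVecs-∈ : ∀ {A : Set} {xs : List A} → ∀ {n} (v : Vec A n) → (∀ i → Vec.lookup v i ∈ xs) → v ∈ allVecs xs n
  allVecs-∈ [] h = here refl
  allVecs-∈ {xs = xs} {suc n} (a ∷ v) h =
    ∈-concatMap⁺ (λ x → map (x ∷_) (allVecs xs n)) (lose (h zero) (∈-map⁺ (a ∷_) (allVecs-∈ v (λ i → h (suc i)))))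

  allVecs-unique : ∀ {A : Set} {xs : List A} → Unique xs → ∀ n → Unique (allVecs xs n)
  allVecs-unique u zero    = [] ∷ []
  allVecs-unique {xs = xs} u (suc n) =
    concatMap-unique (λ x → map (x ∷_) (allVecs xs n)) u
      (λ x → map⁺ (λ { refl → refl }) (allVecs-unique u n)) same
    where
    same : ∀ {x y b} → b ∈ map (x ∷_) (allVecs xs n) → b ∈ map (y ∷_) (allVecs xs n) → x ≡ y
    same p q with ∈-map⁻ _ p | ∈-map⁻ _ q
    ... | _ , _ , refl | _ , _ , refl = refl

  booleans : List Bool
  booleans = true ∷ false ∷ []

  ∈-booleans : ∀ b → b ∈ booleans
  ∈-booleans true  = here refl
  ∈-booleans false = there (here refl)

  booleans-unique : Unique booleans
  booleans-unique = ((λ ()) ∷ []) ∷ [] ∷ []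

  ∈-partitions : ∀ {n} {x : Rel n} → IsPartition x → x ∈ partitions n
  ∈-partitions {n} {x} e = ∈-filter⁺ (λ x → T? (isEquivRel x))
    (allVecs-∈ x (λ i → allVecs-∈ (Vec.lookup x i) (λ j → ∈-booleans _))) (isEquivRel⁺ e)

  partitions-∈ : ∀ {n} {x : Rel n} → x ∈ partitions n → IsPartition x
  partitions-∈ {n} i =
    isEquivRel⁻ (proj₂ (∈-filter⁻ (λ x → T? (isEquivRel x)) {xs = allVecs (allVecs booleans n) n} i))

  partitions-unique : ∀ n → Unique (partitions n)
  partitions-unique n = filter⁺ (λ x → T? (isEquivRel x)) (allVecs-unique (allVecs-unique booleans-unique n) n)

  -- The default `top` stands for 1̂, so that the last element of a chain has an upper neighbour
  -- like the others.
  hd : ∀ {n} → List (Rel n) → Rel n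
  hd []      = top
  hd (x ∷ _) = x

  data IsChain {n} : List ℕ → List (Rel n) → Set where
    []   : IsChain [] []
    cons : ∀ {r rs x c} → IsPartition x → rank x ≡ r → x ⊑ hd c → IsChain rs c → IsChain (r ∷ rs) (x ∷ c)

  chains-∈ : ∀ {n} rs {c} → c ∈ chainsWithRanks n rs → IsChain rs c
  chains-∈ [] (here refl) = []
  chains-∈ {n} (r ∷ rs) i with find (∈-concatMap⁻ _ {xs = chainsWithRanks n rs} i)
  ... | c , ic , j with ∈-map⁻ (_∷ c) j
  ...   | x , k , refl with ∈-filter⁻ (λ _ → T? _) {xs = partitions n} k
  chains-∈ (r ∷ rs) i | []    , ic , j | x , k , refl | ip , t =
    cons (partitions-∈ ip) (≡ᵇ⇒≡ _ _ (proj₁ (to T-∧ t))) ⊑-top (chains-∈ rs ic)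
  chains-∈ (r ∷ rs) i | y ∷ _ , ic , j | x , k , refl | ip , t =
    cons (partitions-∈ ip) (≡ᵇ⇒≡ _ _ (proj₁ (to T-∧ t)))
         (refines⁻ (proj₂ (to (T-∧ {rank x ≡ᵇ r}) t))) (chains-∈ rs ic)

  ∈-chains : ∀ {n} rs {c} → IsChain rs c → c ∈ chainsWithRanks n rs
  ∈-chains [] [] = here refl
  ∈-chains (r ∷ rs) (cons {x = x} {[]} e q s h) =
    ∈-concatMap⁺ _ (lose (∈-chains rs h) (∈-map⁺ (_∷ [])
      (∈-filter⁺ (λ _ → T? _) (∈-partitions e) (from (T-∧ {rank x ≡ᵇ r}) (≡⇒≡ᵇ _ _ q , _)))))
  ∈-chains (r ∷ rs) (cons {x = x} {y ∷ c} e q s h) =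
    ∈-concatMap⁺ _ (lose (∈-chains rs h) (∈-map⁺ (_∷ (y ∷ c))
      (∈-filter⁺ (λ _ → T? _) (∈-partitions e) (from (T-∧ {rank x ≡ᵇ r}) (≡⇒≡ᵇ _ _ q , refines⁺ s)))))

  chains-unique : ∀ n rs → Unique (chainsWithRanks n rs)
  chains-unique n []       = [] ∷ []
  chains-unique n (r ∷ rs) = concatMap-unique _ (chains-unique n rs)
    (λ c → map⁺ (λ { refl → refl }) (filter⁺ (λ _ → T? _) (partitions-unique n))) same
    where
    same : ∀ {c d b} {l l′ : List (Rel n)} → b ∈ map (_∷ c) l → b ∈ map (_∷ d) l′ → c ≡ d
    same p q with ∈-map⁻ _ p | ∈-map⁻ _ q
    ... | _ , _ , refl | _ , _ , refl = refl

-- Rank-selected chains and their descents.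

module Chains where
  open Masks
  open Partitions
  open Lexicographic
  open Greedy
  open Combs
  open Enumeration
  open import Defs
  open import Data.Bool using (Bool; true; false)
  open import Data.Nat using (ℕ; suc; _+_; _≤_; _<_; _<?_; _≟_)
  open import Data.Nat.Properties
  open import Data.List using (List; []; _∷_; map; concatMap; length)
  open import Data.List.Properties using (∷-injective; ∷-injectiveˡ; ∷-injectiveʳ; length-++; length-map)
  open import Data.List.Membership.Propositional using (find; lose)
  open import Data.List.Relation.Unary.Any using (Any; any?)
  open import Data.List.Relation.Unary.All using (All; []; _∷_)
  open import Data.Vec using ([]; _∷_)
  open import Data.Product using (_×_; _,_; ∃-syntax; proj₁; proj₂)
  open import Data.Sum using (_⊎_; inj₁; inj₂)
  open import Data.Empty using (⊥-elim)
  open import Relation.Nullary using (¬_; Dec; yes; no; does)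
  open import Relation.Nullary.Decidable using (_×-dec_)
  open import Relation.Binary.PropositionalEquality

  private variable
    A B : Set

  sel : ∀ {k} → Mask k → List A → List A
  sel []          c       = []
  sel (_ ∷ _)     []      = []
  sel (true ∷ m)  (x ∷ c) = x ∷ sel m c
  sel (false ∷ m) (x ∷ c) = sel m c

  sel-map : ∀ {k} (h : A → B) (m : Mask k) c → sel m (map h c) ≡ map h (sel m c)
  sel-map h []          c       = refl
  sel-map h (_ ∷ _)     []      = refl
  sel-map h (true ∷ m)  (x ∷ c) = cong (h x ∷_) (sel-map h m c)
  sel-map h (false ∷ m) (x ∷ c) = sel-map h m c

  data Increasing (b : ℕ) : ℕ → List ℕ → Set where
    []  : ∀ {r} → r < b → Increasing b r []
    _∷_ : ∀ {r s rs} → r < s → Increasing b s rs → Increasing b r (s ∷ rs)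

  module Descents (m : ℕ) where
    open Path m

    Chain : Set
    Chain = List (Rel N)

    Improves : Rel N → Rel N → Rel N → Rel N → Set
    Improves x z y z′ = x ⊑ z′ × z′ ⊑ y × rank z′ ≡ rank z × value z′ < value z

    -- Abstract, since unfolding the enumeration of all partitions is expensive.
    abstract
      improvable? : ∀ x z y → Dec (Any (Improves x z y) (partitions N))
      improvable? x z y = any? (λ z′ →
        (x ⊑? z′) ×-dec (z′ ⊑? y) ×-dec (rank z′ ≟ rank z) ×-dec (value z′ <? value z)) (partitions N)

      isDescent : Rel N → Rel N → Rel N → Bool
      isDescent x z y = does (improvable? x z y)

      isDescent-false : ∀ x z y → isDescent x z y ≡ false → LocMin x z y
      isDescent-false x z y q ez′ s t r l with improvable? x z y
      ... | no ¬p = ¬p (lose (∈-partitions ez′) (s , t , r , l))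

      isDescent-true : ∀ x z y → isDescent x z y ≡ true → ∃[ z′ ] (IsPartition z′ × Improves x z y z′)
      isDescent-true x z y q with improvable? x z y
      ... | yes p = let z′ , i , h = find p in z′ , partitions-∈ i , h

    -- `lo` is the lower neighbour of the first element, `hd c` the upper neighbour of `x`. The
    -- clause for a chain that is too short is a filler: an `IsChain` has one element for each rank.
    D : (rs : List ℕ) → Rel N → Chain → Mask (length rs)
    D []       lo c       = []
    D (r ∷ rs) lo []      = false ∷ D rs lo []
    D (r ∷ rs) lo (x ∷ c) = isDescent lo x (hd c) ∷ D rs x c

    word : Chain → List Bool
    word = concatMap bits

    bits-length : ∀ x x′ → length (bits x) ≡ length (bits x′)
    bits-length x x′ = trans (length-map _ atoms) (sym (length-map _ atoms))

    word-length : ∀ {rs c c′} → IsChain rs c → IsChain rs c′ → length (word c) ≡ length (word c′)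
    word-length [] [] = refl
    word-length (cons {x = x} {c} _ _ _ h) (cons {x = x′} {c′} _ _ _ h′) =
      trans (length-++ (bits x)) (trans (cong₂ _+_ (bits-length x x′) (word-length h h′)) (sym (length-++ (bits x′))))

    sel-mono : ∀ {rs} {c c′ : Chain} (p q : Mask (length rs)) → IsChain rs c → IsChain rs c′ → (p ≼ q) ≡ true →
               sel q c ≡ sel q c′ → sel p c ≡ sel p c′
    sel-mono [] [] [] [] l e = refl
    sel-mono (true ∷ p)  (true ∷ q)  (cons _ _ _ h) (cons _ _ _ h′) l e =
      cong₂ _∷_ (∷-injectiveˡ e) (sel-mono p q h h′ l (∷-injectiveʳ e))
    sel-mono (false ∷ p) (true ∷ q)  (cons _ _ _ h) (cons _ _ _ h′) l e = sel-mono p q h h′ l (∷-injectiveʳ e)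
    sel-mono (false ∷ p) (false ∷ q) (cons _ _ _ h) (cons _ _ _ h′) l e = sel-mono p q h h′ l e

    sel-full : ∀ {rs} {c c′ : Chain} (p : Mask (length rs)) → IsChain rs c → IsChain rs c′ → isFull p ≡ true →
               sel p c ≡ sel p c′ → c ≡ c′
    sel-full [] [] [] f e = refl
    sel-full (true ∷ p) (cons _ _ _ h) (cons _ _ _ h′) f e =
      cong₂ _∷_ (∷-injectiveˡ e) (sel-full p h h′ f (∷-injectiveʳ e))

    -- A single descent outside `p` is replaced by its improvement. This fits between the same
    -- neighbours, so the rest of the chain stays, and the word drops at that place.
    lower : ∀ {rs c} lo (p : Mask (length rs)) → IsChain rs c → lo ⊑ hd c → (D rs lo c ≼ p) ≡ false →
            ∃[ c′ ] (IsChain rs c′ × lo ⊑ hd c′ × sel p c′ ≡ sel p c × Less (word c′) (word c))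
    lower lo [] [] s ()
    lower {r ∷ rs} {x ∷ c} lo (b ∷ p) (cons e q t h) s ¬l with isDescent lo x (hd c) in d
    lower {r ∷ rs} {x ∷ c} lo (false ∷ p) (cons e q t h) s ¬l | true =
      let z′ , ez′ , lz , zu , rz , v = isDescent-true lo x (hd c) d
      in z′ ∷ c , cons ez′ (trans rz q) zu h , lz , refl
       , Less-++ʳ refl (num-Less⁻ (bits z′) (bits x) (bits-length z′ x) v)
    lower {r ∷ rs} {x ∷ c} lo (true ∷ p) (cons e q t h) s ¬l | true =
      let c′ , h′ , t′ , e′ , l = lower x p h t ¬l
      in x ∷ c′ , cons e q t′ h′ , s , cong (x ∷_) e′ , Less-++ˡ (bits x) l
    lower {r ∷ rs} {x ∷ c} lo (true ∷ p) (cons e q t h) s ¬l | false =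
      let c′ , h′ , t′ , e′ , l = lower x p h t ¬l
      in x ∷ c′ , cons e q t′ h′ , s , cong (x ∷_) e′ , Less-++ˡ (bits x) l
    lower {r ∷ rs} {x ∷ c} lo (false ∷ p) (cons e q t h) s ¬l | false =
      let c′ , h′ , t′ , e′ , l = lower x p h t ¬l
      in x ∷ c′ , cons e q t′ h′ , s , e′ , Less-++ˡ (bits x) l

    -- The upper end for a run of unmarked elements: the next marked element, or 1̂ if there is
    -- none.
    anchor : ∀ {k} → Mask k → Chain → Rel N
    anchor []          c       = top
    anchor (_ ∷ _)     []      = top
    anchor (true ∷ p)  (x ∷ c) = x
    anchor (false ∷ p) (x ∷ c) = anchor p c

    anchor-sel : ∀ {rs c c′} (p : Mask (length rs)) → IsChain rs c → IsChain rs c′ →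
                 sel p c ≡ sel p c′ → anchor p c ≡ anchor p c′
    anchor-sel [] [] [] e = refl
    anchor-sel (true ∷ p)  (cons _ _ _ h) (cons _ _ _ h′) e = ∷-injectiveˡ e
    anchor-sel (false ∷ p) (cons _ _ _ h) (cons _ _ _ h′) e = anchor-sel p h h′ e

    hd-partition : ∀ {rs} {c : Chain} → IsChain rs c → IsPartition (hd c)
    hd-partition []             = top-partition
    hd-partition (cons e _ _ _) = e

    anchor-partition : ∀ {rs c} (p : Mask (length rs)) → IsChain rs c → IsPartition (anchor p c)
    anchor-partition [] [] = top-partition
    anchor-partition (true ∷ p)  (cons e _ _ h) = e
    anchor-partition (false ∷ p) (cons e _ _ h) = anchor-partition p h

    hd-⊑-anchor : ∀ {rs c} (p : Mask (length rs)) → IsChain rs c → hd c ⊑ anchor p c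
    hd-⊑-anchor [] [] = ⊑-refl
    hd-⊑-anchor (true ∷ p)  (cons e _ s h) = ⊑-refl
    hd-⊑-anchor (false ∷ p) (cons e _ s h) = ⊑-trans s (hd-⊑-anchor p h)

    hd-rank : ∀ {r rs} {c : Chain} → IsChain rs c → Increasing (suc m) r rs → r < rank (hd c)
    hd-rank [] ([] l) = ≤-trans l (≤-reflexive (sym (rank-top {suc m})))
    hd-rank (cons _ q _ _) (l ∷ _) = ≤-trans l (≤-reflexive (sym q))

    anchor-rank : ∀ {r rs c} (p : Mask (length rs)) → IsChain rs c → Increasing (suc m) r rs → r < rank (anchor p c)
    anchor-rank p h inc = <-≤-trans (hd-rank h inc) (rank-mono (hd-⊑-anchor p h))

    not-⊑ : ∀ {x y : Rel N} → rank x < rank y → ¬ y ⊑ x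
    not-⊑ l s = <⇒≱ l (rank-mono s)

    -- Between two descents every element of c is a local minimum, and local minimality
    -- propagates from the nearest upper neighbour to the next descent above.
    anchor-Gr : ∀ {r rs x c} lo → IsPartition lo → lo ⊑ x → IsChain (r ∷ rs) (x ∷ c) → Increasing (suc m) r rs →
                isDescent lo x (hd c) ≡ false → Gr lo x (anchor (D rs x c) c)
    anchor-Gr lo elo s (cons e q t []) inc d = locMin-Gr elo e top-partition s ⊑-top (isDescent-false _ _ _ d)
    anchor-Gr {r} {_ ∷ rs} {x} lo elo s (cons e q t h@(cons {x = y} {c} ey qy ty hy)) inc@(l ∷ inc′) d
      with isDescent x y (hd c) in d′
    ... | true  = locMin-Gr elo e ey s t (isDescent-false _ _ _ d)
    ... | false = Gr-extend e t (not-⊑ (subst (_< rank y) (sym q) (hd-rank h inc))) (⊑-trans ty (hd-⊑-anchor (D rs y c) hy))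
                    (locMin-Gr elo e ey s t (isDescent-false _ _ _ d))
                    (anchor-Gr x e t h inc′ d′)

    -- At a descent the first elements coincide. Otherwise `x` is greedy up to the next descent
    -- above it, which `c′` shares, so `Gr-least` compares `x` with `x′`; in case of equality `x`
    -- becomes the new lower end.
    least : ∀ {r rs c c′} lo → IsPartition lo → lo ⊑ hd c → lo ⊑ hd c′ → IsChain rs c → IsChain rs c′ → Increasing (suc m) r rs →
            sel (D rs lo c) c ≡ sel (D rs lo c) c′ → c ≡ c′ ⊎ Less (word c) (word c′)
    least lo elo s s′ [] [] inc eq = inj₁ refl
    least {rs = r ∷ rs} {x ∷ c} {x′ ∷ c′} lo elo s s′ ch@(cons e q t h) (cons e′ q′ t′ h′) (_ ∷ inc) eq
      with isDescent lo x (hd c) in d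
    ... | true with ∷-injective {x = x} {xs = sel (D rs x c) c} {y = x′} {ys = sel (D rs x c) c′} eq
    ...   | refl , eq′ with least x e t t′ h h′ inc eq′
    ...     | inj₁ w = inj₁ (cong (x ∷_) w)
    ...     | inj₂ l = inj₂ (Less-++ˡ (bits x) l)
    least {rs = r ∷ rs} {x ∷ c} {x′ ∷ c′} lo elo s s′ ch@(cons e q t h) (cons e′ q′ t′ h′) (_ ∷ inc) eq | false
      with Gr-least e e′ (anchor-Gr lo elo s ch inc d)
             (⊑-trans t (hd-⊑-anchor (D rs x c) h))
             (subst (_< rank (anchor (D rs x c) c)) (sym q) (anchor-rank (D rs x c) h inc))
             s′ (subst (x′ ⊑_) (sym (anchor-sel (D rs x c) h h′ eq)) (⊑-trans t′ (hd-⊑-anchor (D rs x c) h′)))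
             (trans q′ (sym q))
    ... | inj₂ l = inj₂ (Less-++ʳ (word-length h h′) l)
    ... | inj₁ refl with least x e t t′ h h′ inc eq
    ...   | inj₁ w = inj₁ (cong (x ∷_) w)
    ...   | inj₂ l = inj₂ (Less-++ˡ (bits x) l)

    Nice : Chain → Set
    Nice = All (λ x → Convex x × x ∋ special)

    anchor-nice : ∀ {rs c} (p : Mask (length rs)) → IsChain rs c → Nice c → Convex (anchor p c) × anchor p c ∋ special
    anchor-nice [] [] [] = top-convex , top⁺ (proj₁ special) (proj₂ special)
    anchor-nice (true ∷ p)  (cons _ _ _ h) (n ∷ ns) = n
    anchor-nice (false ∷ p) (cons _ _ _ h) (n ∷ ns) = anchor-nice p h ns

    -- At a descent the element comes from the nice chain. Elsewhere it is greedy between `lo` and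
    -- either an element of that chain or `top`: it inherits convexity from both ends and `special`
    -- from the upper one. For `lo` only convexity is carried along, so that the induction can start
    -- at `bot`.
    nice-closed : ∀ {r rs c c′} lo → IsPartition lo → rank lo ≡ r → Convex lo → lo ⊑ hd c →
                  IsChain rs c → IsChain rs c′ → Increasing (suc m) r rs →
                  Nice c′ → sel (D rs lo c) c ≡ sel (D rs lo c) c′ → Nice c
    nice-closed lo elo _ clo s [] [] inc ns eq = []
    nice-closed {rs = r ∷ rs} {x ∷ c} {x′ ∷ c′} lo elo _ clo s ch@(cons e q t h) (cons e′ q′ t′ h′) (_ ∷ inc) (n ∷ ns) eq
      with isDescent lo x (hd c) in d
    ... | true with ∷-injective {x = x} {xs = sel (D rs x c) c} {y = x′} {ys = sel (D rs x c) c′} eq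
    ...   | refl , eq′ = n ∷ nice-closed x e q (proj₁ n) t h h′ inc ns eq′
    nice-closed {rs = r ∷ rs} {x ∷ c} {x′ ∷ c′} lo elo refl clo s ch@(cons e q t h) (cons e′ q′ t′ h′) (l ∷ inc) (n ∷ ns) eq | false =
      (cx , Gr-special g elo (not-⊑ (subst (rank lo <_) (sym q) l)) (proj₂ na)) ∷ nice-closed x e q cx t h h′ inc ns eq
      where
      g = anchor-Gr lo elo s ch inc d
      na : Convex (anchor (D rs x c) c) × anchor (D rs x c) c ∋ special
      na = subst (λ y → Convex y × y ∋ special) (sym (anchor-sel (D rs x c) h h′ eq)) (anchor-nice (D rs x c) h′ ns)
      cx : Convex x
      cx = Gr-convex g e (anchor-partition (D rs x c) h) s
             (not-⊑ (subst (_< rank (anchor (D rs x c) c)) (sym q) (anchor-rank (D rs x c) h inc))) clo (proj₁ na)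

    combs : List ℕ → Chain
    combs = map (comb {N})

    Increasing-≤ : ∀ {r rs} → Increasing (suc m) r rs → r ≤ suc m
    Increasing-≤ ([] l)  = <⇒≤ l
    Increasing-≤ (l ∷ i) = <⇒≤ (<-≤-trans l (Increasing-≤ i))

    combs-above : ∀ {s rs} → Increasing (suc m) s rs → comb s ⊑ hd (combs rs)
    combs-above ([] _)  = ⊑-top
    combs-above (l ∷ _) = comb-mono (<⇒≤ l)

    combs-chain : ∀ {r rs} → Increasing (suc m) r rs → IsChain rs (combs rs)
    combs-chain ([] l) = []
    combs-chain {rs = s ∷ rs} (l ∷ inc) =
      cons (comb-partition s) (rank-comb s (Increasing-≤ inc)) (combs-above inc) (combs-chain inc)

    combs-nice : ∀ {rs} → All (2 ≤_) rs → Nice (combs rs)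
    combs-nice []       = []
    combs-nice {r ∷ _} (h ∷ hs) = (comb-convex r , comb-special {r} (≤-trans (n≤1+n 1) h)) ∷ combs-nice hs

    -- A non-descent would be a local minimum and hence greedy, which `comb-not-Gr` excludes from
    -- rank 2 on. Above the last comb, `top` is itself `comb (suc m)`.
    combs-full : ∀ {r rs} → Increasing (suc m) r rs → All (2 ≤_) rs → isFull (D rs (comb r) (combs rs)) ≡ true
    combs-full ([] _) [] = refl
    combs-full {r} {s ∷ rs} (l ∷ inc) (h ∷ hs) with isDescent (comb r) (comb s) (hd (combs rs)) in d
    ... | true  = combs-full inc hs
    ... | false = ⊥-elim (not-Gr inc (locMin-Gr (comb-partition r) (comb-partition s) (hd-partition (combs-chain inc))
                    (comb-mono (<⇒≤ l)) (combs-above inc) (isDescent-false _ _ _ d)))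
      where
      not-Gr : ∀ {rs} → Increasing (suc m) s rs → ¬ Gr (comb r) (comb s) (hd (combs rs))
      not-Gr ([] u) g = comb-not-Gr {t = suc m} l u ≤-refl h (subst (Gr (comb r) (comb s)) (sym comb-top) g)
      not-Gr (u ∷ inc) g = comb-not-Gr l u (Increasing-≤ inc) h g

-- The symmetric group acting on partitions and chains.

module Action where
  open Partitions
  open Enumeration
  open Combs using (OneBlock; comb; comb-oneBlock)
  open import Defs
  open import Data.Bool using (true; false; T; T?)
  open import Data.Nat using (zero; suc; _+_; _∸_; _≤_; _<_; z≤n; s≤s)
  open import Data.Nat.Properties
  open import Data.Fin using (Fin; zero; suc; punchOut)
  import Data.Fin.Properties as Fin
  open import Data.Fin.Properties using (any?; punchOut-injective; injective⇒≤)
  open import Data.List using ([]; _∷_; map; allFin)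
  open import Data.List.Membership.Propositional using (_∈_)
  open import Data.List.Membership.Propositional.Properties using (∈-allFin; ∈-filter⁺; ∈-filter⁻)
  open import Data.List.Relation.Unary.Unique.Propositional using (Unique)
  open import Data.List.Relation.Unary.Unique.Propositional.Properties using (filter⁺; allFin⁺)
  open import Data.Vec using (Vec; lookup; tabulate)
  open import Data.Vec.Properties using (lookup∘tabulate; tabulate∘lookup; tabulate-cong)
  open import Data.Product using (_×_; _,_; ∃-syntax; proj₁; proj₂)
  open import Data.Empty using (⊥-elim)
  open import Relation.Nullary using (yes; no)
  open import Relation.Nullary.Decidable using (fromWitness; toWitness)
  open import Relation.Binary.PropositionalEquality

  Permutation : ∀ {n} → Vec (Fin n) n → Set
  Permutation σ = ∀ {i j} → lookup σ i ≡ lookup σ j → i ≡ j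

  Sym-∈ : ∀ {n} {σ : Vec (Fin n) n} → σ ∈ Sym n → Permutation σ
  Sym-∈ {n} {σ} i {a} {b} e = toWitness (T-⇒⁻ (lookup σ a ==F lookup σ b)
    (T-∀F⁻ (T-∀F⁻ (proj₂ (∈-filter⁻ (λ σ → T? (isInjective σ)) {xs = allVecs (allFin n) n} i)) a) b) (fromWitness e))

  ∈-Sym : ∀ {n} {σ : Vec (Fin n) n} → Permutation σ → σ ∈ Sym n
  ∈-Sym {n} {σ} inj = ∈-filter⁺ (λ σ → T? (isInjective σ)) (allVecs-∈ σ (λ i → ∈-allFin _))
    (T-∀F⁺ (λ i → T-∀F⁺ (λ j → T-⇒⁺ (lookup σ i ==F lookup σ j) (λ t → fromWitness (inj (toWitness t))))))

  Sym-unique : ∀ n → Unique (Sym n)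
  Sym-unique n = filter⁺ (λ σ → T? (isInjective σ)) (allVecs-unique (allFin⁺ n) n)

  -- Pigeonhole: with a missed value punched out, `suc n` points would inject into `n`.
  surjective : ∀ {n} {σ : Vec (Fin n) n} → Permutation σ → ∀ j → ∃[ i ] lookup σ i ≡ j
  surjective {suc n} {σ} inj j with any? (λ i → lookup σ i Fin.≟ j)
  ... | yes p = p
  ... | no ¬p = ⊥-elim (1+n≰n (injective⇒≤ {f = λ i → punchOut {i = j} {lookup σ i} (λ e → ¬p (i , sym e))}
                  (λ e → inj (punchOut-injective {i = j} _ _ e))))

  lookup-ext : ∀ {n} {A : Set} {u v : Vec A n} → (∀ i → lookup u i ≡ lookup v i) → u ≡ v
  lookup-ext {u = u} {v} e = trans (sym (tabulate∘lookup u)) (trans (tabulate-cong e) (tabulate∘lookup v))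

  infixr 9 _⊙_
  _⊙_ : ∀ {n} → Vec (Fin n) n → Vec (Fin n) n → Vec (Fin n) n
  σ ⊙ τ = tabulate (λ i → lookup σ (lookup τ i))

  lookup-⊙ : ∀ {n} (σ τ : Vec (Fin n) n) i → lookup (σ ⊙ τ) i ≡ lookup σ (lookup τ i)
  lookup-⊙ σ τ i = lookup∘tabulate (λ i → lookup σ (lookup τ i)) i

  ⊙-permutation : ∀ {n} {σ τ : Vec (Fin n) n} → Permutation σ → Permutation τ → Permutation (σ ⊙ τ)
  ⊙-permutation {σ = σ} {τ} p q {i} {j} e = q (p (trans (sym (lookup-⊙ σ τ i)) (trans e (lookup-⊙ σ τ j))))

  ⊙-cancel : ∀ {n} {τ σ ρ : Vec (Fin n) n} → Permutation τ → τ ⊙ σ ≡ τ ⊙ ρ → σ ≡ ρ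
  ⊙-cancel {τ = τ} {σ} {ρ} p e = lookup-ext (λ i →
    p (trans (sym (lookup-⊙ τ σ i)) (trans (cong (λ v → lookup v i) e) (lookup-⊙ τ ρ i))))

  ⊙-solve : ∀ {n} {τ ρ : Vec (Fin n) n} → Permutation τ → Permutation ρ → ∃[ σ ] (Permutation σ × τ ⊙ σ ≡ ρ)
  ⊙-solve {τ = τ} {ρ} p q = σ , σ-inj , lookup-ext (λ i → trans (lookup-⊙ τ σ i) (τσ i))
    where
    pre : _ → _
    pre i = proj₁ (surjective {σ = τ} p (lookup ρ i))
    σ = tabulate pre
    τσ : ∀ i → lookup τ (lookup σ i) ≡ lookup ρ i
    τσ i = trans (cong (lookup τ) (lookup∘tabulate pre i)) (proj₂ (surjective {σ = τ} p (lookup ρ i)))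
    σ-inj : Permutation σ
    σ-inj {i} {j} e = q (trans (sym (τσ i)) (trans (cong (lookup τ) e) (τσ j)))

  identity : ∀ {n} → Vec (Fin n) n
  identity = tabulate (λ i → i)

  identity-permutation : ∀ {n} → Permutation (identity {n})
  identity-permutation {n} {i} {j} e =
    trans (sym (lookup∘tabulate (λ i → i) i)) (trans e (lookup∘tabulate (λ i → i) j))

  -- The pullback along `σ`, that is σ⁻¹ · x. It avoids inverses and has the same fixed points as
  -- the left action, but it is a right action, so products reverse in `act-⊙`.
  act : ∀ {n} → Vec (Fin n) n → Rel n → Rel n
  act σ x = mk (λ i j → rel x (lookup σ i) (lookup σ j))

  act⁺ : ∀ {n} (σ : Vec (Fin n) n) x {i j} → R x (lookup σ i) (lookup σ j) → R (act σ x) i j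
  act⁺ σ x h = R-mk⁺ (λ i j → rel x (lookup σ i) (lookup σ j)) (holds h)

  act⁻ : ∀ {n} (σ : Vec (Fin n) n) x {i j} → R (act σ x) i j → R x (lookup σ i) (lookup σ j)
  act⁻ σ x h = ⟨ R-mk⁻ (λ i j → rel x (lookup σ i) (lookup σ j)) h ⟩

  act-⊙ : ∀ {n} (σ τ : Vec (Fin n) n) x → act σ (act τ x) ≡ act (τ ⊙ σ) x
  act-⊙ σ τ x = mk-cong (λ i j →
    trans (rel-mk (λ i j → rel x (lookup τ i) (lookup τ j)) (lookup σ i) (lookup σ j))
          (sym (cong₂ (rel x) (lookup-⊙ τ σ i) (lookup-⊙ τ σ j))))

  act-identity : ∀ {n} (x : Rel n) → act identity x ≡ x
  act-identity x = trans (mk-cong (λ i j → cong₂ (rel x) (lookup∘tabulate (λ i → i) i) (lookup∘tabulate (λ i → i) j))) (mk-rel x)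

  act-partition : ∀ {n} (σ : Vec (Fin n) n) {x} → IsPartition x → IsPartition (act σ x)
  act-partition σ {x} e = record
    { reflexive  = λ i → act⁺ σ x (reflexive e _)
    ; symmetric  = λ h → act⁺ σ x (symmetric e (act⁻ σ x h))
    ; transitive = λ h k → act⁺ σ x (transitive e (act⁻ σ x h) (act⁻ σ x k))
    }

  act-mono : ∀ {n} (σ : Vec (Fin n) n) {x y} → x ⊑ y → act σ x ⊑ act σ y
  act-mono σ {x} {y} s i j h = act⁺ σ y (s _ _ (act⁻ σ x h))

  fixedBy⇒≡ : ∀ {n} (σ : Vec (Fin n) n) x → T (fixedBy σ x) → act σ x ≡ x
  fixedBy⇒≡ σ x h = trans (mk-cong (λ i j → same (rel x (lookup σ i) (lookup σ j)) _ (T-∀F⁻ (T-∀F⁻ h i) j))) (mk-rel x)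
    where
    same : ∀ a b → T (a ==B b) → a ≡ b
    same true  true  _ = refl
    same false false _ = refl

  ≡⇒fixedBy : ∀ {n} (σ : Vec (Fin n) n) x → act σ x ≡ x → T (fixedBy σ x)
  ≡⇒fixedBy σ x e = T-∀F⁺ (λ i → T-∀F⁺ (λ j →
    same (trans (sym (rel-mk (λ i j → rel x (lookup σ i) (lookup σ j)) i j)) (cong (λ y → rel y i j) e))))
    where
    same : ∀ {a b} → a ≡ b → T (a ==B b)
    same {true}  refl = _
    same {false} refl = _

  module _ {n} {σ : Vec (Fin n) n} (p : Permutation σ) where

    preimage : ∀ {P : Fin n → Fin n → Set} → (∀ i j → P (lookup σ i) (lookup σ j)) → ∀ i j → P i j
    preimage h i j with surjective {σ = σ} p i | surjective {σ = σ} p j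
    ... | i′ , refl | j′ , refl = h i′ j′

    act-reflects : ∀ {x y} → act σ x ⊑ act σ y → x ⊑ y
    act-reflects {x} {y} s = preimage (λ i j h → act⁻ σ y (s i j (act⁺ σ x h)))

    act-strict : ∀ {x y} → IsPartition x → IsPartition y → x ⊑ y → rank x < rank y → rank (act σ x) < rank (act σ y)
    act-strict {x} {y} ex ey s l = rank-strict (act-partition σ ex) (act-partition σ ey) (act-mono σ s)
      (λ q → <⇒≱ l (rank-mono (act-reflects {y} {x} (subst (act σ y ⊑_) (sym q) ⊑-refl))))

    act-oneBlock : ∀ {x} → OneBlock (act σ x) → OneBlock x
    act-oneBlock {x} ob {i} {j} {k} {l} r i≢j s k≢l
      with surjective {σ = σ} p i | surjective {σ = σ} p j | surjective {σ = σ} p k | surjective {σ = σ} p l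
    ... | i′ , refl | j′ , refl | k′ , refl | l′ , refl =
      act⁻ σ x (ob (act⁺ σ x r) (λ e → i≢j (cong (lookup σ) e)) (act⁺ σ x s) (λ e → k≢l (cong (lookup σ) e)))

  module _ {n} {σ : Vec (Fin (suc n)) (suc n)} (p : Permutation σ) where

    -- The rank is the length of a maximal chain below x, and dually above it.
    rank-act-≥ : ∀ r {x} → IsPartition x → rank x ≡ r → r ≤ rank (act σ x)
    rank-act-≥ zero    e q = z≤n
    rank-act-≥ (suc r) {x} e q =
      let between {z} ez _ zx qz = interpolate bot-partition e (bot-⊑ e) {r}
                                     (subst (_≤ r) (sym (rank-bot {suc n})) z≤n) (subst (r ≤_) (sym q) (n≤1+n r))
      in ≤-trans (s≤s (rank-act-≥ r ez qz))
                 (act-strict {σ = σ} p ez e zx (subst₂ _<_ (sym qz) (sym q) (n<1+n r)))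

    rank-act-≤ : ∀ d {x} → IsPartition x → rank x + d ≡ n → rank (act σ x) + d ≤ n
    rank-act-≤ zero {x} e q = subst (_≤ n) (sym (+-identityʳ _)) (rank< (act-partition σ e))
    rank-act-≤ (suc d) {x} e q =
      let r = rank x
          q′ : suc r + d ≡ n
          q′ = trans (sym (+-suc r d)) q
          between {z} ez xz _ qz = interpolate e top-partition ⊑-top {suc r} (n≤1+n r)
                                     (subst (suc r ≤_) (sym (rank-top {n})) (subst (suc r ≤_) q′ (m≤m+n (suc r) d)))
      in ≤-trans (≤-reflexive (+-suc _ d))
         (≤-trans (+-monoˡ-≤ d (act-strict {σ = σ} p e ez xz (subst (r <_) (sym qz) (n<1+n r))))
                  (rank-act-≤ d ez (trans (cong (_+ d) qz) q′)))

    -- `numBlocks` counts least elements of blocks, which a permutation does not respect. Invariance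
    -- is instead squeezed out of the bounds from chains below and above `x`.
    rank-act : ∀ {x} → IsPartition x → rank (act σ x) ≡ rank x
    rank-act {x} e = ≤-antisym
      (+-cancelʳ-≤ d _ _ (≤-trans (rank-act-≤ d e q) (≤-reflexive (sym q))))
      (rank-act-≥ (rank x) e refl)
      where
      d = n ∸ rank x
      q = m+[n∸m]≡n (rank< e)

    act-chain : ∀ {rs c} → IsChain rs c → IsChain rs (map (act σ) c)
    act-chain [] = []
    act-chain (cons {x = x} {c} e q s h) =
      cons (act-partition σ e) (trans (rank-act e) q) (above c s) (act-chain h)
      where
      above : ∀ c → x ⊑ hd c → act σ x ⊑ hd (map (act σ) c)
      above []      s = ⊑-top
      above (_ ∷ _) s = act-mono σ s

-- From the positive trace to the multiplicity of the trivial representation.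

module Multiplicity where
  open Sums
  open Masks
  open Adapted
  open Partitions
  open Lexicographic
  open Combs
  open Enumeration
  open Chains
  open Action
  open import Defs
  open import Data.Bool using (Bool; true; false; T; T?)
  import Data.Bool.Properties as Bool
  open import Data.Bool.Properties using (T-≡)
  open import Data.Nat as ℕ using (ℕ; zero; suc; _∸_; z≤n; s≤s)
  import Data.Nat.Properties as ℕ
  open import Data.Integer using (ℤ; +_; -_; 0ℤ; 1ℤ; _+_; _*_; _<_)
  open import Data.Integer.Properties
  open import Data.Fin using (Fin; zero; suc)
  import Data.Fin.Properties as Fin
  open import Data.Fin.Subset using (Subset; ∣_∣; _∉_)
  open import Data.Fin.Subset.Properties using (_⊆?_; drop-∷-⊆; s⊆s; out⊆; p⊆q⇒∣p∣≤∣q∣)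
  open import Data.List using (List; []; _∷_; map; filter; filterᵇ; length)
  open import Data.List.Properties using (∷-injectiveˡ; ∷-injectiveʳ; length-map; map-∘; map-cong; map-id)
  import Data.List.Properties as List
  open import Data.List.Membership.Propositional using (_∈_)
  open import Data.List.Membership.Propositional.Properties using (∈-filter⁺; ∈-filter⁻)
  open import Data.List.Relation.Unary.All as All using (All; []; _∷_)
  open import Data.List.Relation.Unary.Unique.Propositional.Properties using (filter⁺)
  open import Data.Vec using (Vec; []; _∷_; here; _[_]=_)
  import Data.Vec.Properties as Vec
  open import Data.Product using (_×_; _,_; ∃-syntax; proj₁)
  open import Data.Sum as Sum using (_⊎_)
  open import Data.Empty using (⊥-elim)
  open import Function.Bundles using (Equivalence)
  open import Relation.Binary using (DecidableEquality)
  open import Relation.Nullary using (¬_; Dec; yes; no; does)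
  open import Relation.Binary.PropositionalEquality
  open Equivalence using (to; from)

  weaken : ∀ {b r s rs} → r ℕ.≤ s → Increasing b s rs → Increasing b r rs
  weaken l ([] m)  = [] (ℕ.≤-<-trans l m)
  weaken l (m ∷ i) = ℕ.≤-<-trans l m ∷ i

  sel-increasing : ∀ {b r rs} (p : Mask (length rs)) → Increasing b r rs → Increasing b r (sel p rs)
  sel-increasing []          ([] l)  = [] l
  sel-increasing (true ∷ p)  (l ∷ i) = l ∷ sel-increasing p i
  sel-increasing (false ∷ p) (l ∷ i) = weaken (ℕ.<⇒≤ l) (sel-increasing p i)

  module Positivity (m : ℕ) (rs : List ℕ) (inc : Increasing (suc m) 0 rs) (big : All (2 ℕ.≤_) rs) where
    open Path m using (N)
    open Descents m

    _≟C_ : DecidableEquality Chain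
    _≟C_ = List.≡-dec (Vec.≡-dec (Vec.≡-dec Bool._≟_))

    xs : List Chain
    xs = chainsWithRanks N rs

    Des : Chain → Mask (length rs)
    Des = D rs bot

    psi : Chain → ℕ
    psi c = num (word c)

    bot-⊑-hd : ∀ {ts} {c : Chain} → IsChain ts c → bot ⊑ hd c
    bot-⊑-hd h = bot-⊑ (hd-partition h)

    lower′ : ∀ {p c} → c ∈ xs → (Des c ≼ p) ≡ false →
             ∃[ c′ ] (c′ ∈ xs × sel p c′ ≡ sel p c × psi c′ ℕ.< psi c)
    lower′ {p} {c} i l =
      let h = chains-∈ rs i
          c′ , h′ , _ , e , lt = lower bot p h (bot-⊑-hd h) l
      in c′ , ∈-chains rs h′ , e , num-Less lt

    least′ : ∀ {c c′} → c ∈ xs → c′ ∈ xs → sel (Des c) c ≡ sel (Des c) c′ → c ≡ c′ ⊎ psi c ℕ.< psi c′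
    least′ i i′ e =
      let h = chains-∈ rs i ; h′ = chains-∈ rs i′
      in Sum.map₂ num-Less (least bot bot-partition (bot-⊑-hd h) (bot-⊑-hd h′) h h′ inc e)

    open Expansion _≟C_ _≟C_ xs (chains-unique N rs) (length rs) sel Des psi
      (λ {p} {q} l i i′ → sel-mono p q (chains-∈ rs i) (chains-∈ rs i′) l) lower′ least′

    actC : Vec (Fin N) N → Chain → Chain
    actC σ = map (act σ)

    actC-∈ : ∀ {σ c} → σ ∈ Sym N → c ∈ xs → actC σ c ∈ xs
    actC-∈ {σ} iσ i = ∈-chains rs (act-chain {σ = σ} (Sym-∈ iσ) (chains-∈ rs i))

    actC-sel : ∀ {σ} (p : Mask (length rs)) {c c′} → σ ∈ Sym N → c ∈ xs → c′ ∈ xs →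
               sel p c ≡ sel p c′ → sel p (actC σ c) ≡ sel p (actC σ c′)
    actC-sel {σ} p {c} {c′} _ _ _ e =
      trans (sel-map (act σ) p c) (trans (cong (actC σ) e) (sym (sel-map (act σ) p c′)))

    translate : ∀ {τ} → τ ∈ Sym N → (h : Chain → ℤ) → ∀ {c} → c ∈ xs →
                Σ (Sym N) (λ σ → h (actC σ (actC τ c))) ≡ Σ (Sym N) (λ σ → h (actC σ c))
    translate {τ} iτ h {c} _ =
      trans (Σ-ext (Sym N) (λ σ → cong h (trans (sym (map-∘ c)) (map-cong (act-⊙ σ τ) c))))
        (Σ-reindex (Vec.≡-dec Fin._≟_) (Sym-unique N) (Sym-unique N) (τ ⊙_)
          (λ {σ} i → ∈-Sym {σ = τ ⊙ σ} (⊙-permutation {σ = τ} {σ} (Sym-∈ iτ) (Sym-∈ i)))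
          (λ {σ} {ρ} _ _ → ⊙-cancel {τ = τ} {σ} {ρ} (Sym-∈ iτ))
          (λ {ρ} i → let σ , q , e = ⊙-solve {τ = τ} {ρ} (Sym-∈ iτ) (Sym-∈ i) in σ , ∈-Sym {σ = σ} q , e)
          (λ σ → h (actC σ c)))

    open Equivariant (Sym N) actC actC-∈ actC-sel translate
      (λ {p} f i i′ → sel-full p (chains-∈ rs i) (chains-∈ rs i′) f)

    -- Having one non-trivial block is invariant under permutations, so it passes from the combs to
    -- every element of `c`; niceness and the rank then leave only the comb.
    orbit-comb : ∀ {ts c σ} → Permutation σ → IsChain ts c → Nice c → actC σ c ≡ combs ts → c ≡ combs ts
    orbit-comb p [] [] e = refl
    orbit-comb {t ∷ ts} {x ∷ c} {σ} p (cons ex q s h) ((cx , sx) ∷ ns) e = cong₂ _∷_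
      (trans (convex-oneBlock ex cx sx
               (act-oneBlock {σ = σ} p (subst OneBlock (sym (∷-injectiveˡ e)) (comb-oneBlock t))))
             (cong comb q))
      (orbit-comb {σ = σ} p h ns (∷-injectiveʳ e))
      where open Path m

    combs-∈ : combs rs ∈ xs
    combs-∈ = ∈-chains rs (combs-chain inc)

    positivity : 0ℤ < Σ (masks (length rs)) (λ p → sgn p * Σ (Sym N) (fixed p))
    positivity = alternating-positive combs-∈
      -- Descents are taken above `bot`, which is `comb 0` and so opens the sequence of combs.
      (subst (λ y → isFull (D rs y (combs rs)) ≡ true) comb-zero (combs-full inc big))
      Nice (combs-nice big)
      (λ i i′ n e → nice-closed bot bot-partition (rank-bot {N}) (Path.bot-convex m) (bot-⊑-hd (chains-∈ rs i))
                      (chains-∈ rs i) (chains-∈ rs i′) inc n e)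
      (λ {c} {σ} i iσ n e → orbit-comb {σ = σ} (Sym-∈ iσ) (chains-∈ rs i) n e)
      (∈-Sym {σ = identity} identity-permutation)
      (trans (map-cong act-identity (combs rs)) (map-id (combs rs)))

    hd-sel : ∀ {ts} {c : Chain} (p : Mask (length ts)) → IsChain ts c → hd c ⊑ hd (sel p c)
    hd-sel [] [] = ⊑-refl
    hd-sel (true ∷ p)  (cons _ _ s h) = ⊑-refl
    hd-sel (false ∷ p) (cons _ _ s h) = ⊑-trans s (hd-sel p h)

    sel-chain : ∀ {ts} {c : Chain} (p : Mask (length ts)) → IsChain ts c → IsChain (sel p ts) (sel p c)
    sel-chain [] [] = []
    sel-chain (true ∷ p)  (cons e q s h) = cons e q (⊑-trans s (hd-sel p h)) (sel-chain p h)
    sel-chain (false ∷ p) (cons e q s h) = sel-chain p h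

    -- Missing ranks are filled from the bottom, each by interpolation below the next prescribed
    -- element or `top`.
    extend : ∀ {r ts d} lo (p : Mask (length ts)) → IsPartition lo → rank lo ℕ.≤ r → Increasing (suc m) r ts →
             lo ⊑ hd d → IsChain (sel p ts) d → ∃[ c ] (IsChain ts c × lo ⊑ hd c × sel p c ≡ d)
    extend lo [] elo l ([] _) s [] = [] , [] , s , refl
    extend lo (true ∷ p) elo l (_ ∷ i) s (cons {x = x} e q t h) =
      let c , h′ , t′ , e′ = extend x p e (ℕ.≤-reflexive q) i t h
      in x ∷ c , cons e q t′ h′ , s , cong (x ∷_) e′
    extend {ts = t ∷ ts} lo (false ∷ p) elo l (l′ ∷ i) s h =
      let between {x} ex lx xd qx = interpolate elo (hd-partition h) s {t}
                                      (ℕ.≤-trans l (ℕ.<⇒≤ l′)) (ℕ.<⇒≤ (hd-rank h (sel-increasing p i)))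
          c , h′ , t′ , e′ = extend x p ex (ℕ.≤-reflexive qx) i xd h
      in x ∷ c , cons ex qx t′ h′ , lx , e′

    all-fixed : ∀ (σ : Vec (Fin N) N) d → does (d ≟C actC σ d) ≡ allB (fixedBy σ) d
    all-fixed σ d = T-ext (λ t → all⁺ d (dec⁻ (d ≟C actC σ d) t)) (λ t → dec⁺ (d ≟C actC σ d) (all⁻ d t))
      where
      dec⁻ : ∀ {P : Set} (e : Dec P) → T (does e) → P
      dec⁻ (yes p) _ = p
      dec⁺ : ∀ {P : Set} (e : Dec P) → P → T (does e)
      dec⁺ (yes _) _ = _
      dec⁺ (no ¬p) p = ¬p p
      all⁺ : ∀ d → d ≡ actC σ d → T (allB (fixedBy σ) d)
      all⁺ []      e = _
      all⁺ (x ∷ d) e = from Bool.T-∧ (≡⇒fixedBy σ x (sym (∷-injectiveˡ e)) , all⁺ d (∷-injectiveʳ e))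
      all⁻ : ∀ d → T (allB (fixedBy σ) d) → d ≡ actC σ d
      all⁻ []      t = refl
      all⁻ (x ∷ d) t = let u , v = to (Bool.T-∧ {fixedBy σ x}) t
                       in cong₂ _∷_ (sym (fixedBy⇒≡ σ x u)) (all⁻ d v)

    -- The chains c with Des c ≼ p represent the chains with rank set sel p rs.
    fixed-count : ∀ p σ → fixed p σ ≡ + length (filterᵇ (allB (fixedBy σ)) (chainsWithRanks N (sel p rs)))
    fixed-count p σ =
      trans (Σ-ext xs (λ c → cong (λ b → ⟦ Des c ≼ p ⟧ * ⟦ b ⟧)
               (trans (cong (λ d → does (sel p c ≟C d)) (sel-map (act σ) p c)) (all-fixed σ (sel p c)))))
      (trans (sym (Σ-filterᵇ (λ c → Des c ≼ p) xs (λ c → K (sel p c))))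
      (trans (Σ-reindex _≟C_ (filter⁺ (λ c → T? (Des c ≼ p)) (chains-unique N rs)) (chains-unique N (sel p rs))
                (sel p) into inj surj K)
             (sym (length-filterᵇ (allB (fixedBy σ)) (chainsWithRanks N (sel p rs))))))
      where
      K : Chain → ℤ
      K d = ⟦ allB (fixedBy σ) d ⟧
      reps : List Chain
      reps = filterᵇ (λ c → Des c ≼ p) xs
      rep⁻ : ∀ {c} → c ∈ reps → c ∈ xs × (Des c ≼ p) ≡ true
      rep⁻ i = let j , t = ∈-filter⁻ (λ c → T? (Des c ≼ p)) {xs = xs} i in j , to T-≡ t
      into : ∀ {c} → c ∈ reps → sel p c ∈ chainsWithRanks N (sel p rs)
      into i = ∈-chains (sel p rs) (sel-chain p (chains-∈ rs (proj₁ (rep⁻ i))))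
      inj : ∀ {c c′} → c ∈ reps → c′ ∈ reps → sel p c ≡ sel p c′ → c ≡ c′
      inj i i′ e = let j , l = rep⁻ i ; j′ , l′ = rep⁻ i′ in representative-unique p j j′ l l′ e
      surj : ∀ {d} → d ∈ chainsWithRanks N (sel p rs) → ∃[ c ] (c ∈ reps × sel p c ≡ d)
      surj i =
        let h = chains-∈ (sel p rs) i
            c , h′ , _ , e = extend bot p bot-partition (ℕ.≤-reflexive (rank-bot {N})) inc (bot-⊑-hd h) h
            c′ , j , l , e′ = representative p (∈-chains rs h′)
        in c′ , ∈-filter⁺ (λ c → T? (Des c ≼ p)) j (from T-≡ l) , trans e′ e

  fixedSum : ℕ → List ℕ → ℤ
  fixedSum n ts = Σ (Sym n) (λ σ → + length (filterᵇ (allB (fixedBy σ)) (chainsWithRanks n ts)))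

  alternating-fixedSum : ∀ m rs → Increasing (suc m) 0 rs → All (2 ℕ.≤_) rs →
    0ℤ < Σ (masks (length rs)) (λ p → sgn p * fixedSum (suc (suc m)) (sel p rs))
  alternating-fixedSum m rs inc big = subst (0ℤ <_)
    (Σ-ext (masks (length rs)) (λ p → cong (sgn p *_) (Σ-ext (Sym (suc (suc m))) (λ σ → Positivity.fixed-count m rs inc big p σ))))
    (Positivity.positivity m rs inc big)

  -- The subset T of S whose indicator inside S is the given mask.
  expand-mask : ∀ {m} (S : Subset m) → Mask ∣ S ∣ → Subset m
  expand-mask []          p       = []
  expand-mask (true ∷ S)  (b ∷ p) = b ∷ expand-mask S p
  expand-mask (false ∷ S) p       = false ∷ expand-mask S p

  ranksOf-expand : ∀ {m} (S : Subset m) p → ranksOf (expand-mask S p) ≡ sel p (ranksOf S)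
  ranksOf-expand []          []          = refl
  ranksOf-expand (true ∷ S)  (true ∷ p)  =
    cong (1 ∷_) (trans (cong (map suc) (ranksOf-expand S p)) (sym (sel-map suc p (ranksOf S))))
  ranksOf-expand (true ∷ S)  (false ∷ p) = trans (cong (map suc) (ranksOf-expand S p)) (sym (sel-map suc p (ranksOf S)))
  ranksOf-expand (false ∷ S) p           = trans (cong (map suc) (ranksOf-expand S p)) (sym (sel-map suc p (ranksOf S)))

  length-ranksOf : ∀ {m} (S : Subset m) → length (ranksOf S) ≡ ∣ S ∣
  length-ranksOf []          = refl
  length-ranksOf (true ∷ S)  = cong suc (trans (length-map suc (ranksOf S)) (length-ranksOf S))
  length-ranksOf (false ∷ S) = trans (length-map suc (ranksOf S)) (length-ranksOf S)

  sign-suc : ∀ k → sign (suc k) ≡ - sign k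
  sign-suc zero          = refl
  sign-suc (suc zero)    = refl
  sign-suc (suc (suc k)) = sign-suc k

  ⊆-cons : ∀ {m} {T S : Subset m} s → does ((s ∷ T) ⊆? (s ∷ S)) ≡ does (T ⊆? S)
  ⊆-cons {T = T} {S} s = does-⇔ ((s ∷ T) ⊆? (s ∷ S)) (T ⊆? S) drop-∷-⊆ s⊆s

  ⊆-out : ∀ {m} {T S : Subset m} s → does ((false ∷ T) ⊆? (s ∷ S)) ≡ does (T ⊆? S)
  ⊆-out {T = T} {S} s = does-⇔ ((false ∷ T) ⊆? (s ∷ S)) (T ⊆? S) drop-∷-⊆ out⊆

  ⊆-in-out : ∀ {m} {T S : Subset m} → does ((true ∷ T) ⊆? (false ∷ S)) ≡ false
  ⊆-in-out {T = T} {S} = does-false ((true ∷ T) ⊆? (false ∷ S)) (λ s → no-head (s here))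
    where
    no-head : ¬ ((false ∷ S) [ zero ]= true)
    no-head ()

  -- By recursion on `S`: a coordinate outside `S` is forced to `false`, and leaving out an element
  -- of `S` flips the sign.
  subsets-masks : ∀ {m} (S : Subset m) (F : Subset m → ℤ) →
    Σ (subsets m) (λ T → ⟦ does (T ⊆? S) ⟧ * (sign (∣ S ∣ ∸ ∣ T ∣) * F T)) ≡
    Σ (masks ∣ S ∣) (λ p → sgn p * F (expand-mask S p))
  subsets-masks []          F = cong (_+ 0ℤ) (*-identityˡ (1ℤ * F []))
  subsets-masks {suc m} (true ∷ S)  F =
    trans (Σ-masks m _)
    (trans (cong₂ _+_
      (trans (Σ-ext (subsets m) (λ T → cong (λ b → ⟦ b ⟧ * (sign (∣ S ∣ ∸ ∣ T ∣) * F (true ∷ T))) (⊆-cons {T = T} {S} true)))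
             (subsets-masks S (λ T → F (true ∷ T))))
      (trans (Σ-ext (subsets m) (λ T →
               trans (cong (λ b → ⟦ b ⟧ * (sign (suc ∣ S ∣ ∸ ∣ T ∣) * F (false ∷ T))) (⊆-out {T = T} {S} true))
               -- The guard supplies `T ⊆ S`, hence |T| ≤ |S|; only then does the successor pass
               -- through the truncated subtraction.
               (trans (guard (T ⊆? S) (λ s →
                        trans (cong (λ k → sign k * F (false ∷ T)) (ℕ.+-∸-assoc 1 (p⊆q⇒∣p∣≤∣q∣ s)))
                        (trans (cong (_* F (false ∷ T)) (sign-suc (∣ S ∣ ∸ ∣ T ∣)))
                               (move (sign (∣ S ∣ ∸ ∣ T ∣)) (F (false ∷ T))))))
                      refl)))
      (trans (subsets-masks S (λ T → - F (false ∷ T)))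
             (Σ-ext (masks ∣ S ∣) (λ p → sym (move (sgn p) (F (false ∷ expand-mask S p))))))))
    (sym (Σ-masks ∣ S ∣ (λ p → sgn p * F (expand-mask (true ∷ S) p)))))
    where
    move : ∀ a b → - a * b ≡ a * - b
    move a b = trans (sym (neg-distribˡ-* a b)) (neg-distribʳ-* a b)
  subsets-masks {suc m} (false ∷ S) F =
    trans (Σ-masks m _)
    (trans (cong₂ _+_
      (trans (Σ-ext (subsets m) (λ T → cong (λ b → ⟦ b ⟧ * (sign (∣ S ∣ ∸ suc ∣ T ∣) * F (true ∷ T))) (⊆-in-out {T = T} {S})))
             (Σ-zero (subsets m)))
      (trans (Σ-ext (subsets m) (λ T → cong (λ b → ⟦ b ⟧ * (sign (∣ S ∣ ∸ ∣ T ∣) * F (false ∷ T))) (⊆-out {T = T} {S} false)))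
             (subsets-masks S (λ T → F (false ∷ T)))))
    (+-identityˡ _))

  map-suc-increasing : ∀ {b r rs} → Increasing b r rs → Increasing (suc b) (suc r) (map suc rs)
  map-suc-increasing ([] l)  = [] (s≤s l)
  map-suc-increasing (l ∷ i) = s≤s l ∷ map-suc-increasing i

  ranksOf-increasing : ∀ {m} (S : Subset m) → Increasing (suc m) 0 (ranksOf S)
  ranksOf-increasing []          = [] (s≤s z≤n)
  ranksOf-increasing (true ∷ S)  = s≤s z≤n ∷ map-suc-increasing (ranksOf-increasing S)
  ranksOf-increasing (false ∷ S) = weaken z≤n (map-suc-increasing (ranksOf-increasing S))

  ranksOf-≥2 : ∀ {m} (S : Subset (suc m)) → zero ∉ S → All (2 ℕ.≤_) (ranksOf S)
  ranksOf-≥2 (true ∷ S)  h = ⊥-elim (h here)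
  ranksOf-≥2 (false ∷ S) h = raise (positive S)
    where
    raise : ∀ {a rs} → All (a ℕ.≤_) rs → All (suc a ℕ.≤_) (map suc rs)
    raise []       = []
    raise (p ∷ ps) = s≤s p ∷ raise ps
    relax : ∀ {a rs} → All (suc a ℕ.≤_) rs → All (a ℕ.≤_) rs
    relax = All.map ℕ.<⇒≤
    positive : ∀ {m} (S : Subset m) → All (1 ℕ.≤_) (ranksOf S)
    positive []          = []
    positive (true ∷ S)  = s≤s z≤n ∷ relax (raise (positive S))
    positive (false ∷ S) = relax (raise (positive S))

  sumχβ-masks : ∀ m (S : Subset m) →
    sumχβ (suc (suc m)) S ≡ Σ (masks (length (ranksOf S))) (λ p → sgn p * fixedSum (suc (suc m)) (sel p (ranksOf S)))
  sumχβ-masks m S =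
    trans (Σ-foldr (filter (λ T → T ⊆? S) (subsets m)) (λ T → sign (∣ S ∣ ∸ ∣ T ∣) * + sumχα N T))
    (trans (Σ-filter (λ T → T ⊆? S) (subsets m) (λ T → sign (∣ S ∣ ∸ ∣ T ∣) * + sumχα N T))
    (trans (subsets-masks S (λ T → + sumχα N T))
    (trans (Σ-ext (masks ∣ S ∣) (λ p → cong (sgn p *_)
             (trans (Σ-sum (Sym N) (χα N (expand-mask S p))) (cong (fixedSum N) (ranksOf-expand S p)))))
           (cong (λ k → Σ (masks k) (λ p → sgn p * fixedSum N (sel p (ranksOf S)))) (sym (length-ranksOf S))))))
    where
    N = suc (suc m)

  sumχβ-positive : ∀ m (S : Subset (suc m)) → zero ∉ S → 0ℤ < sumχβ (suc (suc (suc m))) S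
  sumχβ-positive m S h = subst (0ℤ <_) (sym (sumχβ-masks (suc m) S))
    (alternating-fixedSum (suc m) (ranksOf S) (ranksOf-increasing S) (ranksOf-≥2 S h))

open import Defs
open import Data.Nat using (ℕ; _≤_; _∸_)
open import Data.Fin using (Fin; toℕ)
open import Data.Fin.Subset using (Subset; _∉_)
open import Data.Rational using (0ℚ; _<_)
open import Relation.Binary.PropositionalEquality using (_≡_)
open import Relation.Binary.PropositionalEquality using (refl)
open import Data.Nat using (suc; s≤s; NonZero; _!)
open import Data.Nat.Properties using (_!≢0)
open import Data.Integer using (ℤ; +_; 0ℤ; +<+) renaming (_<_ to _<ℤ_)
open import Data.Rational using (_/_)
open import Data.Rational.Properties using (positive⁻¹; normalize-pos)

/-positive : ∀ (i : ℤ) d .{{_ : NonZero d}} → 0ℤ <ℤ i → 0ℚ < i / d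
/-positive (+ suc k) d _ = positive⁻¹ (+ suc k / d) {{normalize-pos (suc k) d}}
/-positive (+ 0)     d (+<+ ())

theorem2p1 : (n : ℕ) → 3 ≤ n → (S : Subset (n ∸ 2)) →
    ((i : Fin (n ∸ 2)) → toℕ i ≡ 0 → i ∉ S) →
    0ℚ < b n S
theorem2p1 (suc (suc (suc m))) (s≤s (s≤s (s≤s _))) S 1∉S =
  /-positive (sumχβ n S) (n !) {{n !≢0}} (Multiplicity.sumχβ-positive m S (1∉S Fin.zero refl))
  where
  n : ℕ
  n = suc (suc (suc m))
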